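{- Let $G$ be a graph with a spanning triangle-tree. Then $G$ is not $\mathbb{Z}_3$-connected if and only if one of the following holds: (i) $G$ is $K_3$ or $K_4$; (ii) $G=K_3\bigoplus_2 G_1$ for some graph $G_1$ that is not $\mathbb{Z}_3$-connected and contains a spanning triangle-tree; (iii) $G$ is a bull-growing of some graph $H$ that is not $\mathbb{Z}_3$-connected and contains a spanning triangle-tree.
   Context: Graphs are finite, may contain parallel edges, but have no loops. Triangle-tree: a graph formed by starting with a triangle $x_1x_2x_3$ and then repeatedly (zero or more times) adding a new vertex $x_{j+1}$ joined to exactly two vertices $y,z$ that are adjacent in the graph already constructed (so $x_{j+1},y,z$ form a triangle). A spanning triangle-tree of $G$ is a subgraph of $G$ that is a triangle-tree and contains all vertices of $G$. $\mathbb{Z}_3$-connected: a $\mathbb{Z}_3$-boundary of $G$ is a map $\beta:V(G)\to\mathbb{Z}_3$ with $\sum_{v\in V(G)}\beta(v)\equiv 0\pmod 3$. $G$ is $\mathbb{Z}_3$-connected if for every $\mathbb{Z}_3$-boundary $\beta$ there is an orientation $D$ of $G$ with $d_D^+(v)-d_D^-(v)\equiv\beta(v)\pmod 3$ for every vertex $v$ (out-degree minus in-degree). $2$-sum: for subgraphs $A,B$ of $G$, $G=A\bigoplus_2 B$ means $E(G)=E(A)\cup E(B)$, $|E(A)\cap E(B)|=1$ and $|V(A)\cap V(B)|=2$ (with $V(G)=V(A)\cup V(B)$). In $G=K_3\bigoplus_2 G_1$, the subgraph $A$ is a triangle. Bull-reduction / bull-growing: let $u,v$ be two adjacent vertices of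 degree $3$ in a graph $G$ with a common neighbor $w$; let $a$ be the third neighbor of $u$ (other than $v,w$) and $b$ the third neighbor of $v$ (other than $u,w$); $a=b$ is allowed. Let $H=G-u-v+ab$, i.e. delete $u,v$ and add a new edge $ab$ (possibly parallel to existing edges), where if $a=b$ the resulting loop is deleted (so $H=G-u-v$). Then $H$ is called a bull-reduction of $G$, and $G$ is called a bull-growing of $H$. -}

module Defs where

open import Algebra.Properties.CommutativeMonoid.Sum using ()
open import Data.Bool using (Bool; if_then_else_)
open import Data.Fin using (Fin; zero; suc; toℕ; _≟_)
open import Data.Fin.Patterns using (0F; 1F; 2F; 3F; 4F; 5F)
open import Data.Fin.Properties using (any?; suc-injective)
open import Data.Fin.Subset using (Subset; ⊤; _∪_; _∩_; ∁; ⁅_⁆; ∣_∣)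
open import Data.Integer using (+_; _-_)
open import Data.Integer.Divisibility using (_∣_)
open import Data.Nat using (ℕ; suc)
import Data.Nat.Divisibility as ℕ
open import Data.Nat.Properties using (+-0-commutativeMonoid)
open import Data.Product using (Σ-syntax; ∃-syntax; _×_; _,_)
open import Data.Sum using (_⊎_)
open import Data.Vec using (_∷_; []; lookup; tabulate)
open import Function using (_∘_)
open import Function.Definitions using (Injective)
open import Relation.Binary.PropositionalEquality using (_≡_; _≢_)
open import Relation.Nullary using (does; yes; no)
open import Relation.Nullary.Decidable using (_⊎-dec_)
open import Relation.Unary using (Pred; Decidable)

open Algebra.Properties.CommutativeMonoid.Sum +-0-commutativeMonoid using (sum)

-- The subset { i | P i } of Fin n.
comprehension : ∀ {n p} {P : Pred (Fin n) p} → Decidable P → Subset n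
comprehension P? = tabulate (does ∘ P?)

-- Finite loopless multigraphs.  Edges have identities, so parallel edges are
-- distinct elements of Fin size.  Edges are undirected: the order of the two
-- ends src e, tgt e is an arbitrary labelling, ignored by all notions below.
record Graph : Set where
  field
    order    : ℕ
    size     : ℕ
    src      : Fin size → Fin order
    tgt      : Fin size → Fin order
    loopless : ∀ e → src e ≢ tgt e

  Vertex : Set
  Vertex = Fin order

  Edge : Set
  Edge = Fin size

  Joins : Edge → Vertex → Vertex → Set
  Joins e x y = (src e ≡ x × tgt e ≡ y) ⊎ (src e ≡ y × tgt e ≡ x)

  Adjacent : Vertex → Vertex → Set
  Adjacent x y = ∃[ e ] Joins e x y

  incident : Vertex → Subset size
  incident x = comprehension (λ e → (src e ≟ x) ⊎-dec (tgt e ≟ x))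

  -- Parallel edges are counted with multiplicity.
  degree : Vertex → ℕ
  degree x = ∣ incident x ∣

infix 4 _↪_ _≅_ _≡_⊕₂_ _IsBullReductionOf_ _IsBullGrowingOf_

open Graph using (order; size; src; tgt; loopless; Vertex; Edge)

-- H ↪ G exhibits H, up to isomorphism, as a subgraph of G.
record _↪_ (H G : Graph) : Set where
  field
    onV         : Vertex H → Vertex G
    onE         : Edge H → Edge G
    onV-inj     : Injective _≡_ _≡_ onV
    onE-inj     : Injective _≡_ _≡_ onE
    onE-joins   : ∀ e → Graph.Joins G (onE e) (onV (src H e)) (onV (tgt H e))

  V⟨_⟩ : Subset (order G)
  V⟨_⟩ = comprehension (λ x → any? (λ y → onV y ≟ x))

  E⟨_⟩ : Subset (size G)
  E⟨_⟩ = comprehension (λ e → any? (λ f → onE f ≟ e))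

open _↪_ using (onV; V⟨_⟩; E⟨_⟩)

_≅_ : Graph → Graph → Set
H ≅ G = Σ[ ι ∈ H ↪ G ] (V⟨ ι ⟩ ≡ ⊤ × E⟨ ι ⟩ ≡ ⊤)

K₃ : Graph
K₃ = record
  { order = 3
  ; size = 3
  ; src = lookup (0F ∷ 0F ∷ 1F ∷ [])
  ; tgt = lookup (1F ∷ 2F ∷ 2F ∷ [])
  ; loopless = λ { 0F () ; 1F () ; 2F () }
  }

K₄ : Graph
K₄ = record
  { order = 4
  ; size = 6
  ; src = lookup (0F ∷ 0F ∷ 0F ∷ 1F ∷ 1F ∷ 2F ∷ [])
  ; tgt = lookup (1F ∷ 2F ∷ 3F ∷ 2F ∷ 3F ∷ 3F ∷ [])
  ; loopless = λ { 0F () ; 1F () ; 2F () ; 3F () ; 4F () ; 5F () }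
  }

-- G plus a new vertex (numbered zero, the old ones being shifted by suc)
-- joined by one edge to y and by one edge to z.
attach : (G : Graph) → Vertex G → Vertex G → Graph
attach G y z = record
  { order = suc (order G)
  ; size = suc (suc (size G))
  ; src = λ { zero → zero ; (suc zero) → zero ; (suc (suc e)) → suc (src G e) }
  ; tgt = λ { zero → suc y ; (suc zero) → suc z ; (suc (suc e)) → suc (tgt G e) }
  ; loopless = λ { zero () ; (suc zero) () ; (suc (suc e)) → loopless G e ∘ suc-injective }
  }

-- Every triangle-tree is isomorphic to one of these, which are the ones whose
-- vertices and edges are numbered according to their construction.
data TriangleTree : Graph → Set where
  triangle : TriangleTree K₃
  grow     : ∀ {T y z} → TriangleTree T → Graph.Adjacent T y z → TriangleTree (attach T y z)

HasSpanningTriangleTree : Graph → Set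
HasSpanningTriangleTree G =
  ∃[ T ] (TriangleTree T × Σ[ ι ∈ T ↪ G ] V⟨ ι ⟩ ≡ ⊤)

module _ (G : Graph) where

  open Graph G using () renaming (src to s; tgt to t)

  -- D e = true orients e from src e to tgt e, D e = false the other way.
  Orientation : Set
  Orientation = Edge G → Bool

  tail head : Orientation → Edge G → Vertex G
  tail D e = if D e then s e else t e
  head D e = if D e then t e else s e

  outdegree indegree : Orientation → Vertex G → ℕ
  outdegree D x = ∣ comprehension (λ e → tail D e ≟ x) ∣
  indegree  D x = ∣ comprehension (λ e → head D e ≟ x) ∣

  IsBoundary : (Vertex G → Fin 3) → Set
  IsBoundary β = 3 ℕ.∣ sum (toℕ ∘ β)

  Realizes : Orientation → (Vertex G → Fin 3) → Set
  Realizes D β = ∀ x → + 3 ∣ ((+ outdegree D x - + indegree D x) - + toℕ (β x))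

  Z₃-Connected : Set
  Z₃-Connected = ∀ β → IsBoundary β → ∃[ D ] Realizes D β

-- A and B are given up to isomorphism, by their embeddings as subgraphs of G.
record _≡_⊕₂_ (G A B : Graph) : Set where
  field
    ιA         : A ↪ G
    ιB         : B ↪ G
    V-cover    : V⟨ ιA ⟩ ∪ V⟨ ιB ⟩ ≡ ⊤
    E-cover    : E⟨ ιA ⟩ ∪ E⟨ ιB ⟩ ≡ ⊤
    V-overlap  : ∣ V⟨ ιA ⟩ ∩ V⟨ ιB ⟩ ∣ ≡ 2
    E-overlap  : ∣ E⟨ ιA ⟩ ∩ E⟨ ιB ⟩ ∣ ≡ 1

-- G + xy, where nothing is added if the new edge would be a loop.
addEdge : (G : Graph) → Vertex G → Vertex G → Graph
addEdge G x y with x ≟ y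
... | yes _   = G
... | no  x≢y = record
  { order = order G
  ; size = suc (size G)
  ; src = λ { zero → x ; (suc e) → src G e }
  ; tgt = λ { zero → y ; (suc e) → tgt G e }
  ; loopless = λ { zero → x≢y ; (suc e) → loopless G e }
  }

-- G′ is G - u - v, and a′, b′ are the vertices a, b of G as vertices of G′.
record _IsBullReductionOf_ (H G : Graph) : Set where
  open Graph G using (Adjacent; degree; incident)
  field
    u v w a b : Vertex G
    u~v : Adjacent u v
    u~w : Adjacent u w
    v~w : Adjacent v w
    deg-u : degree u ≡ 3
    deg-v : degree v ≡ 3
    u~a : Adjacent u a
    a≢v : a ≢ v
    a≢w : a ≢ w
    v~b : Adjacent v b
    b≢u : b ≢ u
    b≢w : b ≢ w
    G′ : Graph
    ι  : G′ ↪ G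
    V-deleted : V⟨ ι ⟩ ≡ ∁ (⁅ u ⁆ ∪ ⁅ v ⁆)
    E-deleted : E⟨ ι ⟩ ≡ ∁ (incident u ∪ incident v)
    a′ b′ : Vertex G′
    a′↦a : onV ι a′ ≡ a
    b′↦b : onV ι b′ ≡ b
    H≅G′+ab : H ≅ addEdge G′ a′ b′

_IsBullGrowingOf_ : Graph → Graph → Set
G IsBullGrowingOf H = H IsBullReductionOf G

{-# OPTIONS --safe #-}
{-
Modulo 3, an orientation adds to the boundary ±(x − y) for each edge xy, and G is
ℤ₃-connected as soon as every boundary can be realized off one vertex.  A triangle-tree
with one edge doubled is ℤ₃-connected, and directing a path p – u – q through u acts as
an edge pq.  Hence if G is not ℤ₃-connected, a leaf u of the spanning triangle-tree T,
attached to the edge pq, has degree at most 3: with two further edges ua, ua′ these could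
carry the value of u while p – u – q doubles pq.  Degree 2 is case (ii).  If all leaves
have degree 3, a boundary that is not realizable vanishes on them, and each leaf is a
source or a sink, by free choice.

If T has at least four vertices, it ends in a triangle vwc, attached to the rest along
wc, on whose edges vw and vc there hang k ≥ 1 leaves.  If k = 1 and the leaf is u, then
either v has a further edge, and the choice of source or sink at u leaves at v a nonzero
value that this edge can carry; or v has degree 3, and u, v form a bull with w, or G is K₄.
If k ≥ 2 and two of the leaves are adjacent, they form a bull with v.  Otherwise, the
choices at two leaves give v all three values, in particular 0, and then w – v – c doubles
the edge wc of the rest of T.

Conversely, an unrealizable boundary of the smaller graph lifts to G: give the new vertex
of a triangle the value 1, which forces both its edges, and the vertices u, v of a bull
the value 0, which makes one of them a source and the other a sink, so that the bull acts
as the edge ab.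
-}
module Submission where

open import Defs
open import Algebra.Bundles using (CommutativeMonoid)
import Algebra.Properties.CommutativeMonoid.Sum as Summation
open import Data.Bool using (Bool; true; false; if_then_else_)
open import Data.Empty using (⊥; ⊥-elim)
open import Data.Fin using (Fin; zero; suc; toℕ; _≟_)
open import Data.Fin.Patterns using (0F; 1F; 2F; 3F; 4F; 5F)
open import Data.Fin.Properties using (all?; any?; punchInᵢ≢i; suc-injective; ¬∀⟶∃¬)
open import Data.Fin.Subset using (Subset; ∣_∣; ⊤; _∪_; _∩_; ∁; ⁅_⁆; inside; outside)
  renaming (_∈_ to _∈ˢ_; _∉_ to _∉ˢ_; _-_ to _-ˢ_)
open import Data.Fin.Subset.Properties
  using ( ∈⊤; ⊆⊤; ⊆-antisym; p─⊥≡p; p─q⊆p; x∈p∧x≢y⇒x∈p-y; x∈p∪q⁺; x∈p∪q⁻; x∈p∩q⁺; x∈p∩q⁻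
        ; x∈∁p⇒x∉p; x∉p⇒x∈∁p; x∉∁p⇒x∈p; x∈⁅x⁆; x∈⁅y⁆⇒x≡y; Empty-unique; ∣⊥∣≡0; nonempty?)
  renaming (_∈?_ to _∈ˢ?_)
open import Data.Integer using (+_)
import Data.Integer as ℤ
import Data.Integer.Divisibility as ℤ
import Data.Integer.Properties as ℤ
open import Data.List using (List; []; _∷_; _++_; map; allFin; filter; length; lookup; tabulate)
import Data.List.Membership.DecPropositional as DecMembership
open import Data.List.Membership.Propositional using (_∈_; _∉_)
open import Data.List.Membership.Propositional.Properties
  using ( ∈-allFin; ∈-filter⁺; ∈-filter⁻; ∈-++⁺ˡ; ∈-++⁺ʳ; ∈-map⁺; ∈-map⁻; ∈-lookup; ∈-tabulate⁺; ∈-tabulate⁻)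
open import Data.List.Membership.Propositional.Properties.WithK using (unique∧set⇒bag)
import Data.List.Properties as List
open import Data.List.Relation.Binary.BagAndSetEquality using (∼bag⇒↭)
import Data.List.Relation.Binary.Permutation.Propositional as Perm
open Perm using (_↭_; refl; prep; swap; ↭-sym; ↭-trans; ↭⇒↭ₛ)
import Data.List.Relation.Binary.Permutation.Propositional.Properties as Perm
import Data.List.Relation.Binary.Permutation.Setoid.Properties as Permₛ
open import Data.List.Relation.Unary.All using (All; []; _∷_)
import Data.List.Relation.Unary.All as All
import Data.List.Relation.Unary.All.Properties as All
open import Data.List.Relation.Unary.AllPairs using ([]; _∷_)
open import Data.List.Relation.Unary.Any using (here; there; index)
open import Data.List.Relation.Unary.Any.Properties using (lookup-index)
open import Data.List.Relation.Unary.Unique.Propositional using (Unique)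
import Data.List.Relation.Unary.Unique.Propositional.Properties as Unique
open import Data.Nat using (ℕ; zero; suc; _+_; _*_)
import Data.Nat as ℕ
import Data.Nat.Divisibility as ℕ
import Data.Nat.Properties as ℕ
open import Data.Product using (_×_; _,_; ∃-syntax; Σ-syntax; proj₁; proj₂)
open import Data.Sum using (_⊎_; inj₁; inj₂; [_,_]′)
open import Data.Unit using (tt) renaming (⊤ to Unit)
import Data.Vec as Vec
import Data.Vec.Properties as Vec
open import Function using (_∘_; id; const)
open import Function.Bundles using (_⇔_; mk⇔)
open import Function.Definitions using (Injective)
open import Relation.Binary.PropositionalEquality
  using (_≡_; _≢_; _≗_; refl; sym; trans; cong; cong₂; subst; isEquivalence; setoid)
open import Relation.Nullary using (¬_; Dec; yes; no; does; contradiction)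
open import Relation.Nullary.Decidable
  using (from-yes; from-no; map′; dec-true; dec-false; decidable-stable; ¬?; _→-dec_; _⊎-dec_; _×-dec_)
open import Relation.Unary using (Pred; Decidable)

open Graph using (order; size; src; tgt; loopless; Vertex; Edge; Joins)
open _↪_

-- Arithmetic of ℤ₃

-- The number three enters through small counts. Two edges at a vertex produce the outflow 2, 0 or
-- -2, which are all the residues modulo 3, the nonzero ones in a single way each: two free edges
-- meet any demand, and a demand of 1 or 2 dictates both. Three edges produce ±1 or ±3, so a demand
-- of 0 leaves only source and sink. The obstacle is the order of construction. A spanning
-- triangle-tree comes with one order, in which the leaves of the ending triangle may be interleaved
-- with unrelated vertices, while the argument needs that triangle to be followed by its own leaves
-- only. Such an order is maintained while the tree grows: a vertex attached to the rest of the tree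
-- is moved below the triangle, and a vertex attached along an edge at a leaf turns this leaf into
-- the top of a new ending triangle. Edges outside the tree may be directed arbitrarily only as long
-- as this preserves what the boundary is assumed to satisfy at the leaves; hence all edges at the
-- leaves concerned are listed before the others are disposed of.

Z₃ : Set
Z₃ = Fin 3

infixl 6 _⊞_ _⊟_

_⊞_ : Z₃ → Z₃ → Z₃
0F ⊞ b  = b
1F ⊞ 0F = 1F
1F ⊞ 1F = 2F
1F ⊞ 2F = 0F
2F ⊞ 0F = 2F
2F ⊞ 1F = 0F
2F ⊞ 2F = 1F

neg : Z₃ → Z₃
neg 0F = 0F
neg 1F = 2F
neg 2F = 1F

_⊟_ : Z₃ → Z₃ → Z₃
a ⊟ b = a ⊞ neg b

⊞-assoc : ∀ a b c → (a ⊞ b) ⊞ c ≡ a ⊞ (b ⊞ c)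
⊞-assoc = from-yes (all? λ a → all? λ b → all? λ c → ((a ⊞ b) ⊞ c) ≟ (a ⊞ (b ⊞ c)))

⊞-comm : ∀ a b → a ⊞ b ≡ b ⊞ a
⊞-comm = from-yes (all? λ a → all? λ b → (a ⊞ b) ≟ (b ⊞ a))

⊞-identityʳ : ∀ a → a ⊞ 0F ≡ a
⊞-identityʳ = from-yes (all? λ a → (a ⊞ 0F) ≟ a)

⊟-self : ∀ a → a ⊟ a ≡ 0F
⊟-self = from-yes (all? λ a → (a ⊟ a) ≟ 0F)

⊟-swap : ∀ a b c → a ⊟ b ⊟ c ≡ a ⊟ c ⊟ b
⊟-swap = from-yes (all? λ a → all? λ b → all? λ c → (a ⊟ b ⊟ c) ≟ (a ⊟ c ⊟ b))

⊞-swap : ∀ a b c → a ⊞ b ⊞ c ≡ a ⊞ c ⊞ b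
⊞-swap = from-yes (all? λ a → all? λ b → all? λ c → (a ⊞ b ⊞ c) ≟ (a ⊞ c ⊞ b))

⊟-⊞-swap : ∀ a b c → a ⊟ b ⊞ c ≡ a ⊞ c ⊟ b
⊟-⊞-swap = from-yes (all? λ a → all? λ b → all? λ c → (a ⊟ b ⊞ c) ≟ (a ⊞ c ⊟ b))

⊟-flip : ∀ a b c → a ⊟ (b ⊟ c) ≡ a ⊞ (c ⊟ b)
⊟-flip = from-yes (all? λ a → all? λ b → all? λ c → (a ⊟ (b ⊟ c)) ≟ (a ⊞ (c ⊟ b)))

⊞-flip : ∀ a b c → a ⊞ (b ⊟ c) ≡ a ⊟ (c ⊟ b)
⊞-flip = from-yes (all? λ a → all? λ b → all? λ c → (a ⊞ (b ⊟ c)) ≟ (a ⊟ (c ⊟ b)))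

⊟-lift : ∀ a p q u → a ⊟ (p ⊟ q) ≡ a ⊞ (u ⊟ p) ⊟ (u ⊟ q)
⊟-lift = from-yes (all? λ a → all? λ p → all? λ q → all? λ u →
           (a ⊟ (p ⊟ q)) ≟ (a ⊞ (u ⊟ p) ⊟ (u ⊟ q)))

⊞-lift : ∀ a p q u → a ⊞ (p ⊟ q) ≡ a ⊟ (u ⊟ p) ⊞ (u ⊟ q)
⊞-lift = from-yes (all? λ a → all? λ p → all? λ q → all? λ u →
           (a ⊞ (p ⊟ q)) ≟ (a ⊟ (u ⊟ p) ⊞ (u ⊟ q)))

⊞-cancelʳ : ∀ a b c → a ⊞ c ≡ b ⊞ c → a ≡ b
⊞-cancelʳ = from-yes (all? λ a → all? λ b → all? λ c → ((a ⊞ c) ≟ (b ⊞ c)) →-dec (a ≟ b))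
⊞-0-commutativeMonoid : CommutativeMonoid _ _
⊞-0-commutativeMonoid = record
  { Carrier = Z₃ ; _≈_ = _≡_ ; _∙_ = _⊞_ ; ε = 0F
  ; isCommutativeMonoid = record
    { isMonoid = record
      { isSemigroup = record
        { isMagma = record { isEquivalence = isEquivalence ; ∙-cong = cong₂ _⊞_ }
        ; assoc = ⊞-assoc }
      ; identity = (λ _ → refl) , ⊞-identityʳ }
    ; comm = ⊞-comm } }

module Σ₃ = Summation ⊞-0-commutativeMonoid
module Σℕ = Summation ℕ.+-0-commutativeMonoid

[_]₃ : ℕ → Z₃
[ zero ]₃  = 0F
[ suc n ]₃ = 1F ⊞ [ n ]₃

[+]₃ : ∀ m n → [ m + n ]₃ ≡ [ m ]₃ ⊞ [ n ]₃
[+]₃ zero n = refl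
[+]₃ (suc m) n = trans (cong (1F ⊞_) ([+]₃ m n)) (sym (⊞-assoc 1F [ m ]₃ [ n ]₃))

[toℕ]₃ : ∀ z → [ toℕ z ]₃ ≡ z
[toℕ]₃ = from-yes (all? λ z → [ toℕ z ]₃ ≟ z)

[]₃-cycle : ∀ z → 1F ⊞ (1F ⊞ (1F ⊞ z)) ≡ z
[]₃-cycle = from-yes (all? λ z → (1F ⊞ (1F ⊞ (1F ⊞ z))) ≟ z)

∣⇒[]₃≡0 : ∀ {n} → 3 ℕ.∣ n → [ n ]₃ ≡ 0F
∣⇒[]₃≡0 (ℕ.divides k refl) = go k
  where
  go : ∀ k → [ k * 3 ]₃ ≡ 0F
  go zero    = refl
  go (suc k) = trans ([]₃-cycle _) (go k)

[]₃≡0⇒∣ : ∀ n → [ n ]₃ ≡ 0F → 3 ℕ.∣ n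
[]₃≡0⇒∣ 0 _ = 3 ℕ.∣0
[]₃≡0⇒∣ (suc (suc (suc n))) eq =
  ℕ.∣m∣n⇒∣m+n (ℕ.∣-refl {3}) ([]₃≡0⇒∣ n (trans (sym ([]₃-cycle _)) eq))

∣⊖∣⇒≡₃ : ∀ m n → 3 ℕ.∣ ℤ.∣ m ℤ.⊖ n ∣ → [ m ]₃ ≡ [ n ]₃
∣⊖∣⇒≡₃ zero    zero    d = refl
∣⊖∣⇒≡₃ zero    (suc n) d = sym (∣⇒[]₃≡0 d)
∣⊖∣⇒≡₃ (suc m) zero    d = ∣⇒[]₃≡0 d
∣⊖∣⇒≡₃ (suc m) (suc n) d =
  cong (1F ⊞_) (∣⊖∣⇒≡₃ m n (subst (λ i → 3 ℕ.∣ ℤ.∣ i ∣) (ℤ.[1+m]⊖[1+n]≡m⊖n m n) d))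

≡₃⇒∣⊖∣ : ∀ m n → [ m ]₃ ≡ [ n ]₃ → 3 ℕ.∣ ℤ.∣ m ℤ.⊖ n ∣
≡₃⇒∣⊖∣ zero    zero    eq = 3 ℕ.∣0
≡₃⇒∣⊖∣ zero    (suc n) eq = []₃≡0⇒∣ (suc n) (sym eq)
≡₃⇒∣⊖∣ (suc m) zero    eq = []₃≡0⇒∣ (suc m) eq
≡₃⇒∣⊖∣ (suc m) (suc n) eq = subst (λ i → 3 ℕ.∣ ℤ.∣ i ∣) (sym (ℤ.[1+m]⊖[1+n]≡m⊖n m n))
  (≡₃⇒∣⊖∣ m n (⊞-cancelʳ _ _ 1F (trans (⊞-comm [ m ]₃ 1F) (trans eq (⊞-comm 1F [ n ]₃)))))

sub-sub : ∀ a b c → (+ a ℤ.- + b) ℤ.- + c ≡ a ℤ.⊖ (b + c)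
sub-sub a b c =
  trans (ℤ.+-assoc (+ a) (ℤ.- (+ b)) (ℤ.- (+ c)))
    (trans (cong (λ i → + a ℤ.+ i) (sym (ℤ.neg-distrib-+ (+ b) (+ c)))) (ℤ.m-n≡m⊖n a (b + c)))

[+toℕ]₃ : ∀ b z → [ b + toℕ z ]₃ ≡ [ b ]₃ ⊞ z
[+toℕ]₃ b z = trans ([+]₃ b (toℕ z)) (cong ([ b ]₃ ⊞_) ([toℕ]₃ z))

-- Moving the in-degree and the boundary value to the other side turns divisibility of an integer
-- difference into an equation in ℤ₃, so that integers need not be mentioned again.
congruent⇒ : ∀ a b z → + 3 ℤ.∣ (+ a ℤ.- + b) ℤ.- + toℕ z → [ a ]₃ ≡ [ b ]₃ ⊞ z
congruent⇒ a b z d = trans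
  (∣⊖∣⇒≡₃ a (b + toℕ z) (subst (λ i → 3 ℕ.∣ ℤ.∣ i ∣) (sub-sub a b (toℕ z)) d)) ([+toℕ]₃ b z)

⇒congruent : ∀ a b z → [ a ]₃ ≡ [ b ]₃ ⊞ z → + 3 ℤ.∣ (+ a ℤ.- + b) ℤ.- + toℕ z
⇒congruent a b z eq = subst (λ i → 3 ℕ.∣ ℤ.∣ i ∣) (sym (sub-sub a b (toℕ z)))
  (≡₃⇒∣⊖∣ a (b + toℕ z) (trans eq (sym ([+toℕ]₃ b z))))

[sum]₃ : ∀ {n} (f : Fin n → ℕ) → [ Σℕ.sum f ]₃ ≡ Σ₃.sum (λ i → [ f i ]₃)
[sum]₃ {zero}  f = refl
[sum]₃ {suc n} f = trans ([+]₃ (f 0F) _) (cong ([ f 0F ]₃ ⊞_) ([sum]₃ (f ∘ suc)))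

-- Realizable boundaries of edge lists

private
  variable
    n : ℕ

Pair : ℕ → Set
Pair n = Fin n × Fin n

single : Fin n → Z₃ → Fin n → Z₃
single p z x = if does (p ≟ x) then z else 0F

-- The net outflow caused by an arc from `p` to `q`. A loop is allowed and gives 0, so that the bull
-- computations also cover `a = b`.
δ : Pair n → Fin n → Z₃
δ (p , q) x = single p 1F x ⊟ single q 1F x

single-≡ : ∀ (p : Fin n) z → single p z p ≡ z
single-≡ p z rewrite dec-true (p ≟ p) refl = refl

single-≢ : ∀ {p x : Fin n} z → p ≢ x → single p z x ≡ 0F
single-≢ {p = p} {x} z p≢x rewrite dec-false (p ≟ x) p≢x = refl

-- The edges in es can be oriented so that out minus in equals β at the vertices in A.
data R {n : ℕ} (A : Fin n → Set) : List (Pair n) → (Fin n → Z₃) → Set where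
  done : ∀ {β} → (∀ x → A x → β x ≡ 0F) → R A [] β
  fwd  : ∀ {e es β} → R A es (λ x → β x ⊟ δ e x) → R A (e ∷ es) β
  bwd  : ∀ {e es β} → R A es (λ x → β x ⊞ δ e x) → R A (e ∷ es) β

-- The sum of `β` is left free: in the applications `A` leaves out a root, which absorbs any excess.
Full : (Fin n → Set) → List (Pair n) → Set
Full A es = ∀ β → R A es β

Avoids : Fin n → List (Pair n) → Set
Avoids x = All (λ e → proj₁ e ≢ x × proj₂ e ≢ x)

R-cong : ∀ {A : Fin n → Set} {es β γ} → (∀ x → A x → β x ≡ γ x) → R A es β → R A es γ
R-cong eq (done r) = done λ x a → trans (sym (eq x a)) (r x a)
R-cong eq (fwd {e} r) = fwd (R-cong (λ x a → cong (_⊟ δ e x) (eq x a)) r)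
R-cong eq (bwd {e} r) = bwd (R-cong (λ x a → cong (_⊞ δ e x) (eq x a)) r)

R-ext : ∀ {A : Fin n → Set} {es β γ} → β ≗ γ → R A es β → R A es γ
R-ext eq = R-cong (λ x _ → eq x)

R-mono : ∀ {A B : Fin n → Set} {es β} → (∀ x → B x → A x) → R A es β → R B es β
R-mono f (done r) = done λ x b → r x (f x b)
R-mono f (fwd r) = fwd (R-mono f r)
R-mono f (bwd r) = bwd (R-mono f r)

R-∷ : ∀ {A B : Fin n → Set} {e es fs β} → (∀ {γ} → R A es γ → R B fs γ) → R A (e ∷ es) β → R B (e ∷ fs) β
R-∷ f (fwd r) = fwd (f r)
R-∷ f (bwd r) = bwd (f r)

R-↭ : ∀ {A : Fin n → Set} {es fs β} → es ↭ fs → R A es β → R A fs β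
R-↭ refl r = r
R-↭ (prep e p) = R-∷ (R-↭ p)
R-↭ {β = β} (swap e f p) = λ where
  (fwd (fwd r)) → fwd (fwd (R-ext (λ x → ⊟-swap (β x) (δ e x) (δ f x)) (R-↭ p r)))
  (fwd (bwd r)) → bwd (fwd (R-ext (λ x → ⊟-⊞-swap (β x) (δ e x) (δ f x)) (R-↭ p r)))
  (bwd (fwd r)) → fwd (bwd (R-ext (λ x → sym (⊟-⊞-swap (β x) (δ f x) (δ e x))) (R-↭ p r)))
  (bwd (bwd r)) → bwd (bwd (R-ext (λ x → ⊞-swap (β x) (δ e x) (δ f x)) (R-↭ p r)))
R-↭ (Perm.trans p q) r = R-↭ q (R-↭ p r)

R-flip : ∀ {A : Fin n → Set} {p q es β} → R A ((p , q) ∷ es) β → R A ((q , p) ∷ es) β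
R-flip {p = p} {q} {β = β} (fwd r) = bwd (R-ext (λ x → ⊟-flip (β x) (single p 1F x) (single q 1F x)) r)
R-flip {p = p} {q} {β = β} (bwd r) = fwd (R-ext (λ x → ⊞-flip (β x) (single p 1F x) (single q 1F x)) r)

-- Directing the path p – u – q through u replaces directing an edge pq.
R-lift : ∀ {A : Fin n → Set} u {p q es β} → R A ((p , q) ∷ es) β → R A ((u , p) ∷ (u , q) ∷ es) β
R-lift u {p} {q} {β = β} (fwd r) =
  bwd (fwd (R-ext (λ x → ⊟-lift (β x) (single p 1F x) (single q 1F x) (single u 1F x)) r))
R-lift u {p} {q} {β = β} (bwd r) =
  fwd (bwd (R-ext (λ x → ⊞-lift (β x) (single p 1F x) (single q 1F x) (single u 1F x)) r))

R-loop⁻ : ∀ {A : Fin n → Set} {p es β} → R A ((p , p) ∷ es) β → R A es β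
R-loop⁻ {p = p} {β = β} (fwd r) =
  R-ext (λ x → trans (cong (β x ⊟_) (⊟-self (single p 1F x))) (⊞-identityʳ (β x))) r
R-loop⁻ {p = p} {β = β} (bwd r) =
  R-ext (λ x → trans (cong (β x ⊞_) (⊟-self (single p 1F x))) (⊞-identityʳ (β x))) r

R-loop⁺ : ∀ {A : Fin n → Set} {p es β} → R A es β → R A ((p , p) ∷ es) β
R-loop⁺ {p = p} {β = β} r =
  bwd (R-ext (λ x → sym (trans (cong (β x ⊞_) (⊟-self (single p 1F x))) (⊞-identityʳ (β x)))) r)

δ-avoid : ∀ {p q x : Fin n} → p ≢ x → q ≢ x → δ (p , q) x ≡ 0F
δ-avoid p≢x q≢x = cong₂ _⊟_ (single-≢ 1F p≢x) (single-≢ 1F q≢x)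

⊟-avoid : ∀ {p q x : Fin n} z → p ≢ x → q ≢ x → z ⊟ δ (p , q) x ≡ z
⊟-avoid z p≢x q≢x = trans (cong (z ⊟_) (δ-avoid p≢x q≢x)) (⊞-identityʳ z)

⊞-avoid : ∀ {p q x : Fin n} z → p ≢ x → q ≢ x → z ⊞ δ (p , q) x ≡ z
⊞-avoid z p≢x q≢x = trans (cong (z ⊞_) (δ-avoid p≢x q≢x)) (⊞-identityʳ z)

δ-fst : ∀ {p q : Fin n} → q ≢ p → δ (p , q) p ≡ 1F
δ-fst {p = p} q≢p = cong₂ _⊟_ (single-≡ p 1F) (single-≢ 1F q≢p)

-- Edges that miss `x` leave its value as it is, so the final demand that it be 0 is already a
-- demand on `β`.
R⇒≡0 : ∀ {A : Fin n → Set} {es β x} → A x → Avoids x es → R A es β → β x ≡ 0F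
R⇒≡0 a [] (done r) = r _ a
R⇒≡0 a ((p , q) ∷ av) (fwd {β = β} r) = trans (sym (⊟-avoid (β _) p q)) (R⇒≡0 a av r)
R⇒≡0 a ((p , q) ∷ av) (bwd {β = β} r) = trans (sym (⊞-avoid (β _) p q)) (R⇒≡0 a av r)

-- This is how a vertex returns to the set of served vertices once its own edges have brought its
-- value to 0.
R-extend : ∀ {A B : Fin n → Set} {es β u} → (∀ x → B x → x ≡ u ⊎ A x) →
           Avoids u es → β u ≡ 0F → R A es β → R B es β
R-extend {B = B} {β = β} {u} B⊆ [] z (done r) = done zero-on-B
  where
  zero-on-B : ∀ x → B x → β x ≡ 0F
  zero-on-B x b with B⊆ x b
  ... | inj₁ refl = z
  ... | inj₂ a    = r x a
R-extend B⊆ ((p , q) ∷ av) z (fwd {β = β} r) = fwd (R-extend B⊆ av (trans (⊟-avoid (β _) p q) z) r)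
R-extend B⊆ ((p , q) ∷ av) z (bwd {β = β} r) = bwd (R-extend B⊆ av (trans (⊞-avoid (β _) p q) z) r)

R? : ∀ {A : Fin n → Set} → (∀ x → Dec (A x)) → ∀ es β → Dec (R A es β)
R? A? []       β = map′ done (λ { (done r) → r }) (all? λ x → A? x →-dec (β x ≟ 0F))
R? A? (e ∷ es) β = map′ [ fwd , bwd ]′ (λ { (fwd r) → inj₁ r ; (bwd r) → inj₂ r })
  (R? A? es _ ⊎-dec R? A? es _)

sum-single : (p : Fin n) → ∀ z → Σ₃.sum (single p z) ≡ z
sum-single {suc n} p z =
  trans (Σ₃.sum-remove {i = p} (single p z))
    (trans (cong₂ _⊞_ (single-≡ p z)
      (trans (Σ₃.sum-cong-≗ (λ i → single-≢ z (punchInᵢ≢i p i ∘ sym))) (Σ₃.sum-replicate-zero n)))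
      (⊞-identityʳ z))

sum-neg : (f : Fin n → Z₃) → Σ₃.sum (neg ∘ f) ≡ neg (Σ₃.sum f)
sum-neg {zero}  f = refl
sum-neg {suc n} f = trans (cong (neg (f 0F) ⊞_) (sum-neg (f ∘ suc))) (distrib (f 0F) _)
  where
  distrib : ∀ a b → neg a ⊞ neg b ≡ neg (a ⊞ b)
  distrib = from-yes (all? λ a → all? λ b → (neg a ⊞ neg b) ≟ neg (a ⊞ b))

sum-⊟ : (f g : Fin n → Z₃) → Σ₃.sum (λ x → f x ⊟ g x) ≡ Σ₃.sum f ⊟ Σ₃.sum g
sum-⊟ f g = trans (Σ₃.∑-distrib-+ f (neg ∘ g)) (cong (Σ₃.sum f ⊞_) (sum-neg g))

sum-δ : (e : Pair n) → Σ₃.sum (δ e) ≡ 0F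
sum-δ (p , q) = trans (sum-⊟ (single p 1F) (single q 1F)) (cong₂ _⊟_ (sum-single p 1F) (sum-single q 1F))

-- Net outflows sum to 0, so the value at the last vertex r takes care of itself.
R-root : ∀ {r : Fin n} {es β} → Σ₃.sum β ≡ 0F → R (_≢ r) es β → R (λ _ → Unit) es β
R-root {r = r} {β = β} s (done h) = done zero-everywhere
  where
  zero-everywhere : ∀ x → Unit → β x ≡ 0F
  zero-everywhere x _ with x ≟ r
  ... | no x≢r   = h x x≢r
  -- Since `β` vanishes off the root, it is `single x (β x)`, and its sum is its value at the root.
  ... | yes refl = trans (sym (sum-single x (β x))) (trans (Σ₃.sum-cong-≗ eq) s)
    where
    eq : ∀ y → single x (β x) y ≡ β y
    eq y with x ≟ y
    ... | yes refl = refl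
    ... | no x≢y   = sym (h y (x≢y ∘ sym))
R-root s (fwd {e} {β = β} h) = fwd (R-root (trans (sum-⊟ β (δ e)) (cong₂ _⊟_ s (sum-δ e))) h)
R-root s (bwd {e} {β = β} h) = bwd (R-root (trans (Σ₃.∑-distrib-+ β (δ e)) (cong₂ _⊞_ s (sum-δ e))) h)

-- Subsets given by comprehension

module _ {n p} {P : Pred (Fin n) p} (P? : Decidable P) where

  ∈-comprehension⁺ : ∀ {x} → P x → x ∈ˢ comprehension P?
  ∈-comprehension⁺ {x} px =
    Vec.lookup⇒[]= x _ (trans (Vec.lookup∘tabulate (does ∘ P?) x) (dec-true (P? x) px))

  ∈-comprehension⁻ : ∀ {x} → x ∈ˢ comprehension P? → P x
  ∈-comprehension⁻ {x} x∈ with P? x | trans (sym (Vec.lookup∘tabulate (does ∘ P?) x)) (Vec.[]=⇒lookup x∈)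
  ... | yes px | _ = px

∈-V⁺ : ∀ {H G} (ι : H ↪ G) y → onV ι y ∈ˢ V⟨ ι ⟩
∈-V⁺ ι y = ∈-comprehension⁺ (λ x → any? (λ y → onV ι y ≟ x)) (y , refl)

∈-V⁻ : ∀ {H G} (ι : H ↪ G) {x} → x ∈ˢ V⟨ ι ⟩ → ∃[ y ] onV ι y ≡ x
∈-V⁻ ι = ∈-comprehension⁻ (λ x → any? (λ y → onV ι y ≟ x))

∈-E⁺ : ∀ {H G} (ι : H ↪ G) f → onE ι f ∈ˢ E⟨ ι ⟩
∈-E⁺ ι y = ∈-comprehension⁺ (λ x → any? (λ y → onE ι y ≟ x)) (y , refl)

∈-E⁻ : ∀ {H G} (ι : H ↪ G) {e} → e ∈ˢ E⟨ ι ⟩ → ∃[ f ] onE ι f ≡ e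
∈-E⁻ ι = ∈-comprehension⁻ (λ x → any? (λ y → onE ι y ≟ x))

≡⊤⇒∈ : ∀ {n} {p : Subset n} → p ≡ ⊤ → ∀ x → x ∈ˢ p
≡⊤⇒∈ refl x = ∈⊤

-- Lists without repetition

set⇒↭ : ∀ {A : Set} {xs ys : List A} → Unique xs → Unique ys →
        (∀ {z} → z ∈ xs → z ∈ ys) → (∀ {z} → z ∈ ys → z ∈ xs) → xs ↭ ys
set⇒↭ u v to from = ∼bag⇒↭ (unique∧set⇒bag u v (mk⇔ to from))

complement : ∀ {m} {xs : List (Fin m)} → Unique xs → ∃[ ys ] (ys ++ xs ↭ allFin m × All (_∉ xs) ys)
complement {m} {xs} u = ys , set⇒↭ (Unique.++⁺ (Unique.filter⁺ ∉? (Unique.allFin⁺ m)) u disjoint)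
    (Unique.allFin⁺ m) (λ _ → ∈-allFin _) split , All.all-filter ∉? (allFin m)
  where
  open DecMembership (_≟_ {m}) using (_∈?_)
  ∉? : Decidable (_∉ xs)
  ∉? = λ x → ¬? (x ∈? xs)
  ys = filter ∉? (allFin m)
  disjoint : ∀ {z} → ¬ (z ∈ ys × z ∈ xs)
  disjoint (z∈ys , z∈xs) = proj₂ (∈-filter⁻ ∉? {xs = allFin m} z∈ys) z∈xs
  split : ∀ {z} → z ∈ allFin m → z ∈ ys ++ xs
  split {z} _ with z ∈? xs
  ... | yes z∈xs = ∈-++⁺ʳ ys z∈xs
  ... | no z∉xs  = ∈-++⁺ˡ (∈-filter⁺ ∉? (∈-allFin z) z∉xs)

-- Orientations and R

module _ {n : ℕ} where

  private
    -- With `s` and `t` exchanged these are the incoming arcs, so that both degrees of an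
    -- orientation unfold to instances of this one definition.
    arcs : ∀ {m} (s t : Fin m → Fin n) (D : Fin m → Bool) → Fin n → Subset m
    arcs s t D x = Vec.tabulate (λ e → does ((if D e then s e else t e) ≟ x))

    count-∷ : ∀ {m} b (p : Subset m) → [ ∣ b Vec.∷ p ∣ ]₃ ≡ (if b then 1F else 0F) ⊞ [ ∣ p ∣ ]₃
    count-∷ true  p = refl
    count-∷ false p = refl

    step₁⇒ : ∀ a o c i b → a ⊞ o ≡ (c ⊞ i) ⊞ b → o ≡ i ⊞ (b ⊟ (a ⊟ c))
    step₁⇒ = from-yes (all? λ a → all? λ o → all? λ c → all? λ i → all? λ b →
               ((a ⊞ o) ≟ ((c ⊞ i) ⊞ b)) →-dec (o ≟ (i ⊞ (b ⊟ (a ⊟ c)))))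
    step₂⇒ : ∀ a o c i b → c ⊞ o ≡ (a ⊞ i) ⊞ b → o ≡ i ⊞ (b ⊞ (a ⊟ c))
    step₂⇒ = from-yes (all? λ a → all? λ o → all? λ c → all? λ i → all? λ b →
               ((c ⊞ o) ≟ ((a ⊞ i) ⊞ b)) →-dec (o ≟ (i ⊞ (b ⊞ (a ⊟ c)))))
    ⇒step₁ : ∀ a o c i b → o ≡ i ⊞ (b ⊟ (a ⊟ c)) → a ⊞ o ≡ (c ⊞ i) ⊞ b
    ⇒step₁ = from-yes (all? λ a → all? λ o → all? λ c → all? λ i → all? λ b →
               (o ≟ (i ⊞ (b ⊟ (a ⊟ c)))) →-dec ((a ⊞ o) ≟ ((c ⊞ i) ⊞ b)))
    ⇒step₂ : ∀ a o c i b → o ≡ i ⊞ (b ⊞ (a ⊟ c)) → c ⊞ o ≡ (a ⊞ i) ⊞ b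
    ⇒step₂ = from-yes (all? λ a → all? λ o → all? λ c → all? λ i → all? λ b →
               (o ≟ (i ⊞ (b ⊞ (a ⊟ c)))) →-dec ((c ⊞ o) ≟ ((a ⊞ i) ⊞ b)))

  orientation⇒R : ∀ {m} (s t : Fin m → Fin n) D {A : Fin n → Set} {β} →
    (∀ x → A x → [ ∣ arcs s t D x ∣ ]₃ ≡ [ ∣ arcs t s D x ∣ ]₃ ⊞ β x) →
    R A (tabulate (λ e → s e , t e)) β
  orientation⇒R {zero}  s t D h = done λ x a → sym (h x a)
  orientation⇒R {suc m} s t D {A} {β} h with D 0F
  ... | true  = fwd (orientation⇒R s′ t′ D′ λ x a →
    step₁⇒ (single (s 0F) 1F x) _ (single (t 0F) 1F x) [ ∣ arcs t′ s′ D′ x ∣ ]₃ (β x)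
      (trans (sym (count-∷ (does (s 0F ≟ x)) (arcs s′ t′ D′ x)))
        (trans (h x a) (cong (_⊞ β x) (count-∷ (does (t 0F ≟ x)) (arcs t′ s′ D′ x))))))
    where s′ = s ∘ suc ; t′ = t ∘ suc ; D′ = D ∘ suc
  ... | false = bwd (orientation⇒R s′ t′ D′ λ x a →
    step₂⇒ (single (s 0F) 1F x) _ (single (t 0F) 1F x) [ ∣ arcs t′ s′ D′ x ∣ ]₃ (β x)
      (trans (sym (count-∷ (does (t 0F ≟ x)) (arcs s′ t′ D′ x)))
        (trans (h x a) (cong (_⊞ β x) (count-∷ (does (s 0F ≟ x)) (arcs t′ s′ D′ x))))))
    where s′ = s ∘ suc ; t′ = t ∘ suc ; D′ = D ∘ suc

  R⇒orientation : ∀ {m} (s t : Fin m → Fin n) {A : Fin n → Set} {β} →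
    R A (tabulate (λ e → s e , t e)) β →
    ∃[ D ] (∀ x → A x → [ ∣ arcs s t D x ∣ ]₃ ≡ [ ∣ arcs t s D x ∣ ]₃ ⊞ β x)
  R⇒orientation {zero}  s t (done h) = (λ ()) , λ x a → sym (h x a)
  R⇒orientation {suc m} s t {A} {β} (fwd r) with R⇒orientation (s ∘ suc) (t ∘ suc) r
  ... | D , h = (λ { zero → true ; (suc e) → D e }) , λ x a →
    trans (count-∷ (does (s 0F ≟ x)) (arcs s′ t′ D x)) (trans
      (⇒step₁ (single (s 0F) 1F x) _ (single (t 0F) 1F x) [ ∣ arcs t′ s′ D x ∣ ]₃ (β x) (h x a))
      (cong (_⊞ β x) (sym (count-∷ (does (t 0F ≟ x)) (arcs t′ s′ D x)))))
    where s′ = s ∘ suc ; t′ = t ∘ suc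
  R⇒orientation {suc m} s t {A} {β} (bwd r) with R⇒orientation (s ∘ suc) (t ∘ suc) r
  ... | D , h = (λ { zero → false ; (suc e) → D e }) , λ x a →
    trans (count-∷ (does (t 0F ≟ x)) (arcs s′ t′ D x)) (trans
      (⇒step₂ (single (s 0F) 1F x) _ (single (t 0F) 1F x) [ ∣ arcs t′ s′ D x ∣ ]₃ (β x) (h x a))
      (cong (_⊞ β x) (sym (count-∷ (does (s 0F ≟ x)) (arcs t′ s′ D x)))))
    where s′ = s ∘ suc ; t′ = t ∘ suc

ends : (G : Graph) → Edge G → Pair (order G)
ends G e = src G e , tgt G e

pairs : (G : Graph) → List (Pair (order G))
pairs G = map (ends G) (allFin (size G))

pairs≡ : ∀ G → pairs G ≡ tabulate (ends G)
pairs≡ G = List.map-tabulate id (ends G)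

[sum-toℕ]₃ : ∀ {n} (β : Fin n → Fin 3) → [ Σℕ.sum (toℕ ∘ β) ]₃ ≡ Σ₃.sum β
[sum-toℕ]₃ β = trans ([sum]₃ (toℕ ∘ β)) (Σ₃.sum-cong-≗ ([toℕ]₃ ∘ β))

connected⇒Full : ∀ G → Z₃-Connected G → ∀ r → Full (_≢ r) (pairs G)
connected⇒Full G conn r β = R-cong agree
    (subst (λ es → R (_≢ r) es β′) (sym (pairs≡ G))
      (orientation⇒R (src G) (tgt G) D λ x _ → congruent⇒ (outdegree G D x) (indegree G D x) (β′ x) (realizes x)))
  where
  s = Σ₃.sum β
  -- Subtracting the total at the root gives a ℤ₃-boundary and changes nothing elsewhere.
  β′ = λ x → β x ⊟ single r s x
  boundary : IsBoundary G β′
  boundary = []₃≡0⇒∣ _ (trans ([sum-toℕ]₃ β′) (trans (sum-⊟ β (single r s))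
    (trans (cong (s ⊟_) (sum-single r s)) (⊟-self s))))
  D = proj₁ (conn β′ boundary)
  realizes = proj₂ (conn β′ boundary)
  agree : ∀ x → x ≢ r → β′ x ≡ β x
  agree x x≢r = trans (cong (β x ⊟_) (single-≢ s (x≢r ∘ sym))) (⊞-identityʳ (β x))

R⇒connected : ∀ G → (∀ β → ∃[ r ] R (_≢ r) (pairs G) β) → Z₃-Connected G
R⇒connected G off-root β bd = D , λ x → ⇒congruent (outdegree G D x) (indegree G D x) (β x) (h x tt)
  where
  everywhere = R⇒orientation (src G) (tgt G) (subst (λ es → R _ es β) (pairs≡ G)
    (R-root (trans (sym ([sum-toℕ]₃ β)) (∣⇒[]₃≡0 bd)) (proj₂ (off-root β))))
  D = proj₁ everywhere
  h = proj₂ everywhere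

-- The edges outside es are directed arbitrarily.
unique-R : ∀ G (Q : (Vertex G → Z₃) → Set) {es} → Unique es →
  (∀ {f β} → f ∉ es → Q β → Q (λ x → β x ⊟ δ (ends G f) x)) →
  (∀ {β} → Q β → ∃[ r ] R (_≢ r) (map (ends G) es) β) → ∀ {β} → Q β → ∃[ r ] R (_≢ r) (pairs G) β
unique-R G Q {es} u stable off-root {β} q with complement u
... | fs , p , fs∉ = let r , h = prepend fs∉ q in
  r , R-↭ (Perm.map⁺ (ends G) p) (subst (λ ps → R (_≢ r) ps β) (sym (List.map-++ (ends G) fs es)) h)
  where
  prepend : ∀ {fs} → All (_∉ es) fs → ∀ {β} → Q β → ∃[ r ] R (_≢ r) (map (ends G) fs ++ map (ends G) es) β
  prepend []          q = off-root q
  prepend (f∉ ∷ fs∉) q = let r , h = prepend fs∉ (stable f∉ q) in r , fwd h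

unique-R⇒connected : ∀ G {es} → Unique es → (∀ β → ∃[ r ] R (_≢ r) (map (ends G) es) β) → Z₃-Connected G
unique-R⇒connected G u off-root =
  R⇒connected G λ β → unique-R G (λ _ → Unit) u (λ _ _ → tt) (λ _ → off-root _) tt

-- Transport along embeddings

pmap : ∀ {m n} → (Fin m → Fin n) → Pair m → Pair n
pmap f (p , q) = f p , f q

single-injective : ∀ {m n} {f : Fin m → Fin n} → Injective _≡_ _≡_ f →
                   ∀ p z x → single (f p) z (f x) ≡ single p z x
single-injective {f = f} inj p z x with p ≟ x
... | yes refl = single-≡ (f p) z
... | no p≢x   = single-≢ z (p≢x ∘ inj)

δ-injective : ∀ {m n} {f : Fin m → Fin n} → Injective _≡_ _≡_ f →
              ∀ e x → δ (pmap f e) (f x) ≡ δ e x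
δ-injective inj (p , q) x = cong₂ _⊟_ (single-injective inj p 1F x) (single-injective inj q 1F x)

module _ {m n} {f : Fin m → Fin n} (inj : Injective _≡_ _≡_ f) where

  R-map⁺ : ∀ {A : Fin m → Set} {es β} → R A es (β ∘ f) →
           R (λ x → ∃[ h ] (f h ≡ x × A h)) (map (pmap f) es) β
  R-map⁺ {es = []} (done r) = done λ { _ (h , refl , a) → r h a }
  R-map⁺ {es = e ∷ _} {β} (fwd r) =
    fwd (R-map⁺ (R-ext (λ h → cong (β (f h) ⊟_) (sym (δ-injective inj e h))) r))
  R-map⁺ {es = e ∷ _} {β} (bwd r) =
    bwd (R-map⁺ (R-ext (λ h → cong (β (f h) ⊞_) (sym (δ-injective inj e h))) r))

  R-map⁻ : ∀ {A : Fin n → Set} {es β} → R A (map (pmap f) es) β → R (A ∘ f) es (β ∘ f)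
  R-map⁻ {es = []} (done r) = done λ h → r (f h)
  R-map⁻ {es = e ∷ _} {β} (fwd r) =
    fwd (R-ext (λ h → cong (β (f h) ⊟_) (δ-injective inj e h)) (R-map⁻ r))
  R-map⁻ {es = e ∷ _} {β} (bwd r) =
    bwd (R-ext (λ h → cong (β (f h) ⊞_) (δ-injective inj e h)) (R-map⁻ r))

module _ {G : Graph} where

  Joins-sym : ∀ {e x y} → Joins G e x y → Joins G e y x
  Joins-sym (inj₁ j) = inj₂ j
  Joins-sym (inj₂ j) = inj₁ j

  R-join⁺ : ∀ {A : Vertex G → Set} {e x y es β} → Joins G e x y →
            R A ((x , y) ∷ es) β → R A (ends G e ∷ es) β
  R-join⁺ (inj₁ (refl , refl)) r = r
  R-join⁺ (inj₂ (refl , refl)) r = R-flip r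

  R-join⁻ : ∀ {A : Vertex G → Set} {e x y es β} → Joins G e x y →
            R A (ends G e ∷ es) β → R A ((x , y) ∷ es) β
  R-join⁻ (inj₁ (refl , refl)) r = r
  R-join⁻ (inj₂ (refl , refl)) r = R-flip r

module _ {H G : Graph} (ι : H ↪ G) where

  image : List (Edge G)
  image = map (onE ι) (allFin (size H))

  image-unique : Unique image
  image-unique = Unique.map⁺ (onE-inj ι) (Unique.allFin⁺ (size H))

  ∈-image⁺ : ∀ f → onE ι f ∈ image
  ∈-image⁺ f = ∈-map⁺ (onE ι) (∈-allFin f)

  ∈-image⁻ : ∀ {e} → e ∈ image → ∃[ f ] onE ι f ≡ e
  ∈-image⁻ e∈ with ∈-map⁻ (onE ι) e∈
  ... | f , _ , eq = f , sym eq

  R-image⁺ : ∀ {A : Vertex G → Set} es {β} →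
    R A (map (pmap (onV ι)) (map (ends H) es)) β → R A (map (ends G) (map (onE ι) es)) β
  R-image⁺ [] r = r
  R-image⁺ (e ∷ es) r = R-join⁺ {G = G} (onE-joins ι e) (R-∷ (R-image⁺ es) r)

  R-image⁻ : ∀ {A : Vertex G → Set} es {β} →
    R A (map (ends G) (map (onE ι) es)) β → R A (map (pmap (onV ι)) (map (ends H) es)) β
  R-image⁻ [] r = r
  R-image⁻ (e ∷ es) r = R-∷ (R-image⁻ es) (R-join⁻ {G = G} (onE-joins ι e) r)

  R-↪⁺ : ∀ {A : Vertex H → Set} {β} → R A (pairs H) (β ∘ onV ι) →
         R (λ x → ∃[ h ] (onV ι h ≡ x × A h)) (map (ends G) image) β
  R-↪⁺ r = R-image⁺ (allFin (size H)) (R-map⁺ (onV-inj ι) r)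

  R-↪⁻ : ∀ {A : Vertex G → Set} {β} → R A (map (ends G) image) β → R (A ∘ onV ι) (pairs H) (β ∘ onV ι)
  R-↪⁻ r = R-map⁻ (onV-inj ι) (R-image⁻ (allFin (size H)) r)

  -- The value `z` is what the vertices outside `H` receive: 1 at the tip of an ear and 0 at the two
  -- deleted vertices of a bull, where it forces the edges.
  extend : Z₃ → (Vertex H → Z₃) → Vertex G → Z₃
  extend z β x with any? (λ h → onV ι h ≟ x)
  ... | yes (h , _) = β h
  ... | no _        = z

  extend-onV : ∀ z β h → extend z β (onV ι h) ≡ β h
  extend-onV z β h with any? (λ h′ → onV ι h′ ≟ onV ι h)
  ... | yes (h′ , eq) = cong β (onV-inj ι eq)
  ... | no ∄          = ⊥-elim (∄ (h , refl))

  extend-outside : ∀ z β {x} → (∀ h → onV ι h ≢ x) → extend z β x ≡ z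
  extend-outside z β {x} ∉ with any? (λ h → onV ι h ≟ x)
  ... | yes (h , eq) = ⊥-elim (∉ h eq)
  ... | no _         = refl

≅-connected⁺ : ∀ {H G} → H ≅ G → Vertex H → Z₃-Connected H → Z₃-Connected G
≅-connected⁺ {H} {G} (ι , V , _) r conn = unique-R⇒connected G (image-unique ι) λ β → onV ι r ,
  R-mono covered (R-↪⁺ ι (connected⇒Full H conn r (β ∘ onV ι)))
  where
  covered : ∀ x → x ≢ onV ι r → ∃[ h ] (onV ι h ≡ x × h ≢ r)
  covered x x≢ with ∈-V⁻ ι (≡⊤⇒∈ V x)
  ... | h , refl = h , refl , λ { refl → x≢ refl }

≅-connected⁻ : ∀ {H G} → H ≅ G → Vertex H → Z₃-Connected G → Z₃-Connected H
≅-connected⁻ {H} {G} (ι , _ , E) r conn = R⇒connected H λ β → r ,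
  R-mono (λ h h≢r → h≢r ∘ onV-inj ι)
    (R-ext (extend-onV ι 0F β)
      (R-↪⁻ ι (R-↭ (Perm.map⁺ (ends G) all) (connected⇒Full G conn (onV ι r) (extend ι 0F β)))))
  where
  all : allFin (size G) ↭ image ι
  all = set⇒↭ (Unique.allFin⁺ (size G)) (image-unique ι)
    (λ {e} _ → let f , eq = ∈-E⁻ ι (≡⊤⇒∈ E e) in subst (_∈ image ι) eq (∈-image⁺ ι f))
    (λ _ → ∈-allFin _)

-- At degree two the value 1 requires both edges to enter, which is impossible at two adjacent
-- vertices. The code searches all orientations instead.
¬connected-K₃ : ¬ Z₃-Connected K₃
¬connected-K₃ conn = from-no (R? (λ x → ¬? (x ≟ 0F)) (pairs K₃) (const 1F))
  (connected⇒Full K₃ conn 0F (const 1F))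

-- At degree three the value 0 requires a source or a sink, and sources and sinks cannot alternate
-- around a triangle. Again all orientations are searched.
¬connected-K₄ : ¬ Z₃-Connected K₄
¬connected-K₄ conn = from-no (R? (λ x → ¬? (x ≟ 0F)) (pairs K₄) (const 0F))
  (connected⇒Full K₄ conn 0F (const 0F))

-- Serving a vertex by two or three edges.

Full-peel : ∀ {A B : Fin n → Set} {x y z es} → (∀ v → B v → v ≡ x ⊎ A v) → Avoids x es →
            y ≢ x → z ≢ x → Full A es → Full B ((x , y) ∷ (x , z) ∷ es)
Full-peel {A = A} {B} {x} {y} {z} {es} B⊆ av y≢x z≢x full β = go (β x) refl
  where
  δy = δ-fst y≢x
  δz = δ-fst z≢x
  finish : ∀ {γ} → γ x ≡ 0F → R B es γ
  finish γx = R-extend B⊆ av γx (full _)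
  go : ∀ b → β x ≡ b → R B ((x , y) ∷ (x , z) ∷ es) β
  -- One edge out and one in give 0, two in give -2 = 1, two out give 2: every value can be met.
  go 0F eq = fwd (bwd (finish (cong₂ _⊞_ (cong₂ _⊟_ eq δy) δz)))
  go 1F eq = bwd (bwd (finish (cong₂ _⊞_ (cong₂ _⊞_ eq δy) δz)))
  go 2F eq = fwd (fwd (finish (cong₂ _⊟_ (cong₂ _⊟_ eq δy) δz)))

private
  -- The first index is the value needed at `x`, the second the direction of yz: 1 from `y` to `z`,
  -- 2 from `z` to `y`. The left side is what remains after directing yz, the right side what
  -- remains after the matching orientation of the three edges at `x`.
  triple₀₁ : ∀ b x y z → (b ⊟ (x ⊟ y) ⊟ (x ⊟ y) ⊟ (x ⊟ z)) ⊞ (y ⊟ z) ⊟ (y ⊟ z) ≡ b ⊟ (x ⊟ y) ⊟ (x ⊟ y) ⊟ (x ⊟ z)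
  triple₀₁ = from-yes (all? λ b → all? λ x → all? λ y → all? λ z →
    ((b ⊟ (x ⊟ y) ⊟ (x ⊟ y) ⊟ (x ⊟ z)) ⊞ (y ⊟ z) ⊟ (y ⊟ z)) ≟ (b ⊟ (x ⊟ y) ⊟ (x ⊟ y) ⊟ (x ⊟ z)))
  triple₀₂ : ∀ b x y z → (b ⊟ (x ⊟ y) ⊟ (x ⊟ y) ⊟ (x ⊟ z)) ⊞ (y ⊟ z) ⊞ (y ⊟ z) ≡ b ⊞ (x ⊟ y) ⊞ (x ⊟ y) ⊞ (x ⊟ z)
  triple₀₂ = from-yes (all? λ b → all? λ x → all? λ y → all? λ z →
    ((b ⊟ (x ⊟ y) ⊟ (x ⊟ y) ⊟ (x ⊟ z)) ⊞ (y ⊟ z) ⊞ (y ⊟ z)) ≟ (b ⊞ (x ⊟ y) ⊞ (x ⊟ y) ⊞ (x ⊟ z)))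
  triple₁₁ : ∀ b x y z → (b ⊟ (x ⊟ z)) ⊞ (y ⊟ z) ⊟ (y ⊟ z) ≡ b ⊟ (x ⊟ y) ⊞ (x ⊟ y) ⊟ (x ⊟ z)
  triple₁₁ = from-yes (all? λ b → all? λ x → all? λ y → all? λ z →
    ((b ⊟ (x ⊟ z)) ⊞ (y ⊟ z) ⊟ (y ⊟ z)) ≟ (b ⊟ (x ⊟ y) ⊞ (x ⊟ y) ⊟ (x ⊟ z)))
  triple₁₂ : ∀ b x y z → (b ⊟ (x ⊟ z)) ⊞ (y ⊟ z) ⊞ (y ⊟ z) ≡ b ⊟ (x ⊟ y) ⊟ (x ⊟ y) ⊞ (x ⊟ z)
  triple₁₂ = from-yes (all? λ b → all? λ x → all? λ y → all? λ z →
    ((b ⊟ (x ⊟ z)) ⊞ (y ⊟ z) ⊞ (y ⊟ z)) ≟ (b ⊟ (x ⊟ y) ⊟ (x ⊟ y) ⊞ (x ⊟ z)))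
  triple₂₁ : ∀ b x y z → (b ⊞ (x ⊟ z)) ⊟ (y ⊟ z) ⊟ (y ⊟ z) ≡ b ⊞ (x ⊟ y) ⊞ (x ⊟ y) ⊟ (x ⊟ z)
  triple₂₁ = from-yes (all? λ b → all? λ x → all? λ y → all? λ z →
    ((b ⊞ (x ⊟ z)) ⊟ (y ⊟ z) ⊟ (y ⊟ z)) ≟ (b ⊞ (x ⊟ y) ⊞ (x ⊟ y) ⊟ (x ⊟ z)))
  triple₂₂ : ∀ b x y z → (b ⊞ (x ⊟ z)) ⊟ (y ⊟ z) ⊞ (y ⊟ z) ≡ b ⊟ (x ⊟ y) ⊞ (x ⊟ y) ⊞ (x ⊟ z)
  triple₂₂ = from-yes (all? λ b → all? λ x → all? λ y → all? λ z →
    ((b ⊞ (x ⊟ z)) ⊟ (y ⊟ z) ⊞ (y ⊟ z)) ≟ (b ⊟ (x ⊟ y) ⊞ (x ⊟ y) ⊞ (x ⊟ z)))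

-- Whatever value x needs, two orientations of its three edges achieve it, and these
-- differ at y and z as the two orientations of an edge yz do.
Full-triple : ∀ {A B : Fin n → Set} {x y z es} → (∀ v → B v → v ≡ x ⊎ A v) → Avoids x es →
              y ≢ x → z ≢ x → Full A ((y , z) ∷ es) → Full B ((x , y) ∷ (x , y) ∷ (x , z) ∷ es)
Full-triple {A = A} {B} {x} {y} {z} {es} B⊆ av y≢x z≢x full β = go (β x) refl
  where
  δy = δ-fst y≢x
  δz = δ-fst z≢x
  X = single x 1F
  Y = single y 1F
  Z = single z 1F
  finish : ∀ {γ γ′} → (∀ v → γ v ≡ γ′ v) → γ′ x ≡ 0F → R A es γ → R B es γ′
  finish eq γx r = R-extend B⊆ av γx (R-ext eq r)
  go : ∀ b → β x ≡ b → R B ((x , y) ∷ (x , y) ∷ (x , z) ∷ es) β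
  -- The boundary handed to `full` is shifted by one arc yz in advance. One direction of yz undoes
  -- the shift, the other doubles it, and the two remainders are those of the two orientations at
  -- `x` that meet its value.
  go 0F eq with full (λ v → (β v ⊟ δ (x , y) v ⊟ δ (x , y) v ⊟ δ (x , z) v) ⊞ δ (y , z) v)
  ... | fwd r = fwd (fwd (fwd (finish (λ v → triple₀₁ (β v) (X v) (Y v) (Z v))
                  (cong₂ _⊟_ (cong₂ _⊟_ (cong₂ _⊟_ eq δy) δy) δz) r)))
  ... | bwd r = bwd (bwd (bwd (finish (λ v → triple₀₂ (β v) (X v) (Y v) (Z v))
                  (cong₂ _⊞_ (cong₂ _⊞_ (cong₂ _⊞_ eq δy) δy) δz) r)))
  go 1F eq with full (λ v → (β v ⊟ δ (x , z) v) ⊞ δ (y , z) v)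
  ... | fwd r = fwd (bwd (fwd (finish (λ v → triple₁₁ (β v) (X v) (Y v) (Z v))
                  (cong₂ _⊟_ (cong₂ _⊞_ (cong₂ _⊟_ eq δy) δy) δz) r)))
  ... | bwd r = fwd (fwd (bwd (finish (λ v → triple₁₂ (β v) (X v) (Y v) (Z v))
                  (cong₂ _⊞_ (cong₂ _⊟_ (cong₂ _⊟_ eq δy) δy) δz) r)))
  go 2F eq with full (λ v → (β v ⊞ δ (x , z) v) ⊟ δ (y , z) v)
  ... | fwd r = bwd (bwd (fwd (finish (λ v → triple₂₁ (β v) (X v) (Y v) (Z v))
                  (cong₂ _⊟_ (cong₂ _⊞_ (cong₂ _⊞_ eq δy) δy) δz) r)))
  ... | bwd r = fwd (bwd (bwd (finish (λ v → triple₂₂ (β v) (X v) (Y v) (Z v))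
                  (cong₂ _⊞_ (cong₂ _⊞_ (cong₂ _⊟_ eq δy) δy) δz) r)))

-- The correction that remains to be met at the three neighbours of a source; for a sink it has the
-- opposite sign.
star : (p q a : Fin n) → Fin n → Z₃
star p q a x = single p 1F x ⊞ single q 1F x ⊞ single a 1F x

-- The three contributions of `u` add up to a multiple of 3, so `u` disappears from what remains.
source : ∀ b u p q a → b ⊞ (p ⊞ q ⊞ a) ≡ b ⊟ (u ⊟ p) ⊟ (u ⊟ q) ⊟ (u ⊟ a)
source = from-yes (all? λ b → all? λ u → all? λ p → all? λ q → all? λ a →
    (b ⊞ (p ⊞ q ⊞ a)) ≟ (b ⊟ (u ⊟ p) ⊟ (u ⊟ q) ⊟ (u ⊟ a)))
sink : ∀ b u p q a → b ⊟ (p ⊞ q ⊞ a) ≡ b ⊞ (u ⊟ p) ⊞ (u ⊟ q) ⊞ (u ⊟ a)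
sink = from-yes (all? λ b → all? λ u → all? λ p → all? λ q → all? λ a →
    (b ⊟ (p ⊞ q ⊞ a)) ≟ (b ⊞ (u ⊟ p) ⊞ (u ⊟ q) ⊞ (u ⊟ a)))

star-avoid : ∀ {p q a x : Fin n} → p ≢ x → q ≢ x → a ≢ x → star p q a x ≡ 0F
star-avoid p≢x q≢x a≢x = cong₂ _⊞_ (cong₂ _⊞_ (single-≢ 1F p≢x) (single-≢ 1F q≢x)) (single-≢ 1F a≢x)

-- A vertex of degree three and value 0 is a source or a sink.
R-star : ∀ {A B : Fin n → Set} {u p q a es β} → (∀ v → B v → v ≡ u ⊎ A v) → Avoids u es →
         p ≢ u → q ≢ u → a ≢ u → β u ≡ 0F →
         R A es (λ x → β x ⊞ star p q a x) ⊎ R A es (λ x → β x ⊟ star p q a x) →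
         R B ((u , p) ∷ (u , q) ∷ (u , a) ∷ es) β
R-star {u = u} {p} {q} {a} {β = β} B⊆ av p≢u q≢u a≢u βu (inj₁ r) =
  fwd (fwd (fwd (R-ext (λ x → source (β x) (single u 1F x) (single p 1F x) (single q 1F x) (single a 1F x))
    (R-extend B⊆ av (cong₂ _⊞_ βu (star-avoid p≢u q≢u a≢u)) r))))
R-star {u = u} {p} {q} {a} {β = β} B⊆ av p≢u q≢u a≢u βu (inj₂ r) =
  bwd (bwd (bwd (R-ext (λ x → sink (β x) (single u 1F x) (single p 1F x) (single q 1F x) (single a 1F x))
    (R-extend B⊆ av (cong₂ _⊟_ βu (star-avoid p≢u q≢u a≢u)) r))))

-- Triangle-trees as lists of vertices and edges of `G`.

module Trees (G : Graph) where

  -- Starting from an edge instead of a triangle has the effect that what lies behind any triangle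
  -- of the construction, even the first, is again a tree. `perm` allows the construction order to
  -- be changed.
  data Tree : List (Vertex G) → List (Edge G) → Set where
    edge : ∀ {e x y} → Joins G e x y → Tree (x ∷ y ∷ []) (e ∷ [])
    grow : ∀ {vs es x y z e e₁ e₂} → Tree vs es → e ∈ es → Joins G e y z →
           x ∉ vs → Joins G e₁ x y → Joins G e₂ x z → Tree (x ∷ vs) (e₁ ∷ e₂ ∷ es)
    perm : ∀ {vs vs′ es es′} → vs ↭ vs′ → es ↭ es′ → Tree vs es → Tree vs′ es′

  private
    variable
      vs : List (Vertex G)
      es : List (Edge G)
      e f e₁ e₂ : Edge G
      x y z u v p q : Vertex G

  J-sym : Joins G e x y → Joins G e y x
  J-sym = Joins-sym {G}

  J-≢ : Joins G e x y → x ≢ y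
  J-≢ {e} (inj₁ (refl , refl)) = loopless G e
  J-≢ {e} (inj₂ (refl , refl)) = loopless G e ∘ sym

  J-unique : Joins G e x y → Joins G e u v → (u ≡ x × v ≡ y) ⊎ (u ≡ y × v ≡ x)
  J-unique (inj₁ (refl , refl)) (inj₁ (refl , refl)) = inj₁ (refl , refl)
  J-unique (inj₁ (refl , refl)) (inj₂ (refl , refl)) = inj₂ (refl , refl)
  J-unique (inj₂ (refl , refl)) (inj₁ (refl , refl)) = inj₂ (refl , refl)
  J-unique (inj₂ (refl , refl)) (inj₂ (refl , refl)) = inj₁ (refl , refl)

  J-other : Joins G e x y → Joins G e x z → z ≡ y
  J-other j k with J-unique j k
  ... | inj₁ (_ , eq) = eq
  ... | inj₂ (refl , _) = ⊥-elim (J-≢ j refl)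

  Tree-ends : Tree vs es → e ∈ es → Joins G e x y → x ∈ vs × y ∈ vs
  Tree-ends (edge j) (here refl) k with J-unique j k
  ... | inj₁ (refl , refl) = here refl , there (here refl)
  ... | inj₂ (refl , refl) = there (here refl) , here refl
  Tree-ends (grow t e∈ j x∉ j₁ j₂) (here refl) k with J-unique j₁ k
  ... | inj₁ (refl , refl) = here refl , there (proj₁ (Tree-ends t e∈ j))
  ... | inj₂ (refl , refl) = there (proj₁ (Tree-ends t e∈ j)) , here refl
  Tree-ends (grow t e∈ j x∉ j₁ j₂) (there (here refl)) k with J-unique j₂ k
  ... | inj₁ (refl , refl) = here refl , there (proj₂ (Tree-ends t e∈ j))
  ... | inj₂ (refl , refl) = there (proj₂ (Tree-ends t e∈ j)) , here refl
  Tree-ends (grow t e∈ j x∉ j₁ j₂) (there (there f∈)) k with Tree-ends t f∈ k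
  ... | x∈ , y∈ = there x∈ , there y∈
  Tree-ends (perm p q t) e∈ k with Tree-ends t (Perm.∈-resp-↭ (↭-sym q) e∈) k
  ... | x∈ , y∈ = Perm.∈-resp-↭ p x∈ , Perm.∈-resp-↭ p y∈

  fresh : Tree vs es → x ∉ vs → Joins G e x y → e ∉ es
  fresh t x∉ j e∈ = x∉ (proj₁ (Tree-ends t e∈ j))

  Tree-unique : Tree vs es → Unique es
  Tree-unique (edge _) = [] ∷ []
  Tree-unique (grow t e∈ j x∉ j₁ j₂) =
    ((λ { refl → J-≢ j (J-other j₂ j₁) }) ∷ All.¬Any⇒All¬ _ (fresh t x∉ j₁)) ∷
    All.¬Any⇒All¬ _ (fresh t x∉ j₂) ∷ Tree-unique t
  Tree-unique (perm _ q t) = Permₛ.Unique-resp-↭ (setoid _) (↭⇒↭ₛ q) (Tree-unique t)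

  ∉⇒Avoids : Tree vs es → x ∉ vs → Avoids x (map (ends G) es)
  ∉⇒Avoids {vs} {es} {x} t x∉ = All.map⁺ (All.tabulate λ {e} e∈ →
    (λ { refl → x∉ (proj₁ (Tree-ends t e∈ (inj₁ (refl , refl)))) }) ,
    (λ { refl → x∉ (proj₂ (Tree-ends t e∈ (inj₁ (refl , refl)))) }))

  J-avoids : Joins G e y z → y ≢ x → z ≢ x → src G e ≢ x × tgt G e ≢ x
  J-avoids (inj₁ (refl , refl)) y≢x z≢x = y≢x , z≢x
  J-avoids (inj₂ (refl , refl)) y≢x z≢x = z≢x , y≢x

  ∈∉⇒≢ : y ∈ vs → x ∉ vs → y ≢ x
  ∈∉⇒≢ y∈ x∉ refl = x∉ y∈

  Off : Vertex G → List (Vertex G) → Vertex G → Set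
  Off r vs x = x ∈ vs × x ≢ r

  Off-∷ : ∀ {r} x′ → Off r (x ∷ vs) x′ → x′ ≡ x ⊎ Off r vs x′
  Off-∷ x′ (here eq , _)    = inj₁ eq
  Off-∷ x′ (there x∈ , x≢r) = inj₂ (x∈ , x≢r)

  -- Contracting an edge of a triangle in which it is doubled makes the other two parallel,
  -- so the freedom that one doubled edge gives spreads over the whole tree.
  Full-doubled : Tree vs es → Σ[ r ∈ Vertex G ] (∀ {e} → e ∈ es → Full (Off r vs) (ends G e ∷ map (ends G) es))
  Full-doubled (edge {e} {x} {y} j) = x , λ { (here refl) β →
    R-join⁺ {G = G} (J-sym j) (R-∷ (R-join⁺ {G = G} (J-sym j))
      (Full-peel {A = λ _ → ⊥} only-y [] (J-≢ j) (J-≢ j) (λ _ → done λ _ ()) β)) }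
    where
    only-y : ∀ v → Off x (x ∷ y ∷ []) v → v ≡ y ⊎ ⊥
    only-y v (here refl , v≢x) = ⊥-elim (v≢x refl)
    only-y v (there (here refl) , _) = inj₁ refl
  Full-doubled (grow {vs} {es} {x} {y} {z} {e} {e₁} {e₂} t e∈ j x∉ j₁ j₂) with Full-doubled t
  -- The root stays that of the smaller tree. If an edge at `x` is doubled, the three edges at `x`
  -- replace a second copy of yz; if an older edge is doubled, the two edges at `x` serve `x` and
  -- the smaller tree does the rest.
  ... | r , full = r , λ where
      (here refl) β → R-join⁺ {G = G} j₁ (R-∷ (λ h → R-join⁺ {G = G} j₁ (R-∷ (R-join⁺ {G = G} j₂) h))
        (Full-triple Off-∷ av y≢x z≢x full-yz β))
      (there (here refl)) β → R-join⁺ {G = G} j₂ (R-∷ (λ h → R-join⁺ {G = G} j₁ (R-∷ (R-join⁺ {G = G} j₂) h))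
        (R-↭ (prep _ (swap _ _ refl)) (Full-triple Off-∷ av z≢x y≢x (λ γ → R-flip (full-yz γ)) β)))
      (there (there f∈)) β → R-↭ (↭-trans (prep _ (swap _ _ refl)) (swap _ _ refl))
        (R-join⁺ {G = G} j₁ (R-∷ (R-join⁺ {G = G} j₂)
          (Full-peel Off-∷ (avoid-f f∈ ∷ av) y≢x z≢x (full f∈) β)))
    where
    av = ∉⇒Avoids t x∉
    y≢x = ∈∉⇒≢ (proj₁ (Tree-ends t e∈ j)) x∉
    z≢x = ∈∉⇒≢ (proj₂ (Tree-ends t e∈ j)) x∉
    full-yz : Full (Off r vs) ((y , z) ∷ map (ends G) es)
    full-yz γ = R-join⁻ {G = G} j (full e∈ γ)
    avoid-f : ∀ {f} → f ∈ es → src G f ≢ x × tgt G f ≢ x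
    avoid-f f∈ = ∈∉⇒≢ (proj₁ (Tree-ends t f∈ (inj₁ (refl , refl)))) x∉ ,
                 ∈∉⇒≢ (proj₂ (Tree-ends t f∈ (inj₁ (refl , refl)))) x∉
  Full-doubled (perm p q t) with Full-doubled t
  ... | r , full = r , λ e∈ β → R-↭ (prep _ (Perm.map⁺ (ends G) q))
    (R-mono (λ x (x∈ , x≢r) → Perm.∈-resp-↭ (↭-sym p) x∈ , x≢r)
      (full (Perm.∈-resp-↭ (↭-sym q) e∈) β))

-- Trees that end in a triangle with hanging leaves.

module Ends (G : Graph) where

  open Trees G

  private
    variable
      vs vs′ us : List (Vertex G)
      es es′ : List (Edge G)
      e f e₁ e₂ : Edge G
      x y z u v w c p q a : Vertex G

  -- A tree that ends in the triangle vwc, on whose edges vw and vc the vertices in us hang.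
  data End (v w c : Vertex G) : (us vs : List (Vertex G)) → List (Edge G) → Set where
    base : ∀ {vs es e e₁ e₂} → Tree vs es → e ∈ es → Joins G e w c → v ∉ vs →
           Joins G e₁ v w → Joins G e₂ v c → End v w c [] (v ∷ vs) (e₁ ∷ e₂ ∷ es)
    leaf : ∀ {us vs es u p e₁ e₂} → End v w c us vs es → u ∉ vs →
           Joins G e₁ u v → Joins G e₂ u p → p ≡ w ⊎ p ≡ c →
           End v w c (u ∷ us) (u ∷ vs) (e₁ ∷ e₂ ∷ es)

  End-edge : End v w c us vs es → p ≡ w ⊎ p ≡ c → ∃[ e ] (e ∈ es × Joins G e v p)
  End-edge (base _ _ _ _ j₁ j₂) (inj₁ refl) = _ , here refl , j₁
  End-edge (base _ _ _ _ j₁ j₂) (inj₂ refl) = _ , there (here refl) , j₂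
  End-edge (leaf end _ _ _ _) p≡ with End-edge end p≡
  ... | e , e∈ , j = e , there (there e∈) , j

  End⇒Tree : End v w c us vs es → Tree vs es
  End⇒Tree (base t e∈ j v∉ j₁ j₂) = grow t e∈ j v∉ j₁ j₂
  End⇒Tree (leaf end u∉ j₁ j₂ p≡) with End-edge end p≡
  ... | e , e∈ , j = grow (End⇒Tree end) e∈ j u∉ j₁ j₂

  hub∈ : End v w c us vs es → v ∈ vs
  hub∈ end with End-edge end (inj₁ refl)
  ... | e , e∈ , j = proj₁ (Tree-ends (End⇒Tree end) e∈ j)

  side∈ : End v w c us vs es → p ≡ w ⊎ p ≡ c → p ∈ vs
  side∈ end p≡ with End-edge end p≡
  ... | e , e∈ , j = proj₂ (Tree-ends (End⇒Tree end) e∈ j)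

  -- An `End` with at least one leaf, one of them being singled out as the last. The leaves are
  -- interchangeable, so `pick` can bring any of them into this position; the lists are therefore
  -- kept only up to permutation.
  record LastLeaf (v w c : Vertex G) (vs : List (Vertex G)) (es : List (Edge G)) : Set where
    field
      {tip foot} : Vertex G
      {l₁ l₂}    : Edge G
      {tips old} : List (Vertex G)
      {oldE}     : List (Edge G)
      end        : End v w c tips old oldE
      tip∉       : tip ∉ old
      j₁         : Joins G l₁ tip v
      j₂         : Joins G l₂ tip foot
      side       : foot ≡ w ⊎ foot ≡ c
      vs↭        : tip ∷ old ↭ vs
      es↭        : l₁ ∷ l₂ ∷ oldE ↭ es

  HasEnd : List (Vertex G) → List (Edge G) → Set
  HasEnd vs es = ∃[ v ] ∃[ w ] ∃[ c ] LastLeaf v w c vs es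

  rotate : ∀ {A : Set} (a b c d : A) {xs : List A} → a ∷ b ∷ c ∷ d ∷ xs ↭ c ∷ d ∷ a ∷ b ∷ xs
  rotate a b c d = ↭-trans (prep a (swap b c refl)) (↭-trans (swap a c refl)
    (↭-trans (prep c (prep a (swap b d refl))) (prep c (swap a d refl))))

  lastLeaf-here : End v w c us vs es → u ∉ vs → Joins G e₁ u v → Joins G e₂ u p →
                  p ≡ w ⊎ p ≡ c → LastLeaf v w c (u ∷ vs) (e₁ ∷ e₂ ∷ es)
  lastLeaf-here end u∉ j₁ j₂ side = record
    { end = end ; tip∉ = u∉ ; j₁ = j₁ ; j₂ = j₂ ; side = side ; vs↭ = refl ; es↭ = refl }

  -- Both leaves hang on edges at the hub and neither on an edge of the other, so `x` can be
  -- inserted beneath `tip`, which remains last.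
  lastLeaf-there : (l : LastLeaf v w c vs es) → x ∉ vs → Joins G e₁ x v → Joins G e₂ x p →
                   p ≡ w ⊎ p ≡ c → LastLeaf v w c (x ∷ vs) (e₁ ∷ e₂ ∷ es)
  lastLeaf-there {x = x} l x∉ k₁ k₂ side = record
    { end = leaf end (x∉ ∘ Perm.∈-resp-↭ vs↭ ∘ there) k₁ k₂ side
    ; tip∉ = λ { (here refl) → x∉ (Perm.∈-resp-↭ vs↭ (here refl)) ; (there u∈) → tip∉ u∈ }
    ; j₁ = j₁ ; j₂ = j₂ ; side = LastLeaf.side l
    ; vs↭ = ↭-trans (swap _ _ refl) (prep x vs↭)
    ; es↭ = ↭-trans (rotate _ _ _ _) (prep _ (prep _ es↭)) }
    where open LastLeaf l hiding (side)

  pick : End v w c us vs es → u ∈ us → Σ[ l ∈ LastLeaf v w c vs es ] (LastLeaf.tip l ≡ u)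
  pick (leaf end u∉ j₁ j₂ side) (here refl) = lastLeaf-here end u∉ j₁ j₂ side , refl
  pick (leaf end u∉ j₁ j₂ side) (there u∈) with pick end u∈
  ... | l , eq = lastLeaf-there l u∉ j₁ j₂ side , eq

  -- The three fates of a vertex `x` attached along the edge `e` of an `End`: it is one more leaf at
  -- the hub; or it belongs to the part behind the triangle and can be attached there before the hub
  -- is; or `e` is an edge of a leaf, to be treated as the last one.
  data Located (v w c : Vertex G) (vs : List (Vertex G)) (es : List (Edge G))
               (e : Edge G) (x : Vertex G) (e₁ e₂ : Edge G) : Set where
    at-hub  : Joins G e v p → p ≡ w ⊎ p ≡ c → Located v w c vs es e x e₁ e₂
    in-core : End v w c us vs′ es′ → vs′ ↭ x ∷ vs → es′ ↭ e₁ ∷ e₂ ∷ es → Located v w c vs es e x e₁ e₂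
    at-leaf : (l : LastLeaf v w c vs es) → e ≡ LastLeaf.l₁ l ⊎ e ≡ LastLeaf.l₂ l →
              Located v w c vs es e x e₁ e₂

  locate : End v w c us vs es → e ∈ es → Joins G e y z → x ∉ vs → Joins G e₁ x y → Joins G e₂ x z →
           Located v w c vs es e x e₁ e₂
  locate (base t f∈ k v∉ k₁ k₂) (here refl) j x∉ j₁ j₂ = at-hub k₁ (inj₁ refl)
  locate (base t f∈ k v∉ k₁ k₂) (there (here refl)) j x∉ j₁ j₂ = at-hub k₂ (inj₂ refl)
  locate (base t f∈ k v∉ k₁ k₂) (there (there e∈)) j x∉ j₁ j₂ = in-core
    (base (grow t e∈ j (x∉ ∘ there) j₁ j₂) (there (there f∈)) k
      (λ { (here refl) → x∉ (here refl) ; (there v∈) → v∉ v∈ }) k₁ k₂)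
    (swap _ _ refl) (rotate _ _ _ _)
  locate (leaf end u∉ k₁ k₂ side) (here refl) j x∉ j₁ j₂ = at-leaf (lastLeaf-here end u∉ k₁ k₂ side) (inj₁ refl)
  locate (leaf end u∉ k₁ k₂ side) (there (here refl)) j x∉ j₁ j₂ = at-leaf (lastLeaf-here end u∉ k₁ k₂ side) (inj₂ refl)
  locate (leaf end u∉ k₁ k₂ side) (there (there e∈)) j x∉ j₁ j₂ with locate end e∈ j (x∉ ∘ there) j₁ j₂
  ... | at-hub k p≡ = at-hub k p≡
  ... | in-core end′ p q = in-core
    (leaf end′ (λ u∈ → case-u (Perm.∈-resp-↭ p u∈)) k₁ k₂ side)
    (↭-trans (prep _ p) (swap _ _ refl)) (↭-trans (prep _ (prep _ q)) (rotate _ _ _ _))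
    where
    case-u : _ → ⊥
    case-u (here refl) = x∉ (here refl)
    case-u (there u∈)  = u∉ u∈
  ... | at-leaf l e≡ = at-leaf (lastLeaf-there l u∉ k₁ k₂ side) e≡

  lastLeaf-perm : vs ↭ vs′ → es ↭ es′ → LastLeaf v w c vs es → LastLeaf v w c vs′ es′
  lastLeaf-perm p q l = record
    { LastLeaf l ; vs↭ = ↭-trans (LastLeaf.vs↭ l) p ; es↭ = ↭-trans (LastLeaf.es↭ l) q }

  HasEnd-perm : vs ↭ vs′ → es ↭ es′ → HasEnd vs es → HasEnd vs′ es′
  HasEnd-perm p q (v , w , c , l) = v , w , c , lastLeaf-perm p q l

  module _ {es : List (Edge G)} where
    matched : Joins G e y z → Joins G e v p → Joins G e₁ x y → Joins G e₂ x z →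
              ∃[ f₁ ] ∃[ f₂ ] (Joins G f₁ x v × Joins G f₂ x p × f₁ ∷ f₂ ∷ es ↭ e₁ ∷ e₂ ∷ es)
    matched j k j₁ j₂ with J-unique j k
    ... | inj₁ (refl , refl) = _ , _ , j₁ , j₂ , refl
    ... | inj₂ (refl , refl) = _ , _ , j₂ , j₁ , swap _ _ refl

  HasEnd-at-hub : End v w c us vs es → Joins G e v p → p ≡ w ⊎ p ≡ c → Joins G e y z →
    x ∉ vs → Joins G e₁ x y → Joins G e₂ x z → HasEnd (x ∷ vs) (e₁ ∷ e₂ ∷ es)
  HasEnd-at-hub end k side j x∉ j₁ j₂ with matched j k j₁ j₂
  ... | f₁ , f₂ , k₁ , k₂ , q = _ , _ , _ , lastLeaf-perm refl q (lastLeaf-here end x∉ k₁ k₂ side)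

  HasEnd-grow : HasEnd vs es → e ∈ es → Joins G e y z → x ∉ vs → Joins G e₁ x y → Joins G e₂ x z →
                HasEnd (x ∷ vs) (e₁ ∷ e₂ ∷ es)
  HasEnd-grow {vs} {es} {e} {y} {z} {x} {e₁} {e₂} (v , w , c , l) e∈ j x∉ j₁ j₂ =
    HasEnd-perm (prep x vs↭) (prep e₁ (prep e₂ es↭)) (go (Perm.∈-resp-↭ (↭-sym es↭) e∈))
    where
    open LastLeaf l renaming (j₁ to k₁; j₂ to k₂)
    x∉′ : x ∉ tip ∷ old
    x∉′ = x∉ ∘ Perm.∈-resp-↭ vs↭
    -- The last leaf `u` becomes the hub of a new ending triangle uvp, and everything else, older
    -- leaves included, becomes the tree behind it; `x` is its only leaf.
    at-last : ∀ {u p l₁ l₂ us vs es} → End v w c us vs es → u ∉ vs → Joins G l₁ u v → Joins G l₂ u p →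
              p ≡ w ⊎ p ≡ c → x ∉ u ∷ vs → e ≡ l₁ ⊎ e ≡ l₂ → HasEnd (x ∷ u ∷ vs) (e₁ ∷ e₂ ∷ l₁ ∷ l₂ ∷ es)
    at-last end u∉ k₁ k₂ side x∉ eq with End-edge end side
    ... | f , f∈ , k with base (End⇒Tree end) f∈ k u∉ k₁ k₂ | eq
    ...   | end′ | inj₁ refl = HasEnd-at-hub end′ k₁ (inj₁ refl) j x∉ j₁ j₂
    ...   | end′ | inj₂ refl = HasEnd-at-hub end′ k₂ (inj₂ refl) j x∉ j₁ j₂
    go : e ∈ l₁ ∷ l₂ ∷ oldE → HasEnd (x ∷ tip ∷ old) (e₁ ∷ e₂ ∷ l₁ ∷ l₂ ∷ oldE)
    go (here eq) = at-last end tip∉ k₁ k₂ side x∉′ (inj₁ eq)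
    go (there (here eq)) = at-last end tip∉ k₁ k₂ side x∉′ (inj₂ eq)
    go (there (there e∈)) with locate end e∈ j (x∉′ ∘ there) j₁ j₂
    ... | at-hub k p≡ = HasEnd-at-hub (leaf end tip∉ k₁ k₂ side) k p≡ j x∉′ j₁ j₂
    ... | in-core end′ p q = _ , _ , _ , lastLeaf-perm
        (↭-trans (prep tip p) (swap tip x refl)) (↭-trans (prep l₁ (prep l₂ q)) (rotate _ _ _ _))
        (lastLeaf-here end′ tip∉″ k₁ k₂ side)
      where
      tip∉″ : tip ∉ _
      tip∉″ u∈ with Perm.∈-resp-↭ p u∈
      ... | here refl = x∉′ (here refl)
      ... | there u∈′ = tip∉ u∈′
    ... | at-leaf m e≡ = HasEnd-perm
        (prep x vs↭″) (prep e₁ (prep e₂ es↭″))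
        (at-last (LastLeaf.end m′) (LastLeaf.tip∉ m′) (LastLeaf.j₁ m′) (LastLeaf.j₂ m′) (LastLeaf.side m′)
          (x∉′ ∘ Perm.∈-resp-↭ vs↭″) e≡)
      where
      m′ = lastLeaf-there m tip∉ k₁ k₂ side
      open LastLeaf m′ using () renaming (vs↭ to vs↭″; es↭ to es↭″)

  -- The cases are those of two, of three, and of at least four vertices.
  data Shape (vs : List (Vertex G)) (es : List (Edge G)) : Set where
    is-edge     : Joins G e x y → x ∷ y ∷ [] ↭ vs → e ∷ [] ↭ es → Shape vs es
    is-triangle : ∀ {a b c} → Joins G a x y → Joins G b x z → Joins G c y z → x ∉ y ∷ z ∷ [] →
                  x ∷ y ∷ z ∷ [] ↭ vs → a ∷ b ∷ c ∷ [] ↭ es → Shape vs es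
    has-end     : HasEnd vs es → Shape vs es

  Shape-perm : vs ↭ vs′ → es ↭ es′ → Shape vs es → Shape vs′ es′
  Shape-perm p q (is-edge j p′ q′) = is-edge j (↭-trans p′ p) (↭-trans q′ q)
  Shape-perm p q (is-triangle i j k x∉ p′ q′) = is-triangle i j k x∉ (↭-trans p′ p) (↭-trans q′ q)
  Shape-perm p q (has-end h) = has-end (HasEnd-perm p q h)

  private
    ∉-swap : x ∉ y ∷ z ∷ [] → Joins G e y z → y ∉ x ∷ z ∷ []
    ∉-swap x∉ j (here refl) = x∉ (here refl)
    ∉-swap x∉ j (there (here refl)) = J-≢ j refl
    ∉-swap′ : x ∉ y ∷ z ∷ [] → Joins G e y z → z ∉ x ∷ y ∷ []
    ∉-swap′ x∉ j (here refl) = x∉ (there (here refl))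
    ∉-swap′ x∉ j (there (here refl)) = J-≢ j refl

  -- A bare triangle has no distinguished hub, so one is chosen on the edge that receives the leaf:
  -- `x` if possible, and `y` for the edge yz.
  HasEnd-triangle : ∀ {a b c x y z s t e e₁ e₂ v} → Joins G a x y → Joins G b x z → Joins G c y z → x ∉ y ∷ z ∷ [] →
    e ∈ a ∷ b ∷ c ∷ [] → Joins G e s t → v ∉ x ∷ y ∷ z ∷ [] → Joins G e₁ v s → Joins G e₂ v t →
    HasEnd (v ∷ x ∷ y ∷ z ∷ []) (e₁ ∷ e₂ ∷ a ∷ b ∷ c ∷ [])
  HasEnd-triangle i j k x∉ (here refl) l v∉ j₁ j₂ =
    HasEnd-at-hub (base (edge k) (here refl) k x∉ i j) i (inj₁ refl) l v∉ j₁ j₂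
  HasEnd-triangle i j k x∉ (there (here refl)) l v∉ j₁ j₂ =
    HasEnd-at-hub (base (edge k) (here refl) k x∉ i j) j (inj₂ refl) l v∉ j₁ j₂
  HasEnd-triangle {x = x} {y} i j k x∉ (there (there (here refl))) l v∉ j₁ j₂ =
    HasEnd-perm (prep _ (swap y x refl)) (prep _ (prep _ (prep _ (swap _ _ refl))))
      (HasEnd-at-hub (base (edge j) (here refl) j (∉-swap x∉ k) (J-sym i) k) k (inj₂ refl) l
        (v∉ ∘ Perm.∈-resp-↭ (swap y x refl)) j₁ j₂)

  shape : Tree vs es → Shape vs es
  shape (edge j) = is-edge j refl refl
  shape (perm p q t) = Shape-perm p q (shape t)
  shape (grow {x = v} {e₁ = e₁} {e₂} t e∈ j v∉ j₁ j₂) with shape t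
  ... | has-end h = has-end (HasEnd-grow h e∈ j v∉ j₁ j₂)
  ... | is-triangle i k l x∉ p q = has-end (HasEnd-perm (prep v p) (prep e₁ (prep e₂ q))
        (HasEnd-triangle i k l x∉ (Perm.∈-resp-↭ (↭-sym q) e∈) j (v∉ ∘ Perm.∈-resp-↭ p) j₁ j₂))
  ... | is-edge k p q with Perm.∈-resp-↭ (↭-sym q) e∈
  ...   | here refl with J-unique j k
  ...     | inj₁ (refl , refl) = Shape-perm (prep v p) (prep e₁ (prep e₂ q))
            (is-triangle j₁ j₂ k (v∉ ∘ Perm.∈-resp-↭ p) refl refl)
  ...     | inj₂ (refl , refl) = Shape-perm (prep v p) (↭-trans (swap e₂ e₁ refl) (prep e₁ (prep e₂ q)))
            (is-triangle j₂ j₁ k (v∉ ∘ Perm.∈-resp-↭ p) refl refl)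

-- Realizing boundaries along a tree.

module Realization (G : Graph) where

  open Trees G
  open Ends G

  private
    variable
      vs us : List (Vertex G)
      es : List (Edge G)
      e f g e₁ e₂ : Edge G
      x y z u v w c p q a d : Vertex G
      β : Vertex G → Z₃

  root : Tree vs es → Vertex G
  root t = proj₁ (Full-doubled t)

  private
    cases₂ : ∀ {A : Vertex G → Set} {x y z es β} → y ≢ x → z ≢ x →
             (∀ {γ} → γ x ≡ 0F → R A es γ) → R A ((x , y) ∷ (x , z) ∷ es) β
    cases₂ {A} {x} {y} {z} {es} {β} y≢x z≢x h = go (β x) refl
      where
      δy = δ-fst y≢x
      δz = δ-fst z≢x
      go : ∀ b → β x ≡ b → R A ((x , y) ∷ (x , z) ∷ es) β
      go 0F eq = fwd (bwd (h (cong₂ _⊞_ (cong₂ _⊟_ eq δy) δz)))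
      go 1F eq = bwd (bwd (h (cong₂ _⊞_ (cong₂ _⊞_ eq δy) δz)))
      go 2F eq = fwd (fwd (h (cong₂ _⊟_ (cong₂ _⊟_ eq δy) δz)))

  module Leaf (t : Tree vs es) (e∈ : e ∈ es) (j : Joins G e p q) (u∉ : u ∉ vs)
              (j₁ : Joins G e₁ u p) (j₂ : Joins G e₂ u q) where

    -- With nothing to be met at `u`, its two edges are free to act as the second copy of pq that
    -- `Full-doubled` asks for.
    R-zero : β u ≡ 0F → R (Off (root t) (u ∷ vs)) (map (ends G) (e₁ ∷ e₂ ∷ es)) β
    R-zero {β} βu = R-join⁺ {G = G} j₁ (R-∷ (R-join⁺ {G = G} j₂)
      (R-lift u (R-extend Off-∷ ((p≢u , q≢u) ∷ ∉⇒Avoids t u∉) βu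
        (R-join⁻ {G = G} j (proj₂ (Full-doubled t) e∈ β)))))
      where
      p≢u = J-≢ j₁ ∘ sym
      q≢u = J-≢ j₂ ∘ sym

    -- The edge ua can carry the whole value of u, so that p – u – q acts as a second edge pq.
    R-nonzero : Joins G f u a → β u ≢ 0F → R (Off (root t) (u ∷ vs)) (map (ends G) (f ∷ e₁ ∷ e₂ ∷ es)) β
    R-nonzero {f} {a} {β} k βu≢0 = R-join⁺ {G = G} k (go (β u) refl)
      where
      δa = δ-fst (J-≢ k ∘ sym)
      go : ∀ b → β u ≡ b → R (Off (root t) (u ∷ vs)) ((u , a) ∷ map (ends G) (e₁ ∷ e₂ ∷ es)) β
      go 0F eq = ⊥-elim (βu≢0 eq)
      go 1F eq = fwd (R-zero (cong₂ _⊟_ eq δa))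
      go 2F eq = bwd (R-zero (cong₂ _⊞_ eq δa))

    Full-degree-4 : Joins G f u a → Joins G g u d →
                    Full (Off (root t) (u ∷ vs)) (map (ends G) (f ∷ g ∷ e₁ ∷ e₂ ∷ es))
    Full-degree-4 k l β = R-join⁺ {G = G} k (R-∷ (R-join⁺ {G = G} l)
      (cases₂ (J-≢ k ∘ sym) (J-≢ l ∘ sym) (λ γu → R-zero γu)))

  private
    unshift : ∀ s a b → (s ⊟ a ⊟ b) ⊞ a ⊞ b ≡ s × (s ⊞ a ⊟ b) ⊟ a ⊞ b ≡ s × (s ⊞ a ⊞ b) ⊟ a ⊟ b ≡ s
    unshift s a b = one s a b , two s a b , three s a b
      where
      one : ∀ s a b → (s ⊟ a ⊟ b) ⊞ a ⊞ b ≡ s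
      one = from-yes (all? λ s → all? λ a → all? λ b → ((s ⊟ a ⊟ b) ⊞ a ⊞ b) ≟ s)
      two : ∀ s a b → (s ⊞ a ⊟ b) ⊟ a ⊞ b ≡ s
      two = from-yes (all? λ s → all? λ a → all? λ b → ((s ⊞ a ⊟ b) ⊟ a ⊞ b) ≟ s)
      three : ∀ s a b → (s ⊞ a ⊞ b) ⊟ a ⊟ b ≡ s
      three = from-yes (all? λ s → all? λ a → all? λ b → ((s ⊞ a ⊞ b) ⊟ a ⊟ b) ≟ s)

  End-root : End v w c us vs es → Vertex G
  End-root (base t _ _ _ _ _) = root t
  End-root (leaf end _ _ _ _) = End-root end

  -- A family of boundaries taking every value at the hub v, but agreeing on the hanging
  -- vertices, has a member that is 0 at v once these vertices are served; then the path
  -- w – v – c doubles the edge wc of the remaining tree.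
  End-free : ∀ (end : End v w c us vs es) {I : Set} (Γ : I → Vertex G → Z₃) →
             (∀ s → ∃[ i ] Γ i v ≡ s) → (∀ {u} → u ∈ us → ∀ i k → Γ i u ≡ Γ k u) →
             ∃[ i ] R (Off (End-root end) vs) (map (ends G) es) (Γ i)
  End-free (base t e∈ j v∉ j₁ j₂) Γ any-value _ with any-value 0F
  ... | i , eq = i , Leaf.R-zero t e∈ j v∉ j₁ j₂ eq
  End-free {v} {w} {c} (leaf {us} {vs} {es} {u} {p} {e₁} {e₂} end u∉ j₁ j₂ side) {I} Γ any-value agree =
    let i , h = go (Γ i₀ u) refl in i , R-join⁺ {G = G} j₁ (R-∷ (R-join⁺ {G = G} j₂) h)
    where
    i₀ = proj₁ (any-value 0F)
    A = Off (End-root end) (u ∷ vs)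
    av = ∉⇒Avoids (End⇒Tree end) u∉
    δv = δ-fst (J-≢ j₁ ∘ sym)
    δp = δ-fst (J-≢ j₂ ∘ sym)
    at-u : ∀ i {b} → Γ i₀ u ≡ b → Γ i u ≡ b
    at-u i eq = trans (agree (here refl) i i₀) eq
    -- All `Γ i` agree at `u`, so one orientation `op` of its two edges serves them all. It shifts
    -- their values at `v` by a common constant, and so these values still exhaust ℤ₃.
    recurse : (op : Z₃ → Vertex G → Z₃) → (∀ s → ∃[ z ] op z v ≡ s) → (∀ i → op (Γ i u) u ≡ 0F) →
              ∃[ i ] R A (map (ends G) es) (λ x → op (Γ i x) x)
    recurse op surj zero-u with End-free end (λ i x → op (Γ i x) x)
        (λ s → let z , eq = surj s ; i , eq′ = any-value z in i , trans (cong (λ z → op z v) eq′) eq)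
        (λ {x} x∈ i k → cong (λ z → op z x) (agree (there x∈) i k))
    ... | i , h = i , R-extend Off-∷ av (zero-u i) h
    dv = δ (u , v) v
    dp = δ (u , p) v
    go : ∀ z → Γ i₀ u ≡ z → ∃[ i ] R A ((u , v) ∷ (u , p) ∷ map (ends G) es) (Γ i)
    go 0F eq with recurse (λ z x → z ⊟ δ (u , v) x ⊞ δ (u , p) x)
      (λ s → s ⊞ dv ⊟ dp , proj₁ (proj₂ (unshift s dv dp))) (λ i → cong₂ _⊞_ (cong₂ _⊟_ (at-u i eq) δv) δp)
    ... | i , h = i , fwd (bwd h)
    go 1F eq with recurse (λ z x → z ⊞ δ (u , v) x ⊞ δ (u , p) x)
      (λ s → s ⊟ dv ⊟ dp , proj₁ (unshift s dv dp)) (λ i → cong₂ _⊞_ (cong₂ _⊞_ (at-u i eq) δv) δp)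
    ... | i , h = i , bwd (bwd h)
    go 2F eq with recurse (λ z x → z ⊟ δ (u , v) x ⊟ δ (u , p) x)
      (λ s → s ⊞ dv ⊞ dp , proj₂ (proj₂ (unshift s dv dp))) (λ i → cong₂ _⊟_ (cong₂ _⊟_ (at-u i eq) δv) δp)
    ... | i , h = i , fwd (fwd h)

  star-at : ∀ {x q a : Vertex G} → q ≢ x → a ≢ x → star x q a x ≡ 1F
  star-at {x} q≢x a≢x = cong₂ _⊞_ (cong₂ _⊞_ (single-≡ x 1F) (single-≢ 1F q≢x)) (single-≢ 1F a≢x)

  -- `true` stands for a source, `false` for a sink.
  signed : Bool → Z₃ → Z₃ → Z₃
  signed true  b s = b ⊞ s
  signed false b s = b ⊟ s

  R-signed : ∀ {A B : Vertex G → Set} {ps β} s → (∀ x → B x → x ≡ u ⊎ A x) → Avoids u ps →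
             p ≢ u → q ≢ u → a ≢ u → β u ≡ 0F →
             R A ps (λ x → signed s (β x) (star p q a x)) →
             R B ((u , p) ∷ (u , q) ∷ (u , a) ∷ ps) β
  R-signed true  B⊆ av p≢ q≢ a≢ βu r = R-star B⊆ av p≢ q≢ a≢ βu (inj₁ r)
  R-signed false B⊆ av p≢ q≢ a≢ βu r = R-star B⊆ av p≢ q≢ a≢ βu (inj₂ r)

  signed-0 : ∀ s b {z} → z ≡ 0F → signed s b z ≡ b
  signed-0 true  b refl = ⊞-identityʳ b
  signed-0 false b refl = ⊞-identityʳ b

  -- The choices at `u₁` and `u₂` form a family as required by `End-free`: each changes the value at
  -- `v` by exactly 1 or -1, because the other neighbours differ from `v`, and none changes the
  -- value at a vertex of `us`, because no neighbour lies there.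
  two-stars : ∀ {u₁ u₂ p₁ p₂ a₁ a₂} (end : End v w c us vs es) →
    u₂ ∉ vs → u₁ ∉ u₂ ∷ vs → p₁ ∈ vs → p₂ ∈ vs → a₁ ∈ vs → a₂ ∈ vs →
    p₁ ≢ v → p₂ ≢ v → a₁ ≢ v → a₂ ≢ v →
    (∀ {u} → u ∈ us → p₁ ≢ u × p₂ ≢ u × a₁ ≢ u × a₂ ≢ u × v ≢ u) →
    β u₁ ≡ 0F → β u₂ ≡ 0F →
    R (Off (End-root end) (u₁ ∷ u₂ ∷ vs))
      ((u₁ , v) ∷ (u₁ , p₁) ∷ (u₁ , a₁) ∷ (u₂ , v) ∷ (u₂ , p₂) ∷ (u₂ , a₂) ∷ map (ends G) es) β
  two-stars {v} {β = β} {u₁} {u₂} {p₁} {p₂} {a₁} {a₂} end u₂∉ u₁∉ p₁∈ p₂∈ a₁∈ a₂∈ p₁≢v p₂≢v a₁≢v a₂≢v off βu₁ βu₂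
    with End-free end Γ any-value agree
    where
    star₁ = star v p₁ a₁
    star₂ = star v p₂ a₂
    Γ : Bool × Bool → _ → Z₃
    Γ (s₁ , s₂) x = signed s₂ (signed s₁ (β x) (star₁ x)) (star₂ x)
    value : ∀ b s → ∃[ i ] signed (proj₂ i) (signed (proj₁ i) b 1F) 1F ≡ s
    -- Equal signs change the value by 2 or -2, opposite signs by 0.
    value b s with s ≟ (b ⊞ 1F ⊞ 1F) | s ≟ (b ⊟ 1F ⊟ 1F) | s ≟ (b ⊞ 1F ⊟ 1F)
    ... | yes eq | _ | _ = (true , true) , sym eq
    ... | no _ | yes eq | _ = (false , false) , sym eq
    ... | no _ | no _ | yes eq = (true , false) , sym eq
    ... | no n₁ | no n₂ | no n₃ = ⊥-elim (impossible b s n₁ n₂ n₃)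
      where
      impossible : ∀ b s → s ≢ b ⊞ 1F ⊞ 1F → s ≢ b ⊟ 1F ⊟ 1F → s ≢ b ⊞ 1F ⊟ 1F → ⊥
      impossible = from-yes (all? λ b → all? λ s → ¬? (s ≟ (b ⊞ 1F ⊞ 1F)) →-dec
        (¬? (s ≟ (b ⊟ 1F ⊟ 1F)) →-dec (¬? (s ≟ (b ⊞ 1F ⊟ 1F)) →-dec no λ ())))
    any-value : ∀ s → ∃[ i ] Γ i v ≡ s
    any-value s with value (β v) s
    ... | i , eq = i , trans (cong₂ (λ y z → signed (proj₂ i) (signed (proj₁ i) (β v) y) z)
                          (star-at p₁≢v a₁≢v) (star-at p₂≢v a₂≢v)) eq
    at : ∀ {u} → u ∈ _ → ∀ i → Γ i u ≡ β u
    at u∈ (s₁ , s₂) = let p₁≢ , p₂≢ , a₁≢ , a₂≢ , v≢ = off u∈ in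
      trans (signed-0 s₂ _ (star-avoid v≢ p₂≢ a₂≢)) (signed-0 s₁ _ (star-avoid v≢ p₁≢ a₁≢))
    agree : ∀ {u} → u ∈ _ → ∀ i k → Γ i u ≡ Γ k u
    agree u∈ i k = trans (at u∈ i) (sym (at u∈ k))
  ... | (s₁ , s₂) , r =
    R-signed s₁ Off-∷ ((u₂≢u₁ , v≢u₁) ∷ (u₂≢u₁ , ∈∉⇒≢ (there p₂∈) u₁∉) ∷ (u₂≢u₁ , ∈∉⇒≢ (there a₂∈) u₁∉) ∷
        ∉⇒Avoids t (u₁∉ ∘ there)) v≢u₁ (∈∉⇒≢ (there p₁∈) u₁∉) (∈∉⇒≢ (there a₁∈) u₁∉) βu₁
      (R-signed s₂ Off-∷ (∉⇒Avoids t u₂∉) v≢u₂ (∈∉⇒≢ p₂∈ u₂∉) (∈∉⇒≢ a₂∈ u₂∉)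
        (trans (signed-0 s₁ (β u₂) (star-avoid v≢u₂ (∈∉⇒≢ p₁∈ u₂∉) (∈∉⇒≢ a₁∈ u₂∉))) βu₂) r)
    where
    t = End⇒Tree end
    u₂≢u₁ = ∈∉⇒≢ (here refl) u₁∉
    v≢u₁ = ∈∉⇒≢ (there (hub∈ end)) u₁∉
    v≢u₂ = ∈∉⇒≢ (hub∈ end) u₂∉

  module Last-two (t : Tree vs es) (e∈ : e ∈ es) (j : Joins G e w c) (v∉ : v ∉ vs)
                  (k₁ : Joins G e₁ v w) (k₂ : Joins G e₂ v c)
                  (u∉ : u ∉ v ∷ vs) (a≢u : a ≢ u) (a≢v : a ≢ v) where

    private
      w∈ = proj₁ (Tree-ends t e∈ j)
      c∈ = proj₂ (Tree-ends t e∈ j)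
      v≢u = ∈∉⇒≢ (here refl) u∉
      w≢u = ∈∉⇒≢ (there w∈) u∉
      star-v = star-at {v} {w} {a} (∈∉⇒≢ w∈ v∉) a≢v
      tv = grow t e∈ j v∉ k₁ k₂

      Realizable : List (Edge G) → (Vertex G → Z₃) → Set
      Realizable fs = R (Off (root t) (u ∷ v ∷ vs)) ((u , v) ∷ (u , w) ∷ (u , a) ∷ map (ends G) fs)

    -- u may be a source or a sink, and the right choice turns the value of v into 0.
    R-hub-nonzero : β u ≡ 0F → β v ≢ 0F → Realizable (e₁ ∷ e₂ ∷ es) β
    R-hub-nonzero {β} βu βv≢0 = go (β v) refl
      where
      go : ∀ b → β v ≡ b → Realizable (e₁ ∷ e₂ ∷ es) β
      finish : ∀ s → signed s (β v) 1F ≡ 0F → Realizable (e₁ ∷ e₂ ∷ es) β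
      finish s eq = R-signed s Off-∷ (∉⇒Avoids tv u∉) v≢u w≢u a≢u βu
        (Leaf.R-zero t e∈ j v∉ k₁ k₂ (trans (cong (signed s (β v)) star-v) eq))
      go 0F eq = ⊥-elim (βv≢0 eq)
      go 1F eq = finish false (cong (_⊟ 1F) eq)
      go 2F eq = finish true (cong (_⊞ 1F) eq)

    -- Here the right choice makes the value of v nonzero, and vd can carry it.
    R-hub-extra : Joins G g v d → d ≢ u → β u ≡ 0F → Realizable (g ∷ e₁ ∷ e₂ ∷ es) β
    R-hub-extra {g} {β = β} l d≢u βu = go (β v) refl
      where
      go : ∀ b → β v ≡ b → Realizable (g ∷ e₁ ∷ e₂ ∷ es) β
      finish : ∀ s → signed s (β v) 1F ≢ 0F → Realizable (g ∷ e₁ ∷ e₂ ∷ es) β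
      finish s ne = R-signed s Off-∷ (J-avoids l v≢u d≢u ∷ ∉⇒Avoids tv u∉) v≢u w≢u a≢u βu
        (Leaf.R-nonzero t e∈ j v∉ k₁ k₂ l (ne ∘ trans (sym (cong (signed s (β v)) star-v))))
      go 0F eq = finish true (λ z → contradiction (trans (sym (cong (_⊞ 1F) eq)) z) λ ())
      go 1F eq = finish true (λ z → contradiction (trans (sym (cong (_⊞ 1F) eq)) z) λ ())
      go 2F eq = finish false (λ z → contradiction (trans (sym (cong (_⊟ 1F) eq)) z) λ ())

all∈⇒≡⊤ : ∀ {n} {p : Subset n} → (∀ x → x ∈ˢ p) → p ≡ ⊤
all∈⇒≡⊤ h = ⊆-antisym ⊆⊤ (λ _ → h _)

-- Embeddings

module _ {H G : Graph} (ι : H ↪ G) where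

  Joins-↪⁺ : ∀ {e x y} → Joins H e x y → Joins G (onE ι e) (onV ι x) (onV ι y)
  Joins-↪⁺ (inj₁ (refl , refl)) = onE-joins ι _
  Joins-↪⁺ (inj₂ (refl , refl)) = Joins-sym {G} (onE-joins ι _)

  Joins-↪⁻ : ∀ {e x y} → Joins G (onE ι e) (onV ι x) (onV ι y) → Joins H e x y
  Joins-↪⁻ {e} j with Trees.J-unique G j (onE-joins ι e)
  ... | inj₁ (p , q) = inj₁ (onV-inj ι p , onV-inj ι q)
  ... | inj₂ (p , q) = inj₂ (onV-inj ι p , onV-inj ι q)

  surjective⇒⊤ : (∀ x → ∃[ y ] onV ι y ≡ x) → V⟨ ι ⟩ ≡ ⊤
  surjective⇒⊤ surj = all∈⇒≡⊤ λ x → let y , eq = surj x in subst (_∈ˢ V⟨ ι ⟩) eq (∈-V⁺ ι y)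

  surjectiveE⇒⊤ : (∀ e → ∃[ f ] onE ι f ≡ e) → E⟨ ι ⟩ ≡ ⊤
  surjectiveE⇒⊤ surj = all∈⇒≡⊤ λ x → let y , eq = surj x in subst (_∈ˢ E⟨ ι ⟩) eq (∈-E⁺ ι y)

id↪ : ∀ {G} → G ↪ G
id↪ = record
  { onV = id ; onE = id ; onV-inj = id ; onE-inj = id ; onE-joins = λ _ → inj₁ (refl , refl) }

≅-refl : ∀ {G} → G ≅ G
≅-refl {G} = id↪ {G} , surjective⇒⊤ (id↪ {G}) (λ x → x , refl) , surjectiveE⇒⊤ (id↪ {G}) (λ e → e , refl)

_∘↪_ : ∀ {H G K} → G ↪ K → H ↪ G → H ↪ K
κ ∘↪ ι = record
  { onV = onV κ ∘ onV ι ; onE = onE κ ∘ onE ι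
  ; onV-inj = onV-inj ι ∘ onV-inj κ ; onE-inj = onE-inj ι ∘ onE-inj κ
  ; onE-joins = λ e → Joins-↪⁺ κ (onE-joins ι e) }

factor : ∀ {H D G} (τ : H ↪ G) (ι : D ↪ G) → (∀ x → ∃[ d ] onV ι d ≡ onV τ x) →
         (∀ e → ∃[ f ] onE ι f ≡ onE τ e) → H ↪ D
factor {H} {G = G} τ ι liftV liftE = record
  { onV = proj₁ ∘ liftV ; onE = proj₁ ∘ liftE
  ; onV-inj = λ {x} {y} eq → onV-inj τ (trans (sym (proj₂ (liftV x))) (trans (cong (onV ι) eq) (proj₂ (liftV y))))
  ; onE-inj = λ {x} {y} eq → onE-inj τ (trans (sym (proj₂ (liftE x))) (trans (cong (onE ι) eq) (proj₂ (liftE y))))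
  ; onE-joins = λ e → Joins-↪⁻ ι (transport (proj₂ (liftE e)) (proj₂ (liftV (src H e))) (proj₂ (liftV (tgt H e)))
                        (onE-joins τ e)) }
  where
  transport : ∀ {e e′ x x′ y y′} → e′ ≡ e → x′ ≡ x → y′ ≡ y → Joins G e x y → Joins G e′ x′ y′
  transport refl refl refl j = j

≅-sym : ∀ {H G} (ι : H ↪ G) → (∀ x → ∃[ y ] onV ι y ≡ x) → (∀ e → ∃[ f ] onE ι f ≡ e) → G ≅ H
≅-sym ι surjV surjE = κ , surjective⇒⊤ κ (λ h → onV ι h , onV-inj ι (proj₂ (surjV (onV ι h))))
                        , surjectiveE⇒⊤ κ (λ h → onE ι h , onE-inj ι (proj₂ (surjE (onE ι h))))
  where κ = factor id↪ ι surjV surjE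

-- Induced subgraphs

lookup-injective : ∀ {A : Set} {xs : List A} → Unique xs → Injective _≡_ _≡_ (lookup xs)
lookup-injective {xs = _ ∷ _} _        {zero}  {zero}  eq = refl
lookup-injective {xs = _ ∷ xs} (a ∷ _) {zero}  {suc j} eq = ⊥-elim (All.lookup a (∈-lookup j) eq)
lookup-injective {xs = _ ∷ xs} (a ∷ _) {suc i} {zero}  eq = ⊥-elim (All.lookup a (∈-lookup i) (sym eq))
lookup-injective {xs = _ ∷ _} (_ ∷ u)  {suc i} {suc j} eq = cong suc (lookup-injective u eq)

record Enumeration {n} (P : Fin n → Set) : Set where
  field
    count     : ℕ
    at        : Fin count → Fin n
    injective : Injective _≡_ _≡_ at
    sound     : ∀ i → P (at i)
    complete  : ∀ {x} → P x → ∃[ i ] at i ≡ x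

enumerate : ∀ {n} {P : Fin n → Set} → Decidable P → Enumeration P
enumerate {n} P? = record
  { count = length (filter P? (allFin n))
  ; at = lookup (filter P? (allFin n))
  ; injective = lookup-injective (Unique.filter⁺ P? (Unique.allFin⁺ n))
  ; sound = λ i → proj₂ (∈-filter⁻ P? {xs = allFin n} (∈-lookup i))
  ; complete = λ px → let x∈ = ∈-filter⁺ P? (∈-allFin _) px in index x∈ , sym (lookup-index x∈) }

module Induced (G : Graph) {P : Vertex G → Set} (P? : Decidable P) where

  private
    module Vs = Enumeration (enumerate P?)
    Kept : Edge G → Set
    Kept e = P (src G e) × P (tgt G e)
    module Es = Enumeration (enumerate {P = Kept} (λ e → P? (src G e) ×-dec P? (tgt G e)))

  induced : Graph
  induced = record
    { order = Vs.count ; size = Es.count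
    ; src = λ e → proj₁ (Vs.complete (proj₁ (Es.sound e)))
    ; tgt = λ e → proj₁ (Vs.complete (proj₂ (Es.sound e)))
    ; loopless = λ e eq → loopless G (Es.at e) (trans (sym (proj₂ (Vs.complete (proj₁ (Es.sound e)))))
        (trans (cong Vs.at eq) (proj₂ (Vs.complete (proj₂ (Es.sound e)))))) }

  inclusion : induced ↪ G
  inclusion = record
    { onV = Vs.at ; onE = Es.at ; onV-inj = Vs.injective ; onE-inj = Es.injective
    ; onE-joins = λ e → inj₁ (sym (proj₂ (Vs.complete (proj₁ (Es.sound e))))
                            , sym (proj₂ (Vs.complete (proj₂ (Es.sound e))))) }

  vertex⁺ : ∀ {x} → P x → ∃[ y ] onV inclusion y ≡ x
  vertex⁺ = Vs.complete

  vertex⁻ : ∀ y → P (onV inclusion y)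
  vertex⁻ = Vs.sound

  edge⁺ : ∀ {e} → P (src G e) → P (tgt G e) → ∃[ f ] onE inclusion f ≡ e
  edge⁺ ps pt = Es.complete (ps , pt)

  edge⁻ : ∀ f → P (src G (onE inclusion f)) × P (tgt G (onE inclusion f))
  edge⁻ = Es.sound

-- Adding an edge

-- `addEdge` is defined by a `with` and by anonymous functions. The view describes its result by
-- equations instead, and keeps apart the case in which no edge is added.
data AddEdgeView (G : Graph) (x y : Vertex G) : Graph → Set where
  loop : x ≡ y → AddEdgeView G x y G
  new  : ∀ {s t l} → s zero ≡ x → t zero ≡ y → (∀ e → s (suc e) ≡ src G e) → (∀ e → t (suc e) ≡ tgt G e) →
         AddEdgeView G x y (record { order = order G ; size = suc (size G) ; src = s ; tgt = t ; loopless = l })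

addEdge-view : ∀ G x y → AddEdgeView G x y (addEdge G x y)
addEdge-view G x y with x ≟ y
... | yes eq = loop eq
... | no _   = new refl refl (λ _ → refl) (λ _ → refl)

private
  pairs-new : ∀ {m n} (f : Fin (suc m) → Pair n) (g : Fin m → Pair n) {e} → f zero ≡ e → (∀ i → f (suc i) ≡ g i) →
              map f (allFin (suc m)) ≡ e ∷ map g (allFin m)
  pairs-new f g eq eqs = trans (List.map-tabulate id f)
    (cong₂ _∷_ eq (trans (List.tabulate-cong eqs) (sym (List.map-tabulate id g))))

  new-↪ : ∀ {G x y K} → AddEdgeView G x y K → Σ[ ι ∈ G ↪ K ] V⟨ ι ⟩ ≡ ⊤
  new-↪ {G} (loop _) = id↪ , surjective⇒⊤ (id↪ {G}) (λ x → x , refl)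
  new-↪ {G} {K = K} (new _ _ ss ts) = ι , surjective⇒⊤ ι (λ x → x , refl)
    where
    ι : G ↪ K
    ι = record { onV = id ; onE = suc ; onV-inj = id ; onE-inj = suc-injective
               ; onE-joins = λ e → inj₁ (ss e , ts e) }

  new⇒Full : ∀ {G x y K} → AddEdgeView G x y K → Z₃-Connected K →
             ∀ r → Full (_≢ r) ((x , y) ∷ pairs G)
  new⇒Full {G} (loop refl) conn r β = R-loop⁺ (connected⇒Full G conn r β)
  new⇒Full {G} {K = K} (new s₀ t₀ ss ts) conn r β = subst (λ ps → R (_≢ r) ps β)
    (pairs-new (ends K) (ends G) (cong₂ _,_ s₀ t₀) (λ e → cong₂ _,_ (ss e) (ts e))) (connected⇒Full K conn r β)

  R⇒new : ∀ {G x y K} → AddEdgeView G x y K → (∀ β → ∃[ r ] R (_≢ r) ((x , y) ∷ pairs G) β) → Z₃-Connected K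
  R⇒new {G} (loop refl) h = R⇒connected G λ β → let r , k = h β in r , R-loop⁻ k
  R⇒new {G} {K = K} (new s₀ t₀ ss ts) h = R⇒connected K λ β → let r , k = h β in
    r , subst (λ ps → R (_≢ r) ps β)
      (sym (pairs-new (ends K) (ends G) (cong₂ _,_ s₀ t₀) (λ e → cong₂ _,_ (ss e) (ts e)))) k

addEdge-↪ : ∀ G x y → Σ[ ι ∈ G ↪ addEdge G x y ] V⟨ ι ⟩ ≡ ⊤
addEdge-↪ G x y = new-↪ (addEdge-view G x y)

addEdge⇒Full : ∀ G {x y} → Z₃-Connected (addEdge G x y) → ∀ r → Full (_≢ r) ((x , y) ∷ pairs G)
addEdge⇒Full G {x} {y} = new⇒Full (addEdge-view G x y)

R⇒addEdge : ∀ G {x y} → (∀ β → ∃[ r ] R (_≢ r) ((x , y) ∷ pairs G) β) → Z₃-Connected (addEdge G x y)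
R⇒addEdge G {x} {y} = R⇒new (addEdge-view G x y)

-- Trees in G and triangle-trees

module Models (G : Graph) where

  open Trees G
  open Ends G

  -- The `into` fields let the tree factor through a subgraph, `ontoV` makes it span there, and
  -- `ontoE` finds the edge to which the next vertex is attached.
  record Model (vs : List (Vertex G)) (es : List (Edge G)) : Set where
    field
      {T}      : Graph
      tree     : TriangleTree T
      τ        : T ↪ G
      ontoV    : ∀ {x} → x ∈ vs → ∃[ y ] onV τ y ≡ x
      ontoE    : ∀ {e} → e ∈ es → ∃[ f ] onE τ f ≡ e
      intoV    : ∀ y → onV τ y ∈ vs
      intoE    : ∀ f → onE τ f ∈ es

  Model-perm : ∀ {vs vs′ es es′} → vs ↭ vs′ → es ↭ es′ → Model vs es → Model vs′ es′
  Model-perm p q m = record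
    { tree = tree ; τ = τ
    ; ontoV = ontoV ∘ Perm.∈-resp-↭ (↭-sym p) ; ontoE = ontoE ∘ Perm.∈-resp-↭ (↭-sym q)
    ; intoV = Perm.∈-resp-↭ p ∘ intoV ; intoE = Perm.∈-resp-↭ q ∘ intoE }
    where open Model m

  module _ {x y z a b c} (i : Joins G a x y) (j : Joins G b x z) (k : Joins G c y z) where

    triangle-↪ : K₃ ↪ G
    triangle-↪ = record
      { onV = lookup (x ∷ y ∷ z ∷ []) ; onE = lookup (a ∷ b ∷ c ∷ [])
      ; onV-inj = lookup-injective ((J-≢ i ∷ J-≢ j ∷ []) ∷ (J-≢ k ∷ []) ∷ [] ∷ [])
      ; onE-inj = lookup-injective ((a≢b ∷ a≢c ∷ []) ∷ (b≢c ∷ []) ∷ [] ∷ [])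
      ; onE-joins = λ { 0F → i ; 1F → j ; 2F → k } }
      where
      a≢b : a ≢ b
      a≢b refl = J-≢ k (J-other j i)
      a≢c : a ≢ c
      a≢c refl = J-≢ j (J-other k (J-sym i))
      b≢c : b ≢ c
      b≢c refl = J-≢ i (J-other (J-sym k) (J-sym j))

    triangle-model : Model (x ∷ y ∷ z ∷ []) (a ∷ b ∷ c ∷ [])
    triangle-model = record
      { tree = triangle ; τ = triangle-↪
      ; ontoV = λ { (here refl) → 0F , refl ; (there (here refl)) → 1F , refl ; (there (there (here refl))) → 2F , refl }
      ; ontoE = λ { (here refl) → 0F , refl ; (there (here refl)) → 1F , refl ; (there (there (here refl))) → 2F , refl }
      ; intoV = λ { 0F → here refl ; 1F → there (here refl) ; 2F → there (there (here refl)) }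
      ; intoE = λ { 0F → here refl ; 1F → there (here refl) ; 2F → there (there (here refl)) } }

  attach-model : ∀ {vs es x y z e e₁ e₂} → Model vs es → e ∈ es → Joins G e y z → y ∈ vs → z ∈ vs → x ∉ vs →
    e₁ ∉ es → e₂ ∉ es → Joins G e₁ x y → Joins G e₂ x z → Model (x ∷ vs) (e₁ ∷ e₂ ∷ es)
  attach-model {vs} {es} {x} {e₁ = e₁} {e₂} m e∈ j y∈ z∈ x∉ e₁∉ e₂∉ j₁ j₂
    with Model.ontoV m y∈ | Model.ontoV m z∈ | Model.ontoE m e∈
  ... | y′ , refl | z′ , refl | e′ , refl = record
    { tree = grow {y = y′} {z = z′} tree (e′ , Joins-↪⁻ τ j)
    ; τ = record { onV = vert ; onE = edg
                 ; onV-inj = λ {s} {t} → vert-inj s t ; onE-inj = λ {s} {t} → edg-inj s t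
                 ; onE-joins = λ { zero → j₁ ; (suc zero) → j₂ ; (suc (suc f)) → onE-joins τ f } }
    ; ontoV = λ { (here refl) → zero , refl ; (there x∈) → let y , eq = ontoV x∈ in suc y , eq }
    ; ontoE = λ { (here refl) → zero , refl ; (there (here refl)) → suc zero , refl
                ; (there (there f∈)) → let f , eq = ontoE f∈ in suc (suc f) , eq }
    ; intoV = λ { zero → here refl ; (suc v) → there (intoV v) }
    ; intoE = λ { zero → here refl ; (suc zero) → there (here refl) ; (suc (suc f)) → there (there (intoE f)) } }
    where
    open Model m
    vert : Fin (suc (order T)) → Vertex G
    vert zero    = x
    vert (suc v) = onV τ v
    edg : Fin (suc (suc (size T))) → Edge G
    edg zero          = e₁
    edg (suc zero)    = e₂
    edg (suc (suc f)) = onE τ f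
    vert-inj : ∀ s t → vert s ≡ vert t → s ≡ t
    vert-inj zero zero _ = refl
    vert-inj zero (suc t) eq = ⊥-elim (x∉ (subst (_∈ vs) (sym eq) (intoV t)))
    vert-inj (suc s) zero eq = ⊥-elim (x∉ (subst (_∈ vs) eq (intoV s)))
    vert-inj (suc s) (suc t) eq = cong suc (onV-inj τ eq)
    e₁≢e₂ : e₁ ≢ e₂
    e₁≢e₂ refl = J-≢ j (J-other j₂ j₁)
    edg-inj : ∀ s t → edg s ≡ edg t → s ≡ t
    edg-inj zero zero _ = refl
    edg-inj zero (suc zero) eq = ⊥-elim (e₁≢e₂ eq)
    edg-inj zero (suc (suc t)) eq = ⊥-elim (e₁∉ (subst (_∈ es) (sym eq) (intoE t)))
    edg-inj (suc zero) zero eq = ⊥-elim (e₁≢e₂ (sym eq))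
    edg-inj (suc zero) (suc zero) _ = refl
    edg-inj (suc zero) (suc (suc t)) eq = ⊥-elim (e₂∉ (subst (_∈ es) (sym eq) (intoE t)))
    edg-inj (suc (suc s)) zero eq = ⊥-elim (e₁∉ (subst (_∈ es) eq (intoE s)))
    edg-inj (suc (suc s)) (suc zero) eq = ⊥-elim (e₂∉ (subst (_∈ es) eq (intoE s)))
    edg-inj (suc (suc s)) (suc (suc t)) eq = cong (λ f → Fin.suc (Fin.suc f)) (onE-inj τ eq)

  -- The only kind of `Tree` that is not a triangle-tree.
  data IsEdge (vs : List (Vertex G)) (es : List (Edge G)) : Set where
    is-edge : ∀ {e x y} → Joins G e x y → x ∷ y ∷ [] ↭ vs → e ∷ [] ↭ es → IsEdge vs es

  model : ∀ {vs es} → Tree vs es → IsEdge vs es ⊎ Model vs es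
  grown-model : ∀ {vs es x y z e e₁ e₂} → Tree vs es → e ∈ es → Joins G e y z → x ∉ vs →
                Joins G e₁ x y → Joins G e₂ x z → Model (x ∷ vs) (e₁ ∷ e₂ ∷ es)

  model (edge j) = inj₁ (is-edge j refl refl)
  model (grow t e∈ j x∉ j₁ j₂) = inj₂ (grown-model t e∈ j x∉ j₁ j₂)
  model (perm p q t) with model t
  ... | inj₁ (is-edge j p′ q′) = inj₁ (is-edge j (↭-trans p′ p) (↭-trans q′ q))
  ... | inj₂ m = inj₂ (Model-perm p q m)

  grown-model {x = x} {e₁ = e₁} {e₂} t e∈ j x∉ j₁ j₂ with model t
  ... | inj₂ m = attach-model m e∈ j (proj₁ (Tree-ends t e∈ j)) (proj₂ (Tree-ends t e∈ j)) x∉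
                   (fresh t x∉ j₁) (fresh t x∉ j₂) j₁ j₂
  ... | inj₁ (is-edge k p q) with Perm.∈-resp-↭ (↭-sym q) e∈
  ...   | here refl with J-unique j k
  ...     | inj₁ (refl , refl) = Model-perm (prep x p) (prep e₁ (prep e₂ q)) (triangle-model j₁ j₂ k)
  ...     | inj₂ (refl , refl) = Model-perm (prep x p) (↭-trans (swap e₂ e₁ refl) (prep e₁ (prep e₂ q)))
                                   (triangle-model j₂ j₁ k)

  End-model : ∀ {v w c us vs es} → End v w c us vs es → Model vs es
  End-model (base t e∈ j v∉ j₁ j₂) = grown-model t e∈ j v∉ j₁ j₂
  End-model (leaf end u∉ j₁ j₂ side) with End-edge end side
  ... | e , e∈ , j = grown-model (End⇒Tree end) e∈ j u∉ j₁ j₂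

  Model-spans : ∀ {D vs es} (ι : D ↪ G) → Model vs es → (∀ {x} → x ∈ vs → ∃[ d ] onV ι d ≡ x) →
    (∀ {e} → e ∈ es → ∃[ f ] onE ι f ≡ e) → (∀ d → onV ι d ∈ vs) → HasSpanningTriangleTree D
  Model-spans ι m liftV liftE within = T , tree , κ , surjective⇒⊤ κ surj
    where
    open Model m
    κ = factor τ ι (λ y → liftV (intoV y)) (λ f → liftE (intoE f))
    surj : ∀ d → ∃[ y ] onV κ y ≡ d
    surj d = let y , eq = ontoV (within d) in y , onV-inj ι (trans (proj₂ (liftV (intoV y))) eq)

TriangleTree⇒Tree : ∀ {T G} → TriangleTree T → (ι : T ↪ G) → Trees.Tree G (tabulate (onV ι)) (tabulate (onE ι))
-- Vertex 0 of `K₃` is attached to edge 2, which joins the vertices 1 and 2.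
TriangleTree⇒Tree {G = G} triangle ι = grow (edge (onE-joins ι 2F)) (here refl) (onE-joins ι 2F)
    (λ { (here eq) → contradiction (onV-inj ι eq) λ () ; (there (here eq)) → contradiction (onV-inj ι eq) λ () })
    (onE-joins ι 0F) (onE-joins ι 1F)
  where open Trees G
TriangleTree⇒Tree {G = G} (grow T (e , j)) ι =
  Trees.grow (TriangleTree⇒Tree T κ) (∈-tabulate⁺ e) (Joins-↪⁺ κ j)
    (λ x∈ → let y , eq = ∈-tabulate⁻ x∈ in contradiction (onV-inj ι eq) λ ())
    (onE-joins ι 0F) (onE-joins ι 1F)
  where
  κ : _ ↪ G
  κ = record
    { onV = onV ι ∘ suc ; onE = λ f → onE ι (suc (suc f))
    ; onV-inj = suc-injective ∘ onV-inj ι ; onE-inj = suc-injective ∘ suc-injective ∘ onE-inj ι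
    ; onE-joins = λ f → onE-joins ι (suc (suc f)) }

HasSpanning-⊤ : ∀ {H G} (ι : H ↪ G) → V⟨ ι ⟩ ≡ ⊤ → HasSpanningTriangleTree H → HasSpanningTriangleTree G
HasSpanning-⊤ ι V (T , tree , τ , W) = T , tree , ι ∘↪ τ , surjective⇒⊤ (ι ∘↪ τ) λ x →
  let h , eq = ∈-V⁻ ι (≡⊤⇒∈ V x) ; y , eq′ = ∈-V⁻ τ (≡⊤⇒∈ W h) in y , trans (cong (onV ι) eq′) eq

-- Cardinality of subsets

∣p-x∣ : ∀ {n} {p : Subset n} {x} → x ∈ˢ p → suc ∣ p -ˢ x ∣ ≡ ∣ p ∣
∣p-x∣ {p = inside Vec.∷ p}  Vec.here       = cong (suc ∘ ∣_∣) (p─⊥≡p p)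
∣p-x∣ {p = inside Vec.∷ p}  (Vec.there x∈) = cong suc (∣p-x∣ x∈)
∣p-x∣ {p = outside Vec.∷ p} (Vec.there x∈) = ∣p-x∣ x∈

x∉p-x : ∀ {n} {p : Subset n} {x} → x ∉ˢ p -ˢ x
x∉p-x {p = _ Vec.∷ _}       {zero}  ()
x∉p-x {p = _ Vec.∷ _} {suc x} (Vec.there x∈) = x∉p-x x∈

unique⇒length≤ : ∀ {n} {p : Subset n} {xs} → Unique xs → (∀ {x} → x ∈ xs → x ∈ˢ p) → length xs ℕ.≤ ∣ p ∣
unique⇒length≤ [] _ = ℕ.z≤n
unique⇒length≤ {p = p} {x ∷ xs} (a ∷ u) xs⊆ = subst (suc (length xs) ℕ.≤_) (∣p-x∣ (xs⊆ (here refl)))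
  (ℕ.s≤s (unique⇒length≤ {p = p -ˢ x} u λ y∈ → x∈p∧x≢y⇒x∈p-y (xs⊆ (there y∈)) (λ { refl → All.lookup a y∈ refl })))

unique⇒∣∣≡length : ∀ {n} {p : Subset n} {xs} → Unique xs → (∀ {x} → x ∈ xs → x ∈ˢ p) →
                   (∀ {x} → x ∈ˢ p → x ∈ xs) → ∣ p ∣ ≡ length xs
unique⇒∣∣≡length {n} {p} [] _ p⊆ =
  trans (cong ∣_∣ (Empty-unique {p = p} λ { (_ , x∈) → contradiction (p⊆ x∈) λ () })) (∣⊥∣≡0 n)
unique⇒∣∣≡length {p = p} {x ∷ xs} (a ∷ u) xs⊆ p⊆ = trans (sym (∣p-x∣ (xs⊆ (here refl)))) (cong suc
  (unique⇒∣∣≡length u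
    (λ y∈ → x∈p∧x≢y⇒x∈p-y (xs⊆ (there y∈)) (λ { refl → All.lookup a y∈ refl }))
    (λ {y} y∈ → drop y∈ (p⊆ (p─q⊆p p ⁅ x ⁆ y∈)))))
  where
  drop : ∀ {y} → y ∈ˢ p -ˢ x → y ∈ x ∷ xs → y ∈ xs
  drop y∈ (here refl) = ⊥-elim (x∉p-x y∈)
  drop y∈ (there y∈′) = y∈′

-- Incident edges.

module Incidence (G : Graph) where

  open Trees G

  Incident : Edge G → Vertex G → Set
  Incident e x = src G e ≡ x ⊎ tgt G e ≡ x

  ∈-incident⁺ : ∀ {e x} → Incident e x → e ∈ˢ Graph.incident G x
  ∈-incident⁺ {e} {x} = ∈-comprehension⁺ (λ e → (src G e ≟ x) ⊎-dec (tgt G e ≟ x))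

  ∈-incident⁻ : ∀ {e x} → e ∈ˢ Graph.incident G x → Incident e x
  ∈-incident⁻ {e} {x} = ∈-comprehension⁻ (λ e → (src G e ≟ x) ⊎-dec (tgt G e ≟ x))

  J⇒incident : ∀ {e x y} → Joins G e x y → Incident e x
  J⇒incident (inj₁ (eq , _)) = inj₁ eq
  J⇒incident (inj₂ (_ , eq)) = inj₂ eq

  incident⇒J : ∀ {e x} → Incident e x → ∃[ y ] Joins G e x y
  incident⇒J {e} (inj₁ eq) = tgt G e , inj₁ (eq , refl)
  incident⇒J {e} (inj₂ eq) = src G e , inj₂ (refl , eq)

  J-differ : ∀ {e f x y s t} → Joins G e x y → Joins G f s t → s ≢ x → s ≢ y → e ≢ f
  J-differ j k s≢x s≢y refl with J-unique j k
  ... | inj₁ (eq , _) = s≢x eq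
  ... | inj₂ (eq , _) = s≢y eq

  J-fork : ∀ {e f x y z} → Joins G e x y → Joins G f x z → y ≢ z → e ≢ f
  J-fork j k y≢z refl = y≢z (J-other k j)
-- Deleting a vertex of degree two

-- Only two entering edges have outflow -2 = 1. Any other orientation leaves at `x` a nonzero value
-- that no later edge can change.
force-1 : ∀ {n} {A : Fin n → Set} {x y z es β} → A x → Avoids x es → y ≢ x → z ≢ x → β x ≡ 1F →
          R A ((x , y) ∷ (x , z) ∷ es) β → R A es (λ v → β v ⊞ δ (x , y) v ⊞ δ (x , z) v)
force-1 a av y≢ z≢ βx (bwd (bwd r)) = r
force-1 {x = x} {y} {z} a av y≢ z≢ βx (fwd (fwd r)) =
  contradiction (trans (sym (cong₂ _⊟_ (cong₂ _⊟_ βx (δ-fst y≢)) (δ-fst z≢))) (R⇒≡0 a av r)) λ ()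
force-1 {x = x} {y} {z} a av y≢ z≢ βx (fwd (bwd r)) =
  contradiction (trans (sym (cong₂ _⊞_ (cong₂ _⊟_ βx (δ-fst y≢)) (δ-fst z≢))) (R⇒≡0 a av r)) λ ()
force-1 {x = x} {y} {z} a av y≢ z≢ βx (bwd (fwd r)) =
  contradiction (trans (sym (cong₂ _⊟_ (cong₂ _⊞_ βx (δ-fst y≢)) (δ-fst z≢))) (R⇒≡0 a av r)) λ ()

force-2 : ∀ {n} {A : Fin n → Set} {x y z es β} → A x → Avoids x es → y ≢ x → z ≢ x → β x ≡ 2F →
          R A ((x , y) ∷ (x , z) ∷ es) β → R A es (λ v → β v ⊟ δ (x , y) v ⊟ δ (x , z) v)
force-2 a av y≢ z≢ βx (fwd (fwd r)) = r
force-2 {x = x} {y} {z} a av y≢ z≢ βx (bwd (bwd r)) =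
  contradiction (trans (sym (cong₂ _⊞_ (cong₂ _⊞_ βx (δ-fst y≢)) (δ-fst z≢))) (R⇒≡0 a av r)) λ ()
force-2 {x = x} {y} {z} a av y≢ z≢ βx (fwd (bwd r)) =
  contradiction (trans (sym (cong₂ _⊞_ (cong₂ _⊟_ βx (δ-fst y≢)) (δ-fst z≢))) (R⇒≡0 a av r)) λ ()
force-2 {x = x} {y} {z} a av y≢ z≢ βx (bwd (fwd r)) =
  contradiction (trans (sym (cong₂ _⊟_ (cong₂ _⊞_ βx (δ-fst y≢)) (δ-fst z≢))) (R⇒≡0 a av r)) λ ()

-- Of the outflows ±1 and ±3 of three edges only ±3 vanish modulo 3.
R-star⁻ : ∀ {n} {A : Fin n → Set} {u p q a es β} → A u → Avoids u es → p ≢ u → q ≢ u → a ≢ u → β u ≡ 0F →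
          R A ((u , p) ∷ (u , q) ∷ (u , a) ∷ es) β →
          R A es (λ x → β x ⊞ star p q a x) ⊎ R A es (λ x → β x ⊟ star p q a x)
R-star⁻ {A = A} {u} {p} {q} {a} {es} {β} Au av p≢ q≢ a≢ βu = go
  where
  δp = δ-fst p≢
  δq = δ-fst q≢
  δa = δ-fst a≢
  no-way : ∀ {γ z} → γ u ≡ z → z ≢ 0F → R A es γ → ⊥
  no-way eq z≢ r = z≢ (trans (sym eq) (R⇒≡0 Au av r))
  go : R A ((u , p) ∷ (u , q) ∷ (u , a) ∷ es) β → _
  go (fwd (fwd (fwd r))) = inj₁ (R-ext
    (λ x → sym (source (β x) (single u 1F x) (single p 1F x) (single q 1F x) (single a 1F x))) r)
  go (bwd (bwd (bwd r))) = inj₂ (R-ext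
    (λ x → sym (sink (β x) (single u 1F x) (single p 1F x) (single q 1F x) (single a 1F x))) r)
  go (fwd (fwd (bwd r))) = ⊥-elim (no-way (cong₂ _⊞_ (cong₂ _⊟_ (cong₂ _⊟_ βu δp) δq) δa) (λ ()) r)
  go (fwd (bwd (fwd r))) = ⊥-elim (no-way (cong₂ _⊟_ (cong₂ _⊞_ (cong₂ _⊟_ βu δp) δq) δa) (λ ()) r)
  go (fwd (bwd (bwd r))) = ⊥-elim (no-way (cong₂ _⊞_ (cong₂ _⊞_ (cong₂ _⊟_ βu δp) δq) δa) (λ ()) r)
  go (bwd (fwd (fwd r))) = ⊥-elim (no-way (cong₂ _⊟_ (cong₂ _⊟_ (cong₂ _⊞_ βu δp) δq) δa) (λ ()) r)
  go (bwd (fwd (bwd r))) = ⊥-elim (no-way (cong₂ _⊞_ (cong₂ _⊟_ (cong₂ _⊞_ βu δp) δq) δa) (λ ()) r)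
  go (bwd (bwd (fwd r))) = ⊥-elim (no-way (cong₂ _⊟_ (cong₂ _⊞_ (cong₂ _⊞_ βu δp) δq) δa) (λ ()) r)

image-avoids : ∀ {H G} (ι : H ↪ G) {x} → (∀ h → onV ι h ≢ x) → Avoids x (map (ends G) (image ι))
image-avoids {H} {G} ι {x} x∉ = All.map⁺ (All.map⁺ (All.tabulate λ {f} _ → go f))
  where
  go : ∀ f → src G (onE ι f) ≢ x × tgt G (onE ι f) ≢ x
  go f with onE-joins ι f
  ... | inj₁ (p , q) = (λ eq → x∉ _ (trans (sym p) eq)) , (λ eq → x∉ _ (trans (sym q) eq))
  ... | inj₂ (p , q) = (λ eq → x∉ _ (trans (sym p) eq)) , (λ eq → x∉ _ (trans (sym q) eq))

outside-image : ∀ {H G} (ι : H ↪ G) {e x y} → (∀ h → onV ι h ≢ x) → Joins G e x y → e ∉ image ι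
outside-image {H} {G} ι x∉ j e∈ with ∈-image⁻ ι e∈
... | f , refl with Trees.J-unique G (onE-joins ι f) j
...   | inj₁ (eq , _) = x∉ _ (sym eq)
...   | inj₂ (eq , _) = x∉ _ (sym eq)

module Ear {G G₁ : Graph} (ι : G₁ ↪ G) {x e₁ e₂} (x∉ : ∀ h → onV ι h ≢ x) (y z : Vertex G₁)
           (y≢z : y ≢ z) (j₁ : Joins G e₁ x (onV ι y)) (j₂ : Joins G e₂ x (onV ι z)) where

  open Incidence G

  ear-unique : Unique (e₁ ∷ e₂ ∷ image ι)
  ear-unique = (J-fork j₁ j₂ (y≢z ∘ onV-inj ι) ∷ All.¬Any⇒All¬ _ (outside-image ι x∉ j₁)) ∷
               All.¬Any⇒All¬ _ (outside-image ι x∉ j₂) ∷ image-unique ι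

  -- Giving x the value 1 forces both its edges to be directed towards x.
  ear-connected⁻ : (∀ e → e ∈ e₁ ∷ e₂ ∷ image ι) → Z₃-Connected G → Z₃-Connected G₁
  ear-connected⁻ all conn = R⇒connected G₁ λ β → y ,
      R-mono (λ h h≢y → h≢y ∘ onV-inj ι) (R-ext (eq β) (R-↪⁻ ι
        (force-1 (x∉ y ∘ sym) (image-avoids ι x∉) (x∉ y) (x∉ z) (βx β)
          (R-∷ (R-join⁻ {G = G} j₂) (R-join⁻ {G = G} j₁ (R-↭ (Perm.map⁺ (ends G) edges)
            (connected⇒Full G conn (onV ι y) (β′ β))))))))
    where
    Y = single (onV ι y) 1F
    Z = single (onV ι z) 1F
    β′ : (Vertex G₁ → Z₃) → Vertex G → Z₃
    -- The two arcs into `x` produce the outflow 1 at each of its neighbours; this is added in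
    -- advance, so that exactly `β` remains for `G₁`.
    β′ β v = extend ι 1F β v ⊞ Y v ⊞ Z v
    βx : ∀ β → β′ β x ≡ 1F
    βx β = cong₂ _⊞_ (cong₂ _⊞_ (extend-outside ι 1F β x∉) (single-≢ 1F (x∉ y))) (single-≢ 1F (x∉ z))
    edges : allFin (size G) ↭ e₁ ∷ e₂ ∷ image ι
    edges = set⇒↭ (Unique.allFin⁺ (size G)) ear-unique (λ _ → all _) (λ _ → ∈-allFin _)
    cancel : ∀ b s t → b ⊞ s ⊞ t ⊞ (0F ⊟ s) ⊞ (0F ⊟ t) ≡ b
    cancel = from-yes (all? λ b → all? λ s → all? λ t → (b ⊞ s ⊞ t ⊞ (0F ⊟ s) ⊞ (0F ⊟ t)) ≟ b)
    eq : ∀ β h → β′ β (onV ι h) ⊞ δ (x , onV ι y) (onV ι h) ⊞ δ (x , onV ι z) (onV ι h) ≡ β h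
    eq β h = trans (cong₂ (λ b X → b ⊞ Y (onV ι h) ⊞ Z (onV ι h) ⊞ (X ⊟ Y (onV ι h)) ⊞ (X ⊟ Z (onV ι h)))
      (extend-onV ι 1F β h) (single-≢ 1F (x∉ h ∘ sym))) (cancel (β h) (Y (onV ι h)) (Z (onV ι h)))

  -- The two edges at `x` meet whatever `x` demands, and `G₁` absorbs their effect on the
  -- neighbours.
  ear-connected⁺ : (∀ {v} → v ≢ x → ∃[ h ] onV ι h ≡ v) → Z₃-Connected G₁ → Z₃-Connected G
  ear-connected⁺ covered conn = unique-R⇒connected G ear-unique λ β → onV ι y ,
      R-join⁺ {G = G} j₁ (R-∷ (R-join⁺ {G = G} j₂)
        (Full-peel old (image-avoids ι x∉) (x∉ y) (x∉ z)
          (λ γ → R-↪⁺ ι (connected⇒Full G₁ conn y (γ ∘ onV ι))) β))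
    where
    old : ∀ v → v ≢ onV ι y → v ≡ x ⊎ ∃[ h ] (onV ι h ≡ v × h ≢ y)
    old v v≢y with v ≟ x
    ... | yes eq = inj₁ eq
    ... | no v≢x = let h , eq = covered v≢x in inj₂ (h , eq , λ { refl → v≢y (sym eq) })

-- An overlap of two vertices leaves a corner of the triangle outside `G₁`. The common edge cannot
-- touch this corner, so it is the opposite side, and the corner with its two edges is an ear on it.
⊕₂-connected⁻ : ∀ {G G₁} → G ≡ K₃ ⊕₂ G₁ → Z₃-Connected G → Z₃-Connected G₁
⊕₂-connected⁻ {G} {G₁} sum conn = go some-outside some-common
  where
  open _≡_⊕₂_ sum
  open Incidence G
  InB : Vertex K₃ → Set
  InB i = onV ιA i ∈ˢ V⟨ ιB ⟩
  some-outside : ∃[ i ] ¬ InB i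
  some-outside with all? (λ i → onV ιA i ∈ˢ? V⟨ ιB ⟩)
  ... | no ¬all = ¬∀⟶∃¬ 3 InB (λ i → onV ιA i ∈ˢ? V⟨ ιB ⟩) ¬all
  ... | yes all = contradiction
      (subst (3 ℕ.≤_) V-overlap (unique⇒length≤ (Unique.map⁺ (onV-inj ιA) (Unique.allFin⁺ 3)) inside-both)) λ { (ℕ.s≤s (ℕ.s≤s ())) }
    where
    inside-both : ∀ {x} → x ∈ map (onV ιA) (allFin 3) → x ∈ˢ V⟨ ιA ⟩ ∩ V⟨ ιB ⟩
    inside-both x∈ with ∈-map⁻ (onV ιA) x∈
    ... | i , _ , refl = x∈p∩q⁺ (∈-V⁺ ιA i , all i)
  some-common : ∃[ f ] onE ιA f ∈ image ιB
  some-common with nonempty? (E⟨ ιA ⟩ ∩ E⟨ ιB ⟩)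
  ... | no empty = contradiction
    (trans (sym E-overlap) (trans (cong ∣_∣ (Empty-unique empty)) (∣⊥∣≡0 (size G)))) λ ()
  ... | yes (e , e∈) with ∈-E⁻ ιA (proj₁ (x∈p∩q⁻ _ _ e∈)) | ∈-E⁻ ιB (proj₂ (x∈p∩q⁻ _ _ e∈))
  ...   | f , refl | f′ , eq = f , subst (_∈ image ιB) eq (∈-image⁺ ιB f′)
  not-in : ∀ {i} → ¬ InB i → ∀ h → onV ιB h ≢ onV ιA i
  not-in ∉B h eq = ∉B (subst (_∈ˢ V⟨ ιB ⟩) eq (∈-V⁺ ιB h))
  finish : ∀ x y z e₁ e₂ f → Joins K₃ e₁ x y → Joins K₃ e₂ x z → Joins K₃ f y z →
           (∀ e → e ≡ e₁ ⊎ e ≡ e₂ ⊎ e ≡ f) → ¬ InB x → onE ιA f ∈ image ιB → Z₃-Connected G₁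
  finish x y z e₁ e₂ f j₁ j₂ k all x∉ f∈ with ∈-image⁻ ιB f∈
  ... | f′ , eq = ear (Trees.J-unique G (Joins-↪⁺ ιA k) (subst (λ e → Joins G e _ _) eq (onE-joins ιB f′)))
    where
    covered : ∀ e → e ∈ onE ιA e₁ ∷ onE ιA e₂ ∷ image ιB
    covered e with x∈p∪q⁻ E⟨ ιA ⟩ E⟨ ιB ⟩ (≡⊤⇒∈ E-cover e)
    ... | inj₂ e∈ = let g , eq = ∈-E⁻ ιB e∈ in there (there (subst (_∈ image ιB) eq (∈-image⁺ ιB g)))
    ... | inj₁ e∈ with ∈-E⁻ ιA e∈
    ...   | g , refl with all g
    ...     | inj₁ refl = here refl
    ...     | inj₂ (inj₁ refl) = there (here refl)
    ...     | inj₂ (inj₂ refl) = there (there f∈)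
    s = src G₁ f′
    t = tgt G₁ f′
    ear : (onV ιB s ≡ onV ιA y × onV ιB t ≡ onV ιA z) ⊎ (onV ιB s ≡ onV ιA z × onV ιB t ≡ onV ιA y) →
          Z₃-Connected G₁
    ear (inj₁ (p , q)) = Ear.ear-connected⁻ ιB (not-in x∉) s t (loopless G₁ f′)
      (subst (Joins G _ _) (sym p) (Joins-↪⁺ ιA j₁)) (subst (Joins G _ _) (sym q) (Joins-↪⁺ ιA j₂)) covered conn
    ear (inj₂ (p , q)) = Ear.ear-connected⁻ ιB (not-in x∉) t s (loopless G₁ f′ ∘ sym)
      (subst (Joins G _ _) (sym q) (Joins-↪⁺ ιA j₁)) (subst (Joins G _ _) (sym p) (Joins-↪⁺ ιA j₂)) covered conn
  go : ∃[ i ] ¬ InB i → ∃[ f ] onE ιA f ∈ image ιB → Z₃-Connected G₁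
  meets : ∀ {e i k} → Joins K₃ e i k → ¬ InB i → onE ιA e ∉ image ιB
  meets j ∉B = outside-image ιB (not-in ∉B) (Joins-↪⁺ ιA j)
  go (0F , ∉B) (0F , f∈) = ⊥-elim (meets (inj₁ (refl , refl)) ∉B f∈)
  go (0F , ∉B) (1F , f∈) = ⊥-elim (meets (inj₁ (refl , refl)) ∉B f∈)
  go (0F , ∉B) (2F , f∈) = finish 0F 1F 2F 0F 1F 2F (inj₁ (refl , refl)) (inj₁ (refl , refl)) (inj₁ (refl , refl))
    (λ { 0F → inj₁ refl ; 1F → inj₂ (inj₁ refl) ; 2F → inj₂ (inj₂ refl) }) ∉B f∈
  go (1F , ∉B) (0F , f∈) = ⊥-elim (meets (inj₂ (refl , refl)) ∉B f∈)
  go (1F , ∉B) (1F , f∈) = finish 1F 0F 2F 0F 2F 1F (inj₂ (refl , refl)) (inj₁ (refl , refl)) (inj₁ (refl , refl))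
    (λ { 0F → inj₁ refl ; 1F → inj₂ (inj₂ refl) ; 2F → inj₂ (inj₁ refl) }) ∉B f∈
  go (1F , ∉B) (2F , f∈) = ⊥-elim (meets (inj₁ (refl , refl)) ∉B f∈)
  go (2F , ∉B) (0F , f∈) = finish 2F 0F 1F 1F 2F 0F (inj₂ (refl , refl)) (inj₂ (refl , refl)) (inj₁ (refl , refl))
    (λ { 0F → inj₂ (inj₂ refl) ; 1F → inj₁ refl ; 2F → inj₂ (inj₁ refl) }) ∉B f∈
  go (2F , ∉B) (1F , f∈) = ⊥-elim (meets (inj₂ (refl , refl)) ∉B f∈)
  go (2F , ∉B) (2F , f∈) = ⊥-elim (meets (inj₂ (refl , refl)) ∉B f∈)

≅K₃⇒¬connected : ∀ {G} → G ≅ K₃ → ¬ Z₃-Connected G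
≅K₃⇒¬connected iso@(ι , V , _) conn = ¬connected-K₃ (≅-connected⁺ iso (proj₁ (∈-V⁻ ι (≡⊤⇒∈ V 0F))) conn)

≅K₄⇒¬connected : ∀ {G} → G ≅ K₄ → ¬ Z₃-Connected G
≅K₄⇒¬connected iso@(ι , V , _) conn = ¬connected-K₄ (≅-connected⁺ iso (proj₁ (∈-V⁻ ι (≡⊤⇒∈ V 0F))) conn)

-- Bull-reductions

module Bull {G G′ : Graph} (ι : G′ ↪ G) {u v w : Vertex G} {a b : Vertex G′} {e₁ e₂ e₃ e₄ e₅}
  (j₁ : Joins G e₁ u v) (j₂ : Joins G e₂ u w) (j₃ : Joins G e₃ u (onV ι a))
  (j₄ : Joins G e₄ v w) (j₅ : Joins G e₅ v (onV ι b))
  (u∉ : ∀ h → onV ι h ≢ u) (v∉ : ∀ h → onV ι h ≢ v) (a≢w : onV ι a ≢ w) (b≢w : onV ι b ≢ w) where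

  open Trees G
  open Incidence G

  bull-edges : List (Edge G)
  bull-edges = e₁ ∷ e₂ ∷ e₃ ∷ e₄ ∷ e₅ ∷ image ι

  private
    v≢u = J-≢ j₁ ∘ sym
    w≢u = J-≢ j₂ ∘ sym
    w≢v = J-≢ j₄ ∘ sym

  bull-unique : Unique bull-edges
  bull-unique =
    (J-fork j₁ j₂ (J-≢ j₄) ∷ J-fork j₁ j₃ (v∉ a ∘ sym) ∷ J-fork (J-sym j₁) j₄ (w≢u ∘ sym) ∷
      J-fork (J-sym j₁) j₅ (u∉ b ∘ sym) ∷ apart u∉ j₁) ∷
    (J-fork j₂ j₃ (a≢w ∘ sym) ∷ J-differ j₂ j₄ v≢u (w≢v ∘ sym) ∷ J-differ j₂ j₅ v≢u (w≢v ∘ sym) ∷ apart u∉ j₂) ∷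
    (J-differ j₃ j₄ v≢u (v∉ a ∘ sym) ∷ J-differ j₃ j₅ v≢u (v∉ a ∘ sym) ∷ apart u∉ j₃) ∷
    (J-fork j₄ j₅ (b≢w ∘ sym) ∷ apart v∉ j₄) ∷ apart v∉ j₅ ∷ image-unique ι
    where
    apart : ∀ {e x y} → (∀ h → onV ι h ≢ x) → Joins G e x y → All (e ≢_) (image ι)
    apart x∉ j = All.¬Any⇒All¬ _ (outside-image ι x∉ j)

  R-bull⁺ : ∀ {A : Vertex G → Set} {β} →
    R A ((u , v) ∷ (u , w) ∷ (u , onV ι a) ∷ (v , w) ∷ (v , onV ι b) ∷ map (ends G) (image ι)) β →
    R A (map (ends G) bull-edges) β
  R-bull⁺ r = R-join⁺ {G = G} j₁ (R-∷ (λ r → R-join⁺ {G = G} j₂ (R-∷ (λ r → R-join⁺ {G = G} j₃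
    (R-∷ (λ r → R-join⁺ {G = G} j₄ (R-∷ (R-join⁺ {G = G} j₅) r)) r)) r)) r)

  R-bull⁻ : ∀ {A : Vertex G → Set} {β} → R A (map (ends G) bull-edges) β →
    R A ((u , v) ∷ (u , w) ∷ (u , onV ι a) ∷ (v , w) ∷ (v , onV ι b) ∷ map (ends G) (image ι)) β
  R-bull⁻ r = R-join⁻ {G = G} j₁ (R-∷ (λ r → R-join⁻ {G = G} j₂ (R-∷ (λ r → R-join⁻ {G = G} j₃
    (R-∷ (λ r → R-join⁻ {G = G} j₄ (R-∷ (R-join⁻ {G = G} j₅) r)) r)) r)) r)

  private
    -- Here `u` is a source and `v` a sink, and `c` stands for the third neighbour of `v`. The three
    -- terms `v` vanish modulo 3, the two terms `w` cancel, and what remains is an arc from that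
    -- neighbour to `a`.
    source-path : ∀ b v w a c → b ⊞ (v ⊞ w ⊞ a) ⊞ (v ⊟ w) ⊞ (v ⊟ c) ≡ b ⊞ (a ⊟ c)
    source-path = from-yes (all? λ b → all? λ v → all? λ w → all? λ a → all? λ c →
      (b ⊞ (v ⊞ w ⊞ a) ⊞ (v ⊟ w) ⊞ (v ⊟ c)) ≟ (b ⊞ (a ⊟ c)))
    sink-path : ∀ b v w a c → b ⊟ (v ⊞ w ⊞ a) ⊟ (v ⊟ w) ⊟ (v ⊟ c) ≡ b ⊟ (a ⊟ c)
    sink-path = from-yes (all? λ b → all? λ v → all? λ w → all? λ a → all? λ c →
      (b ⊟ (v ⊞ w ⊞ a) ⊟ (v ⊟ w) ⊟ (v ⊟ c)) ≟ (b ⊟ (a ⊟ c)))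
    star-v : star v w (onV ι a) v ≡ 1F
    star-v = Realization.star-at G w≢v (v∉ a)
    av-u : Avoids u ((v , w) ∷ (v , onV ι b) ∷ map (ends G) (image ι))
    av-u = (v≢u , w≢u) ∷ (v≢u , u∉ b) ∷ image-avoids ι u∉

  -- With the value 0 at u and v, one of u, v is a source and the other a sink, and the
  -- five edges at u and v act together as an edge between a and b.
  bull⇒edge : ∀ {A : Vertex G → Set} {β} → A u → A v → β u ≡ 0F → β v ≡ 0F →
    R A (map (ends G) bull-edges) β → R A ((onV ι a , onV ι b) ∷ map (ends G) (image ι)) β
  bull⇒edge {β = β} Au Av βu βv r with R-star⁻ Au av-u v≢u w≢u (u∉ a) βu (R-bull⁻ r)
  ... | inj₁ r′ = bwd (R-ext (λ x → source-path (β x) (single v 1F x) (single w 1F x)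
        (single (onV ι a) 1F x) (single (onV ι b) 1F x))
          (force-1 Av (image-avoids ι v∉) w≢v (v∉ b) (cong₂ _⊞_ βv star-v) r′))
  ... | inj₂ r′ = fwd (R-ext (λ x → sink-path (β x) (single v 1F x) (single w 1F x)
        (single (onV ι a) 1F x) (single (onV ι b) 1F x))
          (force-2 Av (image-avoids ι v∉) w≢v (v∉ b) (cong₂ _⊟_ βv star-v) r′))

  edge⇒bull : ∀ {A B C : Vertex G → Set} {β} → (∀ x → C x → x ≡ u ⊎ B x) → (∀ x → B x → x ≡ v ⊎ A x) →
    β u ≡ 0F → β v ≡ 0F →
    R A ((onV ι a , onV ι b) ∷ map (ends G) (image ι)) β → R C (map (ends G) bull-edges) β
  edge⇒bull {A} {β = β} C⊆ B⊆ βu βv r = R-bull⁺ (R-star C⊆ av-u v≢u w≢u (u∉ a) βu (go r))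
    where
    go : R A ((onV ι a , onV ι b) ∷ map (ends G) (image ι)) β → _
    go (bwd r) = inj₁ (bwd (bwd (R-extend B⊆ (image-avoids ι v∉)
      (cong₂ _⊞_ (cong₂ _⊞_ (cong₂ _⊞_ βv star-v) (δ-fst w≢v)) (δ-fst (v∉ b)))
      (R-ext (λ x → sym (source-path (β x) (single v 1F x) (single w 1F x)
            (single (onV ι a) 1F x) (single (onV ι b) 1F x))) r))))
    go (fwd r) = inj₂ (fwd (fwd (R-extend B⊆ (image-avoids ι v∉)
      (cong₂ _⊟_ (cong₂ _⊟_ (cong₂ _⊟_ βv star-v) (δ-fst w≢v)) (δ-fst (v∉ b)))
      (R-ext (λ x → sym (sink-path (β x) (single v 1F x) (single w 1F x)
            (single (onV ι a) 1F x) (single (onV ι b) 1F x))) r))))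

-- One more member would give a list without repetition that is longer than the size of `p`.
degree⇒∈ : ∀ {n} {p : Subset n} {xs} → Unique xs → (∀ {x} → x ∈ xs → x ∈ˢ p) → ∣ p ∣ ≡ length xs →
           ∀ {x} → x ∈ˢ p → x ∈ xs
degree⇒∈ {n} {p} {xs} u xs⊆ eq {x} x∈p with x ∈L? xs
  where open DecMembership (_≟_ {n}) renaming (_∈?_ to _∈L?_)
... | yes x∈ = x∈
... | no x∉  = contradiction (subst (suc (length xs) ℕ.≤_) eq
  (unique⇒length≤ (All.¬Any⇒All¬ _ x∉ ∷ u) λ { (here refl) → x∈p ; (there y∈) → xs⊆ y∈ })) (ℕ.<-irrefl refl)

bullReduction-connected : ∀ {H G} → H IsBullReductionOf G → Z₃-Connected G → Z₃-Connected H
bullReduction-connected {H} {G} bull conn =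
  ≅-connected⁻ H≅G′+ab vertex (R⇒addEdge G′ λ β → a′ ,
    R-mono (λ h h≢a → h≢a ∘ onV-inj ι) (R-ext (extend-onV ι 0F β)
      (R-map⁻ (onV-inj ι) {es = (a′ , b′) ∷ pairs G′} (R-∷ (R-image⁻ ι (allFin (size G′)))
        (bull⇒edge (u∉ a′ ∘ sym) (v∉ a′ ∘ sym) (extend-outside ι 0F β u∉) (extend-outside ι 0F β v∉)
          (R-↭ (Perm.map⁺ (ends G) edges) (connected⇒Full G conn (onV ι a′) (extend ι 0F β))))))))
  where
  open _IsBullReductionOf_ bull
  open Trees G
  open Incidence G
  e₁ = proj₁ u~v
  e₂ = proj₁ u~w
  e₃ = proj₁ u~a
  e₄ = proj₁ v~w
  e₅ = proj₁ v~b
  deleted : ∀ h → onV ι h ∉ˢ ⁅ u ⁆ ∪ ⁅ v ⁆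
  deleted h = x∈∁p⇒x∉p (subst (onV ι h ∈ˢ_) V-deleted (∈-V⁺ ι h))
  u∉ : ∀ h → onV ι h ≢ u
  u∉ h eq = deleted h (x∈p∪q⁺ (inj₁ (subst (_∈ˢ ⁅ u ⁆) (sym eq) (x∈⁅x⁆ u))))
  v∉ : ∀ h → onV ι h ≢ v
  v∉ h eq = deleted h (x∈p∪q⁺ (inj₂ (subst (_∈ˢ ⁅ v ⁆) (sym eq) (x∈⁅x⁆ v))))
  open Bull ι {u} {v} {w} {a′} {b′} (proj₂ u~v) (proj₂ u~w)
    (subst (Joins G e₃ u) (sym a′↦a) (proj₂ u~a)) (proj₂ v~w) (subst (Joins G e₅ v) (sym b′↦b) (proj₂ v~b))
    u∉ v∉ (a≢w ∘ trans (sym a′↦a)) (b≢w ∘ trans (sym b′↦b))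
  at-u : ∀ {e} → e ∈ˢ Graph.incident G u → e ∈ e₁ ∷ e₂ ∷ e₃ ∷ []
  at-u = degree⇒∈
    ((J-fork (proj₂ u~v) (proj₂ u~w) (J-≢ (proj₂ v~w)) ∷ J-fork (proj₂ u~v) (proj₂ u~a) (a≢v ∘ sym) ∷ []) ∷
     (J-fork (proj₂ u~w) (proj₂ u~a) (a≢w ∘ sym) ∷ []) ∷ [] ∷ [])
    (λ { (here refl) → ∈-incident⁺ (J⇒incident (proj₂ u~v))
       ; (there (here refl)) → ∈-incident⁺ (J⇒incident (proj₂ u~w))
       ; (there (there (here refl))) → ∈-incident⁺ (J⇒incident (proj₂ u~a)) }) deg-u
  at-v : ∀ {e} → e ∈ˢ Graph.incident G v → e ∈ e₁ ∷ e₄ ∷ e₅ ∷ []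
  at-v = degree⇒∈
    ((J-fork (J-sym (proj₂ u~v)) (proj₂ v~w) (J-≢ (proj₂ u~w)) ∷ J-fork (J-sym (proj₂ u~v)) (proj₂ v~b) (b≢u ∘ sym) ∷ []) ∷
     (J-fork (proj₂ v~w) (proj₂ v~b) (b≢w ∘ sym) ∷ []) ∷ [] ∷ [])
    (λ { (here refl) → ∈-incident⁺ (J⇒incident (J-sym (proj₂ u~v)))
       ; (there (here refl)) → ∈-incident⁺ (J⇒incident (proj₂ v~w))
       ; (there (there (here refl))) → ∈-incident⁺ (J⇒incident (proj₂ v~b)) }) deg-v
  covered : ∀ e → e ∈ bull-edges
  covered e with e ∈ˢ? E⟨ ι ⟩
  ... | yes e∈ = let f , eq = ∈-E⁻ ι e∈ in
    there (there (there (there (there (subst (_∈ image ι) eq (∈-image⁺ ι f))))))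
  ... | no e∉ with x∈p∪q⁻ _ _ (x∉∁p⇒x∈p (e∉ ∘ subst (e ∈ˢ_) (sym E-deleted)))
  ...   | inj₁ e∈u with at-u e∈u
  ...     | here refl = here refl
  ...     | there (here refl) = there (here refl)
  ...     | there (there (here refl)) = there (there (here refl))
  covered e | no e∉ | inj₂ e∈v with at-v e∈v
  ...     | here refl = here refl
  ...     | there (here refl) = there (there (there (here refl)))
  ...     | there (there (here refl)) = there (there (there (there (here refl))))
  edges : allFin (size G) ↭ bull-edges
  edges = set⇒↭ (Unique.allFin⁺ (size G)) bull-unique (λ _ → covered _) (λ _ → ∈-allFin _)
  vertex : Vertex H
  vertex = proj₁ (∈-V⁻ (proj₁ H≅G′+ab)
    (≡⊤⇒∈ (proj₁ (proj₂ H≅G′+ab)) (onV (proj₁ (addEdge-↪ G′ a′ b′)) a′)))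

-- Consequences of `G` not being ℤ₃-connected.

module Forward (G : Graph) (¬conn : ¬ Z₃-Connected G) where

  open Trees G
  open Ends G
  open Realization G
  open Models G
  open Incidence G

  open DecMembership (_≟_ {size G}) using () renaming (_∈?_ to _∈E?_)
  open DecMembership (_≟_ {order G}) using () renaming (_∈?_ to _∈V?_)

  private
    variable
      vs : List (Vertex G)
      es : List (Edge G)
      e f g e₁ e₂ : Edge G
      x y z u v w p q a d : Vertex G
      β : Vertex G → Z₃

  Ear-case Bull-case Conclusion : Set
  Ear-case   = ∃[ G₁ ] (G ≡ K₃ ⊕₂ G₁ × ¬ Z₃-Connected G₁ × HasSpanningTriangleTree G₁)
  Bull-case  = ∃[ H ] (G IsBullGrowingOf H × ¬ Z₃-Connected H × HasSpanningTriangleTree H)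
  Conclusion = (G ≅ K₃ ⊎ G ≅ K₄) ⊎ Ear-case ⊎ Bull-case

  Spans : List (Vertex G) → Set
  Spans vs = ∀ x → x ∈ vs

  off : ∀ {r} → Spans vs → R (Off r vs) (map (ends G) es) β → R (_≢ r) (map (ends G) es) β
  off spans = R-mono (λ x x≢r → spans x , x≢r)

  -- A parallel edge outside the tree would double a tree edge, and a spanning tree with a doubled
  -- edge already makes `G` ℤ₃-connected.
  no-parallel : Tree vs es → Spans vs → e ∈ es → Joins G e p q → Joins G g p q → g ∈ es
  no-parallel {vs} {es} {e} {g = g} t spans e∈ j k with g ∈E? es
  ... | yes g∈ = g∈
  ... | no g∉  = ⊥-elim (¬conn (unique-R⇒connected G (All.¬Any⇒All¬ _ g∉ ∷ Tree-unique t) λ β →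
    root t , off {es = g ∷ es} spans (R-join⁺ {G = G} k (R-join⁻ {G = G} j (proj₂ (Full-doubled t) e∈ β)))))

  OnlyAt : Vertex G → List (Edge G) → Set
  OnlyAt x es = ∀ {g} → Incident g x → g ∈ es

  unaffected : (∀ {g} → Incident g x → g ∈ es) → f ∉ es → ∀ z → z ⊟ δ (ends G f) x ≡ z
  unaffected only f∉ z = ⊟-avoid z (λ eq → f∉ (only (inj₁ eq))) (λ eq → f∉ (only (inj₂ eq)))

  record Third (u : Vertex G) (e₁ e₂ : Edge G) : Set where
    field
      {third} : Edge G
      {far}   : Vertex G
      joins   : Joins G third u far
      third∉  : third ∉ e₁ ∷ e₂ ∷ []
      only    : OnlyAt u (e₁ ∷ e₂ ∷ third ∷ [])

  module Leaf-of (t : Tree vs es) (e∈ : e ∈ es) (j : Joins G e p q) (u∉ : u ∉ vs)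
                 (j₁ : Joins G e₁ u p) (j₂ : Joins G e₂ u q) (spans : Spans (u ∷ vs)) where

    private
      p∈ = proj₁ (Tree-ends t e∈ j)
      q∈ = proj₂ (Tree-ends t e∈ j)
      p≢q = J-≢ j
      whole = grow t e∈ j u∉ j₁ j₂

    -- The summands are the triangle upq and the graph `G` without `u`, which share exactly the edge
    -- `e`: any parallel edge lies in the second summand only.
    ear-case : Model vs es → OnlyAt u (e₁ ∷ e₂ ∷ []) → Ear-case
    ear-case m only = induced , sum , ¬conn ∘ ear-connected⁺ (vertex⁺) ,
        Model-spans inclusion m (λ x∈ → vertex⁺ (∈∉⇒≢ x∈ u∉))
          (λ f∈ → edge⁺ (∈∉⇒≢ (proj₁ (Tree-ends t f∈ (inj₁ (refl , refl)))) u∉)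
                        (∈∉⇒≢ (proj₂ (Tree-ends t f∈ (inj₁ (refl , refl)))) u∉))
          (λ d → old (spans _) (vertex⁻ d))
      where
      open Induced G (λ x → ¬? (x ≟ u))
      old : ∀ {x} → x ∈ u ∷ vs → x ≢ u → x ∈ vs
      old (here eq) x≢ = ⊥-elim (x≢ eq)
      old (there x∈) _ = x∈
      p⁻ = vertex⁺ (∈∉⇒≢ p∈ u∉)
      q⁻ = vertex⁺ (∈∉⇒≢ q∈ u∉)
      open Ear inclusion vertex⁻ (proj₁ p⁻) (proj₁ q⁻)
        (λ eq → p≢q (trans (sym (proj₂ p⁻)) (trans (cong (onV inclusion) eq) (proj₂ q⁻))))
        (subst (Joins G _ u) (sym (proj₂ p⁻)) j₁) (subst (Joins G _ u) (sym (proj₂ q⁻)) j₂)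
      △ : K₃ ↪ G
      △ = triangle-↪ j₁ j₂ j
      keep : ∀ {f} → src G f ≢ u → tgt G f ≢ u → f ∈ˢ E⟨ inclusion ⟩
      keep s≢ t≢ = let f′ , eq = edge⁺ s≢ t≢ in subst (_∈ˢ E⟨ inclusion ⟩) eq (∈-E⁺ inclusion f′)
      kept-e : e ∈ˢ E⟨ inclusion ⟩
      kept-e = let s≢ , t≢ = J-avoids j (∈∉⇒≢ p∈ u∉) (∈∉⇒≢ q∈ u∉) in keep s≢ t≢
      lost : ∀ {f y} → Joins G f u y → f ∉ˢ E⟨ inclusion ⟩
      lost k f∈ with ∈-E⁻ inclusion f∈
      ... | f′ , refl with edge⁻ f′ | k
      ...   | s≢ , t≢ | inj₁ (eq , _) = s≢ eq
      ...   | s≢ , t≢ | inj₂ (_ , eq) = t≢ eq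
      keepV : ∀ {x} → x ≢ u → x ∈ˢ V⟨ inclusion ⟩
      keepV x≢ = let x′ , eq = vertex⁺ x≢ in subst (_∈ˢ V⟨ inclusion ⟩) eq (∈-V⁺ inclusion x′)
      coverV : ∀ x → x ∈ˢ V⟨ △ ⟩ ∪ V⟨ inclusion ⟩
      coverV x with x ≟ u
      ... | yes refl = x∈p∪q⁺ (inj₁ (∈-V⁺ △ 0F))
      ... | no x≢    = x∈p∪q⁺ (inj₂ (keepV x≢))
      coverE : ∀ f → f ∈ˢ E⟨ △ ⟩ ∪ E⟨ inclusion ⟩
      coverE f with src G f ≟ u | tgt G f ≟ u
      ... | no s≢ | no t≢ = x∈p∪q⁺ (inj₂ (keep s≢ t≢))
      ... | yes s≡ | _ with only (inj₁ s≡)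
      ...   | here refl = x∈p∪q⁺ (inj₁ (∈-E⁺ △ 0F))
      ...   | there (here refl) = x∈p∪q⁺ (inj₁ (∈-E⁺ △ 1F))
      coverE f | no _ | yes t≡ with only (inj₂ t≡)
      ...   | here refl = x∈p∪q⁺ (inj₁ (∈-E⁺ △ 0F))
      ...   | there (here refl) = x∈p∪q⁺ (inj₁ (∈-E⁺ △ 1F))
      commonV : ∀ {x} → x ∈ˢ V⟨ △ ⟩ ∩ V⟨ inclusion ⟩ → x ∈ p ∷ q ∷ []
      commonV x∈ with ∈-V⁻ △ (proj₁ (x∈p∩q⁻ _ _ x∈)) | ∈-V⁻ inclusion (proj₂ (x∈p∩q⁻ _ _ x∈))
      ... | 0F , refl | y , eq = ⊥-elim (vertex⁻ y eq)
      ... | 1F , refl | _ = here refl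
      ... | 2F , refl | _ = there (here refl)
      commonE : ∀ {f} → f ∈ˢ E⟨ △ ⟩ ∩ E⟨ inclusion ⟩ → f ∈ e ∷ []
      commonE f∈ with ∈-E⁻ △ (proj₁ (x∈p∩q⁻ _ _ f∈))
      ... | 0F , refl = ⊥-elim (lost j₁ (proj₂ (x∈p∩q⁻ _ _ f∈)))
      ... | 1F , refl = ⊥-elim (lost j₂ (proj₂ (x∈p∩q⁻ _ _ f∈)))
      ... | 2F , refl = here refl
      sum : G ≡ K₃ ⊕₂ induced
      sum = record
        { ιA = △ ; ιB = inclusion
        ; V-cover = all∈⇒≡⊤ coverV ; E-cover = all∈⇒≡⊤ coverE
        ; V-overlap = unique⇒∣∣≡length ((p≢q ∷ []) ∷ [] ∷ [])
            (λ { (here refl) → x∈p∩q⁺ (∈-V⁺ △ 1F , keepV (∈∉⇒≢ p∈ u∉))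
               ; (there (here refl)) → x∈p∩q⁺ (∈-V⁺ △ 2F , keepV (∈∉⇒≢ q∈ u∉)) }) commonV
        ; E-overlap = unique⇒∣∣≡length ([] ∷ [])
            (λ { (here refl) → x∈p∩q⁺ (∈-E⁺ △ 2F , kept-e) }) commonE }

    old-edge : ∀ {f y} → Joins G f u y → f ∉ e₁ ∷ e₂ ∷ [] → f ∉ e₁ ∷ e₂ ∷ es
    old-edge k f∉ (here eq)         = f∉ (here eq)
    old-edge k f∉ (there (here eq)) = f∉ (there (here eq))
    old-edge k f∉ (there (there f∈)) = fresh t u∉ k f∈

    ear-or-third : Model vs es → Ear-case ⊎ Third u e₁ e₂
    ear-or-third m with any? (λ f → ((src G f ≟ u) ⊎-dec (tgt G f ≟ u)) ×-dec ¬? (f ∈E? (e₁ ∷ e₂ ∷ [])))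
    ... | no none = inj₁ (ear-case m λ {g} inc → decidable-stable (g ∈E? (e₁ ∷ e₂ ∷ [])) λ g∉ → none (g , inc , g∉))
    ... | yes (f , incf , f∉) with any? (λ g → ((src G g ≟ u) ⊎-dec (tgt G g ≟ u)) ×-dec ¬? (g ∈E? (e₁ ∷ e₂ ∷ f ∷ [])))
    ...   | no none = inj₂ (record { joins = proj₂ (incident⇒J incf) ; third∉ = f∉
            ; only = λ {g} inc → decidable-stable (g ∈E? (e₁ ∷ e₂ ∷ f ∷ [])) λ g∉ → none (g , inc , g∉) })
    ...   | yes (g , incg , g∉) = ⊥-elim (¬conn (unique-R⇒connected G
            (((λ { refl → g∉ (there (there (here refl))) }) ∷ All.¬Any⇒All¬ _ (old-edge k f∉)) ∷
             All.¬Any⇒All¬ _ (old-edge l (g∉ ∘ λ { (here eq) → here eq ; (there (here eq)) → there (here eq) })) ∷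
             Tree-unique whole)
            λ β → root t , off {es = f ∷ g ∷ e₁ ∷ e₂ ∷ es} spans (Leaf.Full-degree-4 t e∈ j u∉ j₁ j₂ k l β)))
      where
      k = proj₂ (incident⇒J incf)
      l = proj₂ (incident⇒J incg)

    module _ (th : Third u e₁ e₂) where
      open Third th

      far≢p : far ≢ p
      far≢p refl = old-edge joins third∉ (no-parallel whole spans (here refl) j₁ joins)

      far≢q : far ≢ q
      far≢q refl = old-edge joins third∉ (no-parallel whole spans (there (here refl)) j₂ joins)

      -- All edges at `u` are `e₁`, `e₂` and `third`, so directing the edges outside the list
      -- arbitrarily keeps the value at `u` nonzero, as `R-nonzero` requires.
      nonzero-realizable : β u ≢ 0F → ∃[ r ] R (_≢ r) (pairs G) β
      nonzero-realizable = unique-R G (λ β → β u ≢ 0F)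
        (All.¬Any⇒All¬ _ (old-edge joins third∉) ∷ Tree-unique whole)
        (λ f∉ ne eq → ne (trans (sym (unaffected only (f∉ ∘ reorder) _)) eq))
        (λ ne → root t , off {es = third ∷ e₁ ∷ e₂ ∷ es} spans (Leaf.R-nonzero t e∈ j u∉ j₁ j₂ joins ne))
        where
        reorder : ∀ {f} → f ∈ e₁ ∷ e₂ ∷ third ∷ [] → f ∈ third ∷ e₁ ∷ e₂ ∷ es
        reorder (here eq) = there (here eq)
        reorder (there (here eq)) = there (there (here eq))
        reorder (there (there (here eq))) = here eq

  -- The last two hypotheses realize the boundaries that do not vanish at both `u` and `v`, and are
  -- proved differently in the two situations that produce a bull. For the remaining boundaries the
  -- bull is traded for the edge ab, so a ℤ₃-connected reduction would make `G` ℤ₃-connected.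
  bull-case : ∀ {u v w a b e₁ e₂ e₃ e₄ e₅} (j₁ : Joins G e₁ u v) (j₂ : Joins G e₂ u w) (j₃ : Joins G e₃ u a)
    (j₄ : Joins G e₄ v w) (j₅ : Joins G e₅ v b) → a ≢ v → a ≢ w → b ≢ u → b ≢ w →
    OnlyAt u (e₁ ∷ e₂ ∷ e₃ ∷ []) → OnlyAt v (e₁ ∷ e₄ ∷ e₅ ∷ []) →
    Tree vs es → Model vs es → u ∉ vs → v ∉ vs → (∀ x → x ≢ u → x ≢ v → x ∈ vs) →
    (∀ {β} → β u ≢ 0F → ∃[ r ] R (_≢ r) (pairs G) β) →
    (∀ {β} → β u ≡ 0F → β v ≢ 0F → ∃[ r ] R (_≢ r) (pairs G) β) → Bull-case
  bull-case {vs} {es} {u} {v} {w} {a} {b} {e₁} {e₂} {e₃} {e₄} {e₅} j₁ j₂ j₃ j₄ j₅ a≢v a≢w b≢u b≢w only-u only-v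
            t m u∉ v∉ others nonzero-u nonzero-v =
    addEdge induced a′ b′ , reduction , ¬conn ∘ connect ,
    HasSpanning-⊤ (proj₁ (addEdge-↪ induced a′ b′)) (proj₂ (addEdge-↪ induced a′ b′))
      (Model-spans inclusion m (λ x∈ → vertex⁺ (∈∉⇒≢ x∈ u∉ , ∈∉⇒≢ x∈ v∉))
        (λ f∈ → let s∈ , t∈ = Tree-ends t f∈ (inj₁ (refl , refl)) in
          edge⁺ (∈∉⇒≢ s∈ u∉ , ∈∉⇒≢ s∈ v∉) (∈∉⇒≢ t∈ u∉ , ∈∉⇒≢ t∈ v∉))
        (λ d → others _ (proj₁ (vertex⁻ d)) (proj₂ (vertex⁻ d))))
    where
    open Induced G (λ x → ¬? (x ≟ u) ×-dec ¬? (x ≟ v))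
    a⁻ = vertex⁺ (J-≢ j₃ ∘ sym , a≢v)
    b⁻ = vertex⁺ (b≢u , J-≢ j₅ ∘ sym)
    a′ = proj₁ a⁻
    b′ = proj₁ b⁻
    open Bull inclusion {a = a′} {b′} j₁ j₂ (subst (Joins G e₃ u) (sym (proj₂ a⁻)) j₃) j₄
      (subst (Joins G e₅ v) (sym (proj₂ b⁻)) j₅) (proj₁ ∘ vertex⁻) (proj₂ ∘ vertex⁻)
      (a≢w ∘ trans (sym (proj₂ a⁻))) (b≢w ∘ trans (sym (proj₂ b⁻)))
    covered : ∀ f → f ∈ bull-edges
    covered f with (src G f ≟ u) ⊎-dec (tgt G f ≟ u) | (src G f ≟ v) ⊎-dec (tgt G f ≟ v)
    ... | no ¬u | no ¬v = let f′ , eq = edge⁺ (¬u ∘ inj₁ , ¬v ∘ inj₁) (¬u ∘ inj₂ , ¬v ∘ inj₂) in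
      there (there (there (there (there (subst (_∈ image inclusion) eq (∈-image⁺ inclusion f′))))))
    ... | yes iu | _ with only-u iu
    ...   | here refl = here refl
    ...   | there (here refl) = there (here refl)
    ...   | there (there (here refl)) = there (there (here refl))
    covered f | no _ | yes iv with only-v iv
    ...   | here refl = here refl
    ...   | there (here refl) = there (there (there (here refl)))
    ...   | there (there (here refl)) = there (there (there (there (here refl))))
    edges : bull-edges ↭ allFin (size G)
    edges = set⇒↭ bull-unique (Unique.allFin⁺ (size G)) (λ _ → ∈-allFin _) (λ _ → covered _)
    connect : Z₃-Connected (addEdge induced a′ b′) → Z₃-Connected G
    connect conn = R⇒connected G realize
      where
      realize : ∀ β → ∃[ r ] R (_≢ r) (pairs G) β
      realize β with β u ≟ 0F | β v ≟ 0F
      ... | no βu | _      = nonzero-u βu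
      ... | yes βu | no βv = nonzero-v βu βv
      ... | yes βu | yes βv = onV inclusion a′ , R-↭ (Perm.map⁺ (ends G) edges)
        (edge⇒bull {B = λ x → x ≢ onV inclusion a′ × x ≢ u} split-u split-v βu βv
          (R-∷ (R-image⁺ inclusion (allFin (size induced)))
            (R-map⁺ (onV-inj inclusion) (addEdge⇒Full induced conn a′ (β ∘ onV inclusion)))))
        where
        split-u : ∀ x → x ≢ onV inclusion a′ → x ≡ u ⊎ (x ≢ onV inclusion a′ × x ≢ u)
        split-u x x≢ with x ≟ u
        ... | yes eq = inj₁ eq
        ... | no x≢u = inj₂ (x≢ , x≢u)
        split-v : ∀ x → x ≢ onV inclusion a′ × x ≢ u → x ≡ v ⊎ ∃[ h ] (onV inclusion h ≡ x × h ≢ a′)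
        split-v x (x≢ , x≢u) with x ≟ v
        ... | yes eq = inj₁ eq
        ... | no x≢v = let h , eq = vertex⁺ (x≢u , x≢v) in
          inj₂ (h , eq , λ h≡ → x≢ (trans (sym eq) (cong (onV inclusion) h≡)))
    incident-is : ∀ {x fs} → Unique fs → (∀ {f} → f ∈ fs → Incident f x) → OnlyAt x fs →
                  Graph.degree G x ≡ length fs
    incident-is uniq inc only = unique⇒∣∣≡length uniq (∈-incident⁺ ∘ inc) (only ∘ ∈-incident⁻)
    deleted⁺ : ∀ {x} → x ∈ˢ V⟨ inclusion ⟩ → x ∈ˢ ∁ (⁅ u ⁆ ∪ ⁅ v ⁆)
    deleted⁺ x∈ with ∈-V⁻ inclusion x∈
    ... | y , refl = x∉p⇒x∈∁p λ y∈ → [ proj₁ (vertex⁻ y) ∘ x∈⁅y⁆⇒x≡y u , proj₂ (vertex⁻ y) ∘ x∈⁅y⁆⇒x≡y v ]′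
                       (x∈p∪q⁻ ⁅ u ⁆ ⁅ v ⁆ y∈)
    deleted⁻ : ∀ {x} → x ∈ˢ ∁ (⁅ u ⁆ ∪ ⁅ v ⁆) → x ∈ˢ V⟨ inclusion ⟩
    deleted⁻ {x} x∈ = let y , eq = vertex⁺ ((λ { refl → x∈∁p⇒x∉p x∈ (x∈p∪q⁺ (inj₁ (x∈⁅x⁆ x))) })
                                           , (λ { refl → x∈∁p⇒x∉p x∈ (x∈p∪q⁺ (inj₂ (x∈⁅x⁆ x))) }))
      in subst (_∈ˢ V⟨ inclusion ⟩) eq (∈-V⁺ inclusion y)
    deletedE⁺ : ∀ {f} → f ∈ˢ E⟨ inclusion ⟩ → f ∈ˢ ∁ (Graph.incident G u ∪ Graph.incident G v)
    deletedE⁺ f∈ with ∈-E⁻ inclusion f∈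
    ... | f′ , refl with edge⁻ f′
    ...   | (s≢u , s≢v) , (t≢u , t≢v) = x∉p⇒x∈∁p λ f∈ →
            [ [ s≢u , t≢u ]′ ∘ ∈-incident⁻ , [ s≢v , t≢v ]′ ∘ ∈-incident⁻ ]′ (x∈p∪q⁻ _ _ f∈)
    deletedE⁻ : ∀ {f} → f ∈ˢ ∁ (Graph.incident G u ∪ Graph.incident G v) → f ∈ˢ E⟨ inclusion ⟩
    deletedE⁻ f∈ = let f′ , eq = edge⁺ (out-u ∘ inj₁ , out-v ∘ inj₁) (out-u ∘ inj₂ , out-v ∘ inj₂)
      in subst (_∈ˢ E⟨ inclusion ⟩) eq (∈-E⁺ inclusion f′)
      where
      out-u = λ i → x∈∁p⇒x∉p f∈ (x∈p∪q⁺ (inj₁ (∈-incident⁺ i)))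
      out-v = λ i → x∈∁p⇒x∉p f∈ (x∈p∪q⁺ (inj₂ (∈-incident⁺ i)))
    reduction : G IsBullGrowingOf addEdge induced a′ b′
    reduction = record
      { u = u ; v = v ; w = w ; a = a ; b = b
      ; u~v = e₁ , j₁ ; u~w = e₂ , j₂ ; v~w = e₄ , j₄
      ; deg-u = incident-is
          ((J-fork j₁ j₂ (J-≢ j₄) ∷ J-fork j₁ j₃ (a≢v ∘ sym) ∷ []) ∷ (J-fork j₂ j₃ (a≢w ∘ sym) ∷ []) ∷ [] ∷ [])
          (λ { (here refl) → J⇒incident j₁ ; (there (here refl)) → J⇒incident j₂
             ; (there (there (here refl))) → J⇒incident j₃ }) only-u
      ; deg-v = incident-is
          ((J-fork (J-sym j₁) j₄ (J-≢ j₂)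
                ∷ J-fork (J-sym j₁) j₅ (b≢u ∘ sym) ∷ []) ∷ (J-fork j₄ j₅ (b≢w ∘ sym) ∷ []) ∷ [] ∷ [])
          (λ { (here refl) → J⇒incident (J-sym j₁) ; (there (here refl)) → J⇒incident j₄
             ; (there (there (here refl))) → J⇒incident j₅ }) only-v
      ; u~a = e₃ , j₃ ; a≢v = a≢v ; a≢w = a≢w
      ; v~b = e₅ , j₅ ; b≢u = b≢u ; b≢w = b≢w
      ; G′ = induced ; ι = inclusion
      ; V-deleted = ⊆-antisym deleted⁺ deleted⁻
      ; E-deleted = ⊆-antisym deletedE⁺ deletedE⁻
      ; a′ = a′ ; b′ = b′ ; a′↦a = proj₂ a⁻ ; b′↦b = proj₂ b⁻
      ; H≅G′+ab = ≅-refl }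

-- One leaf or several leaves on the ending triangle.

module Cases (G : Graph) (¬conn : ¬ Z₃-Connected G) where

  open Trees G
  open Ends G
  open Realization G
  open Models G
  open Incidence G
  open Forward G ¬conn

  open DecMembership (_≟_ {size G}) using () renaming (_∈?_ to _∈E?_)
  open DecMembership (_≟_ {order G}) using () renaming (_∈?_ to _∈V?_)

  private
    variable
      vs us : List (Vertex G)
      es : List (Edge G)
      e f g e₁ e₂ : Edge G
      x y z u v w c p q a : Vertex G
      β : Vertex G → Z₃

  core∉tips : End v w c us vs es → u ∈ us → v ≢ u × (p ≡ w ⊎ p ≡ c → p ≢ u)
  core∉tips (leaf end u∉ _ _ _) (here refl) = ∈∉⇒≢ (hub∈ end) u∉ , λ p≡ → ∈∉⇒≢ (side∈ end p≡) u∉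
  core∉tips (leaf end _ _ _ _) (there u∈) = core∉tips end u∈

  side≢hub : End v w c us vs es → p ≡ w ⊎ p ≡ c → p ≢ v
  side≢hub end p≡ = let _ , _ , j = End-edge end p≡ in J-≢ j ∘ sym

  rotate-∈ : ∀ {A : Set} {x s t r : A} → x ∈ s ∷ t ∷ r ∷ [] → x ∈ r ∷ s ∷ t ∷ []
  rotate-∈ (here eq)                 = there (here eq)
  rotate-∈ (there (here eq))         = there (there (here eq))
  rotate-∈ (there (there (here eq))) = here eq

  -- The two leaves are the vertices of degree three, the hub is their common neighbour, and their
  -- feet, which may coincide, are the ends of the new edge. What remains after deleting both leaves
  -- is an `End`, hence a spanning triangle-tree of the reduction.
  adjacent-tips : (end : End v w c us vs es) → u ∉ vs → Joins G e₁ u v → Joins G e₂ u p → p ≡ w ⊎ p ≡ c →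
    Spans (u ∷ vs) → (th : Third u e₁ e₂) → Third.far th ∈ us → Ear-case ⊎ Bull-case
  adjacent-tips {v} {w} {c} {us} {vs} {es} {u} {l₁} {l₂} {p} end u∉ j₁ j₂ side spans th far∈ with pick end far∈
  ... | m , refl = go (End-edge M.end side) (End-edge M.end M.side)
    where
    module M = LastLeaf m
    open Third th
    u∉M : u ∉ M.tip ∷ M.old
    u∉M = u∉ ∘ Perm.∈-resp-↭ M.vs↭
    tip∉ : M.tip ∉ u ∷ M.old
    tip∉ (here refl) = u∉M (here refl)
    tip∉ (there t∈)  = M.tip∉ t∈
    spans₁ : Spans (u ∷ M.tip ∷ M.old)
    spans₁ x = Perm.∈-resp-↭ (prep u (↭-sym M.vs↭)) (spans x)
    spans₂ : Spans (M.tip ∷ u ∷ M.old)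
    spans₂ x = Perm.∈-resp-↭ (swap u M.tip refl) (spans₁ x)
    go : ∃[ e ] (e ∈ M.oldE × Joins G e v p) → ∃[ e ] (e ∈ M.oldE × Joins G e v M.foot) → Ear-case ⊎ Bull-case
    go (e , e∈ , j) (e′ , e′∈ , j′) = [ inj₁ , inj₂ ∘ finish ]′ (L′.ear-or-third model′)
      where
      t₁ = grow (End⇒Tree M.end) e′∈ j′ M.tip∉ M.j₁ M.j₂
      t₂ = grow (End⇒Tree M.end) e∈ j (u∉M ∘ there) j₁ j₂
      model′ = grown-model (End⇒Tree M.end) e∈ j (u∉M ∘ there) j₁ j₂
      module L = Leaf-of t₁ (there (there e∈)) j u∉M j₁ j₂ spans₁
      module L′ = Leaf-of t₂ (there (there e′∈)) j′ tip∉ M.j₁ M.j₂ spans₂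
      finish : Third M.tip M.l₁ M.l₂ → Bull-case
      finish th′ = bull-case joins j₁ j₂ M.j₁ M.j₂
        (∈∉⇒≢ (side∈ M.end side) M.tip∉) (side≢hub M.end side)
        (∈∉⇒≢ (side∈ M.end M.side) (u∉M ∘ there)) (side≢hub M.end M.side)
        (rotate-∈ ∘ only) (rotate-∈ ∘ only′)
        (End⇒Tree M.end) (End-model M.end) (u∉M ∘ there) M.tip∉ others
        (L.nonzero-realizable th) (λ _ → L′.nonzero-realizable th′)
        where
        -- The two tree edges of the other leaf go to the hub and to its foot, neither of which is
        -- `u`; so the edge between the leaves is the third edge of both.
        third-is : third ∈ M.l₁ ∷ M.l₂ ∷ Third.third th′ ∷ [] → third ≡ Third.third th′
        third-is (here refl) = ⊥-elim (∈∉⇒≢ (hub∈ M.end) (u∉M ∘ there) (J-other (J-sym joins) M.j₁))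
        third-is (there (here refl)) =
          ⊥-elim (∈∉⇒≢ (side∈ M.end M.side) (u∉M ∘ there) (J-other (J-sym joins) M.j₂))
        third-is (there (there (here eq))) = eq
        only′ : OnlyAt M.tip (M.l₁ ∷ M.l₂ ∷ third ∷ [])
        only′ inc = subst (λ f → _ ∈ M.l₁ ∷ M.l₂ ∷ f ∷ [])
          (sym (third-is (Third.only th′ (J⇒incident (J-sym joins))))) (Third.only th′ inc)
        others : ∀ x → x ≢ u → x ≢ M.tip → x ∈ M.old
        others x x≢u x≢t with spans₁ x
        ... | here eq = ⊥-elim (x≢u eq)
        ... | there (here eq) = ⊥-elim (x≢t eq)
        ... | there (there x∈) = x∈

  many-tips : ∀ {u₁ u₂ p₁ p₂ l₁ l₂ k₁ k₂} (end : End v w c us vs es) →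
    (u₂∉ : u₂ ∉ vs) (j₁ : Joins G k₁ u₂ v) (j₂ : Joins G k₂ u₂ p₂) (side₂ : p₂ ≡ w ⊎ p₂ ≡ c) →
    (u₁∉ : u₁ ∉ u₂ ∷ vs) (i₁ : Joins G l₁ u₁ v) (i₂ : Joins G l₂ u₁ p₁) (side₁ : p₁ ≡ w ⊎ p₁ ≡ c) →
    Spans (u₁ ∷ u₂ ∷ vs) → Ear-case ⊎ Bull-case
  many-tips {v} {w} {c} {us} {vs} {es} {u₁} {u₂} {p₁} {p₂} {l₁} {l₂} {k₁} {k₂}
            end u₂∉ j₁ j₂ side₂ u₁∉ i₁ i₂ side₁ spans = go (End-edge end side₁) (End-edge end side₂)
    where
    -- Either of the two leaves may be attached last, so what holds for a last leaf holds for both.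
    end₂ = leaf end u₂∉ j₁ j₂ side₂
    end₁ = leaf end (u₁∉ ∘ there) i₁ i₂ side₁
    u₂∉₁ : u₂ ∉ u₁ ∷ vs
    u₂∉₁ (here refl) = u₁∉ (here refl)
    u₂∉₁ (there u∈)  = u₂∉ u∈
    spans′ : Spans (u₂ ∷ u₁ ∷ vs)
    spans′ x = Perm.∈-resp-↭ (swap u₁ u₂ refl) (spans x)
    go : ∃[ e ] (e ∈ es × Joins G e v p₁) → ∃[ e ] (e ∈ es × Joins G e v p₂) → Ear-case ⊎ Bull-case
    go (e , e∈ , j) (e′ , e′∈ , j′) with L₁.ear-or-third (End-model end₂) | L₂.ear-or-third (End-model end₁)
      where
      module L₁ = Leaf-of (End⇒Tree end₂) (there (there e∈)) j u₁∉ i₁ i₂ spans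
      module L₂ = Leaf-of (End⇒Tree end₁) (there (there e′∈)) j′ u₂∉₁ j₁ j₂ spans′
    ... | inj₁ ear | _ = inj₁ ear
    ... | inj₂ _ | inj₁ ear = inj₁ ear
    ... | inj₂ th₁ | inj₂ th₂ with Third.far th₁ ∈V? (u₂ ∷ us) | Third.far th₂ ∈V? (u₁ ∷ us)
    ...   | yes a₁∈ | _ = adjacent-tips end₂ u₁∉ i₁ i₂ side₁ spans th₁ a₁∈
    ...   | no _ | yes a₂∈ = adjacent-tips end₁ u₂∉₁ j₁ j₂ side₂ spans′ th₂ a₂∈
    -- Now the third edges of `u₁` and `u₂` end at no leaf, and not at the hub either, where they
    -- would be parallel to a tree edge. This is what `two-stars` needs.
    ...   | no a₁∉ | no a₂∉ = ⊥-elim (¬conn (R⇒connected G realize))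
      where
      module L₁ = Leaf-of (End⇒Tree end₂) (there (there e∈)) j u₁∉ i₁ i₂ spans
      module L₂ = Leaf-of (End⇒Tree end₁) (there (there e′∈)) j′ u₂∉₁ j₁ j₂ spans′
      open Third th₁ using () renaming (third to f₁; far to a₁; joins to m₁; third∉ to f₁∉; only to only₁)
      open Third th₂ using () renaming (third to f₂; far to a₂; joins to m₂; third∉ to f₂∉; only to only₂)
      a₁∈ : a₁ ∈ vs
      a₁∈ with spans a₁
      ... | here eq = ⊥-elim (J-≢ m₁ (sym eq))
      ... | there (here eq) = ⊥-elim (a₁∉ (here eq))
      ... | there (there a∈) = a∈
      a₂∈ : a₂ ∈ vs
      a₂∈ with spans a₂
      ... | here eq = ⊥-elim (a₂∉ (here eq))
      ... | there (here eq) = ⊥-elim (J-≢ m₂ (sym eq))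
      ... | there (there a∈) = a∈
      list = l₁ ∷ l₂ ∷ f₁ ∷ k₁ ∷ k₂ ∷ f₂ ∷ es
      u₂≢u₁ = ∈∉⇒≢ (here refl) u₁∉
      list-unique : Unique list
      list-unique =
        (J-fork i₁ i₂ (side≢hub end side₁ ∘ sym) ∷ (λ { refl → f₁∉ (here refl) }) ∷ other i₁ (∈∉⇒≢ (hub∈ end) u₂∉)) ∷
        ((λ { refl → f₁∉ (there (here refl)) }) ∷ other i₂ (∈∉⇒≢ (side∈ end side₁) u₂∉)) ∷
        other m₁ (∈∉⇒≢ a₁∈ u₂∉) ∷
        (J-fork j₁ j₂ (side≢hub end side₂ ∘ sym) ∷ (λ { refl → f₂∉ (here refl) }) ∷ All.¬Any⇒All¬ _ (fresh t u₂∉ j₁)) ∷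
        ((λ { refl → f₂∉ (there (here refl)) }) ∷ All.¬Any⇒All¬ _ (fresh t u₂∉ j₂)) ∷
        All.¬Any⇒All¬ _ (fresh t u₂∉ m₂) ∷ Tree-unique t
        where
        t = End⇒Tree end
        other : ∀ {f y} → Joins G f u₁ y → y ≢ u₂ → All (f ≢_) (k₁ ∷ k₂ ∷ f₂ ∷ es)
        other k y≢ = J-differ k j₁ u₂≢u₁ (y≢ ∘ sym) ∷ J-differ k j₂ u₂≢u₁ (y≢ ∘ sym) ∷
          J-differ k m₂ u₂≢u₁ (y≢ ∘ sym) ∷ All.¬Any⇒All¬ _ (fresh t (u₁∉ ∘ there) k)
      first : ∀ {f} → f ∈ l₁ ∷ l₂ ∷ f₁ ∷ [] → f ∈ list
      first (here eq) = here eq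
      first (there (here eq)) = there (here eq)
      first (there (there (here eq))) = there (there (here eq))
      second : ∀ {f} → f ∈ k₁ ∷ k₂ ∷ f₂ ∷ [] → f ∈ list
      second (here eq) = there (there (there (here eq)))
      second (there (here eq)) = there (there (there (there (here eq))))
      second (there (there (here eq))) = there (there (there (there (there (here eq)))))
      apart : ∀ {u} → u ∈ us → p₁ ≢ u × p₂ ≢ u × a₁ ≢ u × a₂ ≢ u × v ≢ u
      apart u∈ = proj₂ (core∉tips end u∈) side₁ , proj₂ (core∉tips end u∈) side₂ ,
        (λ { refl → a₁∉ (there u∈) }) , (λ { refl → a₂∉ (there u∈) }) , proj₁ (core∉tips {p = v} end u∈)
      zeros : β u₁ ≡ 0F × β u₂ ≡ 0F → ∃[ r ] R (_≢ r) (map (ends G) list) β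
      zeros {β} (β₁ , β₂) = End-root end , off {es = list} spans
        (R-join⁺ {G = G} i₁ (R-∷ (λ r → R-join⁺ {G = G} i₂ (R-∷ (λ r → R-join⁺ {G = G} m₁
        (R-∷ (λ r → R-join⁺ {G = G} j₁ (R-∷ (λ r → R-join⁺ {G = G} j₂ (R-∷ (R-join⁺ {G = G} m₂) r)) r)) r)) r))
        (two-stars end u₂∉ u₁∉ (side∈ end side₁) (side∈ end side₂) a₁∈ a₂∈ (side≢hub end side₁) (side≢hub end side₂)
          (L₁.far≢p th₁) (L₂.far≢p th₂) apart β₁ β₂)))
      realize : ∀ β → ∃[ r ] R (_≢ r) (pairs G) β
      realize β with β u₁ ≟ 0F | β u₂ ≟ 0F
      ... | no β₁  | _      = L₁.nonzero-realizable th₁ β₁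
      ... | yes _  | no β₂  = L₂.nonzero-realizable th₂ β₂
      ... | yes β₁ | yes β₂ = unique-R G (λ β → β u₁ ≡ 0F × β u₂ ≡ 0F) list-unique
        (λ f∉ (b₁ , b₂) → trans (unaffected (first ∘ only₁) f∉ _) b₁ , trans (unaffected (second ∘ only₂) f∉ _) b₂)
        zeros (β₁ , β₂)

  module One-tip {e k₁ k₂ e₁ e₂ : Edge G} (t : Tree vs es) (e∈ : e ∈ es) (j : Joins G e w c) (v∉ : v ∉ vs)
    (k₁j : Joins G k₁ v w) (k₂j : Joins G k₂ v c) (u∉ : u ∉ v ∷ vs) (j₁ : Joins G e₁ u v) (j₂ : Joins G e₂ u w)
    (spans : Spans (u ∷ v ∷ vs)) where

    private
      tv = grow t e∈ j v∉ k₁j k₂j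
      whole = grow tv (here refl) k₁j u∉ j₁ j₂
      w∈ = proj₁ (Tree-ends t e∈ j)
      c∈ = proj₂ (Tree-ends t e∈ j)
      module L = Leaf-of tv (here refl) k₁j u∉ j₁ j₂ spans
      v≢u = ∈∉⇒≢ (here refl) u∉
      w≢u = ∈∉⇒≢ (there w∈) u∉
      c≢u = ∈∉⇒≢ (there c∈) u∉

    module _ (th : Third u e₁ e₂) where
      open Third th

      third-new : third ∉ e₁ ∷ e₂ ∷ k₁ ∷ k₂ ∷ es
      third-new = L.old-edge joins third∉

      -- All edges at `u` and at `v` are in the list, so the other edges change neither of the two
      -- values, and the choice between source and sink at `u` can clear the value at `v`.
      hub-realizable : β u ≡ 0F → β v ≢ 0F → OnlyAt v (e₁ ∷ k₁ ∷ k₂ ∷ []) → ∃[ r ] R (_≢ r) (pairs G) β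
      hub-realizable βu βv only-v = unique-R G (λ β → β u ≡ 0F × β v ≢ 0F)
        (All.¬Any⇒All¬ _ third-new ∷ Tree-unique whole)
        (λ f∉ (b , b′) → trans (unaffected (at-u ∘ only) f∉ _) b ,
                         λ eq → b′ (trans (sym (unaffected (at-v ∘ only-v) f∉ _)) eq))
        (λ (b , b′) → root t , off {es = third ∷ e₁ ∷ e₂ ∷ k₁ ∷ k₂ ∷ es} spans
          (R-↭ (↭-trans (prep _ (swap _ _ refl)) (swap _ _ refl))
            (R-join⁺ {G = G} j₁ (R-∷ (λ r → R-join⁺ {G = G} j₂ (R-∷ (R-join⁺ {G = G} joins) r))
              (Last-two.R-hub-nonzero t e∈ j v∉ k₁j k₂j u∉ (J-≢ joins ∘ sym) (L.far≢p th) b b′)))))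
        (βu , βv)
        where
        at-u : ∀ {f} → f ∈ e₁ ∷ e₂ ∷ third ∷ [] → f ∈ third ∷ e₁ ∷ e₂ ∷ k₁ ∷ k₂ ∷ es
        at-u (here eq) = there (here eq)
        at-u (there (here eq)) = there (there (here eq))
        at-u (there (there (here eq))) = here eq
        at-v : ∀ {f} → f ∈ e₁ ∷ k₁ ∷ k₂ ∷ [] → f ∈ third ∷ e₁ ∷ e₂ ∷ k₁ ∷ k₂ ∷ es
        at-v (here eq) = there (here eq)
        at-v (there (here eq)) = there (there (there (here eq)))
        at-v (there (there (here eq))) = there (there (there (there (here eq))))

      -- `R-hub-extra` copes with every value at `v`. Hence only the value at `u` has to survive the
      -- arbitrary directions of the other edges, and `v` may have any number of them.
      hub-extra : ∀ {g} → Incident g v → g ∉ e₁ ∷ k₁ ∷ k₂ ∷ [] → ⊥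
      hub-extra {g} inc g∉ = ¬conn (R⇒connected G realize)
        where
        far′ = proj₁ (incident⇒J inc)
        l : Joins G g v far′
        l = proj₂ (incident⇒J inc)
        d≢u : far′ ≢ u
        d≢u refl with only (J⇒incident (J-sym l))
        ... | here refl = g∉ (here refl)
        ... | there (here refl) = J-≢ k₁j (J-other j₂ (J-sym l))
        ... | there (there (here refl)) = L.far≢p th (J-other (J-sym l) joins)
        g-new : g ∉ k₁ ∷ k₂ ∷ es
        g-new (here eq) = g∉ (there (here eq))
        g-new (there (here eq)) = g∉ (there (there (here eq)))
        g-new (there (there g∈)) = fresh t v∉ l g∈
        list = third ∷ e₁ ∷ e₂ ∷ g ∷ k₁ ∷ k₂ ∷ es
        list-unique : Unique list
        list-unique with Tree-unique whole
        ... | (e₁≢e₂ ∷ e₁≢) ∷ (e₂≢ ∷ rest) =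
          ((λ { refl → third∉ (here refl) }) ∷ (λ { refl → third∉ (there (here refl)) }) ∷
            J-differ joins l v≢u (L.far≢p th ∘ sym) ∷ All.¬Any⇒All¬ _ (λ f∈ → third-new (there (there f∈)))) ∷
          (e₁≢e₂ ∷ (λ { refl → g∉ (here refl) }) ∷ e₁≢) ∷
          (J-differ j₂ l v≢u (J-≢ k₁j) ∷ e₂≢) ∷ All.¬Any⇒All¬ _ g-new ∷ rest
        at-u : ∀ {f} → f ∈ e₁ ∷ e₂ ∷ third ∷ [] → f ∈ list
        at-u (here eq) = there (here eq)
        at-u (there (here eq)) = there (there (here eq))
        at-u (there (there (here eq))) = here eq
        realize : ∀ β → ∃[ r ] R (_≢ r) (pairs G) β
        realize β with β u ≟ 0F
        ... | no βu  = L.nonzero-realizable th βu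
        ... | yes βu = unique-R G (λ β → β u ≡ 0F) list-unique
          (λ f∉ b → trans (unaffected (at-u ∘ only) f∉ _) b)
          (λ b → root t , off {es = list} spans
            (R-↭ (↭-trans (prep _ (swap _ _ refl)) (swap _ _ refl))
              (R-join⁺ {G = G} j₁ (R-∷ (λ r → R-join⁺ {G = G} j₂ (R-∷ (R-join⁺ {G = G} joins) r))
                (Last-two.R-hub-extra t e∈ j v∉ k₁j k₂j u∉ (J-≢ joins ∘ sym) (L.far≢p th) l d≢u b))))) βu

      only-hub : OnlyAt v (e₁ ∷ k₁ ∷ k₂ ∷ [])
      only-hub {g} inc = decidable-stable (g ∈E? (e₁ ∷ k₁ ∷ k₂ ∷ [])) (hub-extra inc)

      -- In contrast to `adjacent-tips`, the hub is here one of the two vertices of degree three: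
      -- the common neighbour is `w`, and the third neighbour of the hub is `c`.
      one-tip-bull : Model vs es → Bull-case
      one-tip-bull m = bull-case j₁ j₂ joins k₁j k₂j (L.far≢p th) (L.far≢q th)
        c≢u (J-≢ j ∘ sym) only only-hub t m (u∉ ∘ there) v∉ others
        (L.nonzero-realizable th) (λ βu βv → hub-realizable βu βv only-hub)
        where
        others : ∀ x → x ≢ u → x ≢ v → x ∈ vs
        others x x≢u x≢v with spans x
        ... | here eq = ⊥-elim (x≢u eq)
        ... | there (here eq) = ⊥-elim (x≢v eq)
        ... | there (there x∈) = x∈

      -- The third edge of `u` must end at `c`, since at `v` or `w` it would be parallel to a tree
      -- edge. All edges at `u` and `v` are then known, and the only other edge is `e`, which has no
      -- parallel.
      one-tip-K₄ : (∀ x → x ∈ vs → x ∈ w ∷ c ∷ []) → (∀ g → g ∈ es → g ≡ e) → G ≅ K₄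
      one-tip-K₄ only-wc only-e = ≅-sym ι surjV surjE
        where
        verts = u ∷ v ∷ w ∷ c ∷ []
        edges = e₁ ∷ e₂ ∷ third ∷ k₁ ∷ k₂ ∷ e ∷ []
        all-verts : ∀ x → x ∈ verts
        all-verts x with spans x
        ... | here eq = here eq
        ... | there (here eq) = there (here eq)
        ... | there (there x∈) = there (there (only-wc x x∈))
        far≡c : far ≡ c
        far≡c with all-verts far
        ... | here eq = ⊥-elim (J-≢ joins (sym eq))
        ... | there (here eq) = ⊥-elim (L.far≢p th eq)
        ... | there (there (here eq)) = ⊥-elim (L.far≢q th eq)
        ... | there (there (there (here eq))) = eq
        verts-unique : Unique verts
        verts-unique = (v≢u ∘ sym ∷ w≢u ∘ sym ∷ c≢u ∘ sym ∷ []) ∷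
          (J-≢ k₁j ∷ J-≢ k₂j ∷ []) ∷ (J-≢ j ∷ []) ∷ [] ∷ []
        in-tree : ∀ {g} → g ∈ e₁ ∷ e₂ ∷ k₁ ∷ k₂ ∷ es → g ∈ edges
        in-tree (here eq) = here eq
        in-tree (there (here eq)) = there (here eq)
        in-tree (there (there (here eq))) = there (there (there (here eq)))
        in-tree (there (there (there (here eq)))) = there (there (there (there (here eq))))
        in-tree (there (there (there (there g∈)))) = there (there (there (there (there (here (only-e _ g∈))))))
        at-u : ∀ {g} → g ∈ e₁ ∷ e₂ ∷ third ∷ [] → g ∈ edges
        at-u (here eq) = here eq
        at-u (there (here eq)) = there (here eq)
        at-u (there (there (here eq))) = there (there (here eq))
        at-v : ∀ {g} → g ∈ e₁ ∷ k₁ ∷ k₂ ∷ [] → g ∈ edges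
        at-v (here eq) = here eq
        at-v (there (here eq)) = there (there (there (here eq)))
        at-v (there (there (here eq))) = there (there (there (there (here eq))))
        all-edges : ∀ g → g ∈ edges
        all-edges g with all-verts (src G g) | all-verts (tgt G g)
        ... | here eq | _ = at-u (only (inj₁ eq))
        ... | _ | here eq = at-u (only (inj₂ eq))
        ... | there (here eq) | _ = at-v (only-hub (inj₁ eq))
        ... | _ | there (here eq) = at-v (only-hub (inj₂ eq))
        ... | there (there (here s)) | there (there (here t)) = ⊥-elim (loopless G g (trans s (sym t)))
        ... | there (there (there (here s))) | there (there (there (here t))) = ⊥-elim (loopless G g (trans s (sym t)))
        ... | there (there (here s)) | there (there (there (here t))) =
          in-tree (no-parallel whole spans (there (there (there (there e∈)))) j (inj₁ (s , t)))
        ... | there (there (there (here s))) | there (there (here t)) =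
          in-tree (no-parallel whole spans (there (there (there (there e∈)))) j (inj₂ (s , t)))
        edges-unique : Unique edges
        edges-unique with Tree-unique whole
        ... | (e₁≢e₂ ∷ e₁≢k₁ ∷ e₁≢k₂ ∷ e₁≢) ∷ (e₂≢k₁ ∷ e₂≢k₂ ∷ e₂≢) ∷ (k₁≢k₂ ∷ k₁≢) ∷ k₂≢ ∷ _ =
          (e₁≢e₂ ∷ (λ { refl → third-new (here refl) }) ∷ e₁≢k₁ ∷ e₁≢k₂ ∷ All.lookup e₁≢ e∈ ∷ []) ∷
          ((λ { refl → third-new (there (here refl)) }) ∷ e₂≢k₁ ∷ e₂≢k₂ ∷ All.lookup e₂≢ e∈ ∷ []) ∷
          ((λ { refl → third-new (there (there (here refl))) }) ∷
            (λ { refl → third-new (there (there (there (here refl)))) }) ∷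
            (λ { refl → third-new (there (there (there (there e∈)))) }) ∷ []) ∷
          (k₁≢k₂ ∷ All.lookup k₁≢ e∈ ∷ []) ∷ (All.lookup k₂≢ e∈ ∷ []) ∷ [] ∷ []
        ι : K₄ ↪ G
        ι = record
          { onV = lookup verts ; onE = lookup edges
          ; onV-inj = lookup-injective verts-unique ; onE-inj = lookup-injective edges-unique
          ; onE-joins = λ { 0F → j₁ ; 1F → j₂ ; 2F → subst (Joins G third u) far≡c joins
                          ; 3F → k₁j ; 4F → k₂j ; 5F → j } }
        surjV : ∀ x → ∃[ y ] lookup verts y ≡ x
        surjV x = index (all-verts x) , sym (lookup-index (all-verts x))
        surjE : ∀ g → ∃[ f ] lookup edges f ≡ g
        surjE g = index (all-edges g) , sym (lookup-index (all-edges g))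

      -- Deleting `u` and `v` leaves the tree `t`. If it is a bare edge, it yields no spanning
      -- triangle-tree of the reduction; but then `G` has only four vertices and is `K₄`.
      one-tip-third : Conclusion
      one-tip-third with model t
      ... | inj₂ m = inj₂ (inj₂ (one-tip-bull m))
      ... | inj₁ (is-edge {e′} {x} {y} k p q) = inj₁ (inj₂ (one-tip-K₄ only-wc only-e))
        where
        only-e : ∀ g → g ∈ es → g ≡ e
        only-e g g∈ with Perm.∈-resp-↭ (↭-sym q) g∈ | Perm.∈-resp-↭ (↭-sym q) e∈
        ... | here refl | here refl = refl
        ends-k : (w ≡ x × c ≡ y) ⊎ (w ≡ y × c ≡ x)
        ends-k with Perm.∈-resp-↭ (↭-sym q) e∈
        ... | here refl = J-unique k j
        only-wc : ∀ x → x ∈ vs → x ∈ w ∷ c ∷ []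
        only-wc z z∈ with Perm.∈-resp-↭ (↭-sym p) z∈ | ends-k
        ... | here refl | inj₁ (refl , refl) = here refl
        ... | here refl | inj₂ (refl , refl) = there (here refl)
        ... | there (here refl) | inj₁ (refl , refl) = there (here refl)
        ... | there (here refl) | inj₂ (refl , refl) = here refl

    one-tip : Conclusion
    one-tip = [ inj₂ ∘ inj₁ , one-tip-third ]′ (L.ear-or-third (grown-model t e∈ j v∉ k₁j k₂j))

  spanned : Tree vs es → (∀ x → x ∈ vs) → ¬ IsEdge vs es → Conclusion
  spanned t spans ¬edge with shape t
  ... | is-edge j p q = ⊥-elim (¬edge (Models.is-edge j p q))
  ... | is-triangle {x} {y} {z} {a} {b} {c} i j k x∉ p q = inj₁ (inj₁ (≅-sym ι surjV surjE))
    where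
    ι = triangle-↪ i j k
    verts : Spans (x ∷ y ∷ z ∷ [])
    verts v = Perm.∈-resp-↭ (↭-sym p) (spans v)
    t′ = perm (↭-sym p) (↭-sym q) t
    edges : ∀ g → g ∈ a ∷ b ∷ c ∷ []
    edges g with verts (src G g) | verts (tgt G g)
    ... | here s | here t = ⊥-elim (loopless G g (trans s (sym t)))
    ... | here s | there (here t) = no-parallel t′ verts (here refl) i (inj₁ (s , t))
    ... | here s | there (there (here t)) = no-parallel t′ verts (there (here refl)) j (inj₁ (s , t))
    ... | there (here s) | here t = no-parallel t′ verts (here refl) i (inj₂ (s , t))
    ... | there (here s) | there (here t) = ⊥-elim (loopless G g (trans s (sym t)))
    ... | there (here s) | there (there (here t)) = no-parallel t′ verts (there (there (here refl))) k (inj₁ (s , t))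
    ... | there (there (here s)) | here t = no-parallel t′ verts (there (here refl)) j (inj₂ (s , t))
    ... | there (there (here s)) | there (here t) = no-parallel t′ verts (there (there (here refl))) k (inj₂ (s , t))
    ... | there (there (here s)) | there (there (here t)) = ⊥-elim (loopless G g (trans s (sym t)))
    surjV : ∀ v → ∃[ y ] onV ι y ≡ v
    surjV v = index (verts v) , sym (lookup-index (verts v))
    surjE : ∀ g → ∃[ f ] onE ι f ≡ g
    surjE g = index (edges g) , sym (lookup-index (edges g))
  ... | has-end (v , w , c , l) = go l.end l.tip∉ l.j₁ l.j₂ l.side
          (λ x → Perm.∈-resp-↭ (↭-sym l.vs↭) (spans x))
    where
    module l = LastLeaf l
    go : ∀ {us vs es u p e₁ e₂} → End v w c us vs es → u ∉ vs → Joins G e₁ u v → Joins G e₂ u p →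
         p ≡ w ⊎ p ≡ c → Spans (u ∷ vs) → Conclusion
    go (base t e∈ j v∉ k₁ k₂) u∉ j₁ j₂ (inj₁ refl) spans = One-tip.one-tip t e∈ j v∉ k₁ k₂ u∉ j₁ j₂ spans
    -- A leaf on vc is brought to the edge vw by exchanging the roles of `w` and `c`.
    go (base t e∈ j v∉ k₁ k₂) u∉ j₁ j₂ (inj₂ refl) spans = One-tip.one-tip t e∈ (J-sym j) v∉ k₂ k₁ u∉ j₁ j₂ spans
    go (leaf end u₂∉ k₁ k₂ side₂) u∉ j₁ j₂ side spans =
      inj₂ (many-tips end u₂∉ k₁ k₂ side₂ u∉ j₁ j₂ side spans)

3≤order : ∀ {T} → TriangleTree T → 3 ℕ.≤ order T
3≤order triangle   = ℕ.≤-refl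
3≤order (grow t _) = ℕ.m≤n⇒m≤1+n (3≤order t)

theorem1p9 : (G : Graph) → HasSpanningTriangleTree G →
    (¬ Z₃-Connected G) ⇔
    ( (G ≅ K₃ ⊎ G ≅ K₄)
    ⊎ (∃[ G₁ ] (G ≡ K₃ ⊕₂ G₁ × ¬ Z₃-Connected G₁ × HasSpanningTriangleTree G₁))
    ⊎ (∃[ H ] (G IsBullGrowingOf H × ¬ Z₃-Connected H × HasSpanningTriangleTree H)))
theorem1p9 G (T , tree , ι , V) = mk⇔ forward backward
  where
  spans : ∀ x → x ∈ tabulate (onV ι)
  spans x = let y , eq = ∈-V⁻ ι (≡⊤⇒∈ V x) in subst (_∈ tabulate (onV ι)) eq (∈-tabulate⁺ y)
  ¬edge : ¬ Models.IsEdge G (tabulate (onV ι)) (tabulate (onE ι))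
  ¬edge (Models.is-edge _ p _) = contradiction
    (subst (3 ℕ.≤_) (sym (trans (Perm.↭-length p) (List.length-tabulate (onV ι)))) (3≤order tree))
    λ { (ℕ.s≤s (ℕ.s≤s ())) }
  forward = λ ¬conn → Cases.spanned G ¬conn (TriangleTree⇒Tree tree ι) spans ¬edge
  backward : _ → ¬ Z₃-Connected G
  backward (inj₁ (inj₁ iso)) = ≅K₃⇒¬connected iso
  backward (inj₁ (inj₂ iso)) = ≅K₄⇒¬connected iso
  backward (inj₂ (inj₁ (_ , sum , ¬conn , _)))  = ¬conn ∘ ⊕₂-connected⁻ sum
  backward (inj₂ (inj₂ (_ , bull , ¬conn , _))) = ¬conn ∘ bullReduction-connected bull
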